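{- Let $\frac12<\sigma<1$, $\boldsymbol\theta=(\theta_1,\theta_2)\in\mathbb{R}^2$, and let $\boldsymbol\chi=(\chi_1,\chi_2)$ be a pair of Dirichlet characters with $\chi_1\not\sim\chi_2$. Then $$\tilde\xi(\sigma,\boldsymbol\chi,\boldsymbol\theta)\ \ge\ 2^{\frac{1}{2(1-\sigma)}}.$$ In particular, $\tilde\xi(\sigma,\boldsymbol\chi,\boldsymbol\theta)>2$.
   Context: Two Dirichlet characters are equivalent, $\chi_1\sim\chi_2$, if they are induced by the same primitive character. With $d$ the least common multiple of the moduli of $\chi_1,\chi_2$, $\phi$ the Euler totient function and $\boldsymbol1=(1,1)$, $$\xi(\sigma,\boldsymbol\chi,\boldsymbol\theta;\boldsymbol1)=\frac1{\phi(d)}\sum_{u\in(\mathbb{Z}/d\mathbb{Z})^\times}\bigl|e^{ -i\theta_1}\chi_1(u)+e^{ -i\theta_2}\chi_2(u)\bigr|^{1/\sigma},\qquad \tilde\xi(\sigma,\boldsymbol\chi,\boldsymbol\theta)=2^{\frac1{1-\sigma}}\bigl(\xi(\sigma,\boldsymbol\chi,\boldsymbol\theta;\boldsymbol 1)\bigr)^{\frac{ -\sigma}{1-\sigma}}.$$ -}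

module Defs where

open import Axiom.ExcludedMiddle using (ExcludedMiddle)
open import Data.Integer.Base as ℤ using (ℤ)
open import Data.List.Base using (List; []; _∷_; upTo; filter; length)
open import Data.Nat.Base as ℕ using (ℕ; zero; suc)
open import Data.Nat.Coprimality using (Coprime; coprime?)
open import Data.Nat.Divisibility using (_∣_)
open import Data.Nat.LCM using (lcm)
import Data.Nat.Properties as ℕₚ
open import Data.Product.Base using (Σ; ∃; _×_; _,_)
open import Data.Rational.Base as ℚ using (ℚ; 0ℚ; 1ℚ)
import Data.Rational.Properties as ℚₚ
open import Data.Rational.Solver using (module +-*-Solver)
open import Level using (0ℓ)
open import Relation.Binary.PropositionalEquality
  using (_≡_; refl; sym; trans; cong; subst)
open import Relation.Nullary using (¬_; yes; no)

------------------------------------------------------------------------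
-- Real numbers: Cauchy sequences of rationals, with the setoid equality
-- "the difference tends to 0".

IsCauchy : (ℕ → ℚ) → Set
IsCauchy s = ∀ ε → 0ℚ ℚ.< ε →
  ∃ λ N → ∀ m n → N ℕ.≤ m → N ℕ.≤ n → ℚ.∣ s m ℚ.- s n ∣ ℚ.< ε

record ℝ : Set where
  constructor mkℝ
  field
    seq    : ℕ → ℚ
    cauchy : IsCauchy seq

open ℝ public

infix 4 _≈_ _<_ _≤_ _>_ _≥_

_≈_ : ℝ → ℝ → Set
x ≈ y = ∀ ε → 0ℚ ℚ.< ε →
  ∃ λ N → ∀ n → N ℕ.≤ n → ℚ.∣ seq x n ℚ.- seq y n ∣ ℚ.< ε

_<_ : ℝ → ℝ → Set
x < y = ∃ λ ε → 0ℚ ℚ.< ε ×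
  ∃ λ N → ∀ n → N ℕ.≤ n → seq x n ℚ.+ ε ℚ.< seq y n

_≤_ : ℝ → ℝ → Set
x ≤ y = ∀ ε → 0ℚ ℚ.< ε →
  ∃ λ N → ∀ n → N ℕ.≤ n → seq x n ℚ.< seq y n ℚ.+ ε

_>_ : ℝ → ℝ → Set
x > y = y < x

_≥_ : ℝ → ℝ → Set
x ≥ y = y ≤ x

private
  open +-*-Solver using (solve; _:=_; _:+_; _:*_; _:-_; :-_)

  halves : ∀ ε → ℚ.½ ℚ.* ε ℚ.+ ℚ.½ ℚ.* ε ≡ ε
  halves ε = trans (sym (ℚₚ.*-distribʳ-+ ε ℚ.½ ℚ.½)) (ℚₚ.*-identityˡ ε)

  half>0 : ∀ {ε} → 0ℚ ℚ.< ε → 0ℚ ℚ.< ℚ.½ ℚ.* ε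
  half>0 {ε} ε>0 = ℚₚ.positive⁻¹ (ℚ.½ ℚ.* ε)
    where instance _ = ℚₚ.pos*pos⇒pos ℚ.½ ε {{ℚ.positive ε>0}}

  abstract
    +-cauchy : ∀ {s t} → IsCauchy s → IsCauchy t → IsCauchy (λ n → s n ℚ.+ t n)
    +-cauchy {s} {t} cs ct ε ε>0 =
      let M , hs = cs (ℚ.½ ℚ.* ε) (half>0 ε>0)
          N , ht = ct (ℚ.½ ℚ.* ε) (half>0 ε>0)
      in M ℕ.⊔ N , λ m n p q → begin-strict
        ℚ.∣ (s m ℚ.+ t m) ℚ.- (s n ℚ.+ t n) ∣
          ≡⟨ cong ℚ.∣_∣ (solve 4 (λ a b c d →
               (a :+ b) :- (c :+ d) := (a :- c) :+ (b :- d)) refl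
               (s m) (t m) (s n) (t n)) ⟩
        ℚ.∣ (s m ℚ.- s n) ℚ.+ (t m ℚ.- t n) ∣
          ≤⟨ ℚₚ.∣p+q∣≤∣p∣+∣q∣ (s m ℚ.- s n) (t m ℚ.- t n) ⟩
        ℚ.∣ s m ℚ.- s n ∣ ℚ.+ ℚ.∣ t m ℚ.- t n ∣
          <⟨ ℚₚ.+-mono-< {ℚ.∣ s m ℚ.- s n ∣} {ℚ.½ ℚ.* ε}
               {ℚ.∣ t m ℚ.- t n ∣} {ℚ.½ ℚ.* ε}
               (hs m n (ℕₚ.m⊔n≤o⇒m≤o M N p) (ℕₚ.m⊔n≤o⇒m≤o M N q))
               (ht m n (ℕₚ.m⊔n≤o⇒n≤o M N p) (ℕₚ.m⊔n≤o⇒n≤o M N q)) ⟩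
        ℚ.½ ℚ.* ε ℚ.+ ℚ.½ ℚ.* ε
          ≡⟨ halves ε ⟩
        ε ∎
      where open ℚₚ.≤-Reasoning

    neg-cauchy : ∀ {s} → IsCauchy s → IsCauchy (λ n → ℚ.- s n)
    neg-cauchy {s} cs ε ε>0 with cs ε ε>0
    ... | N , h = N , λ m n p q →
      subst (ℚ._< ε)
        (trans (sym (ℚₚ.∣-p∣≡∣p∣ (s m ℚ.- s n)))
          (cong ℚ.∣_∣ (solve 2 (λ a b → :- (a :- b) := (:- a) :- (:- b)) refl (s m) (s n))))
        (h m n p q)

    const-cauchy : ∀ q → IsCauchy (λ _ → q)
    const-cauchy q ε ε>0 = 0 , λ _ _ _ _ →
      subst (ℚ._< ε) (sym (cong ℚ.∣_∣ (ℚₚ.+-inverseʳ q))) ε>0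

    eventually-bounded : ∀ {s} → IsCauchy s →
      ∃ λ B → 0ℚ ℚ.< B × ∃ λ N → ∀ n → N ℕ.≤ n → ℚ.∣ s n ∣ ℚ.< B
    eventually-bounded {s} cs with cs 1ℚ (ℚₚ.positive⁻¹ 1ℚ)
    ... | N , h = 1ℚ ℚ.+ ℚ.∣ s N ∣
                , ℚₚ.+-mono-<-≤ (ℚₚ.positive⁻¹ 1ℚ) (ℚₚ.0≤∣p∣ (s N))
                , N , λ n p → begin-strict
        ℚ.∣ s n ∣
          ≡⟨ cong ℚ.∣_∣ (solve 2 (λ a b → a := (a :- b) :+ b) refl (s n) (s N)) ⟩
        ℚ.∣ (s n ℚ.- s N) ℚ.+ s N ∣
          ≤⟨ ℚₚ.∣p+q∣≤∣p∣+∣q∣ (s n ℚ.- s N) (s N) ⟩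
        ℚ.∣ s n ℚ.- s N ∣ ℚ.+ ℚ.∣ s N ∣
          <⟨ ℚₚ.+-monoˡ-< ℚ.∣ s N ∣ (h n N p ℕₚ.≤-refl) ⟩
        1ℚ ℚ.+ ℚ.∣ s N ∣ ∎
      where open ℚₚ.≤-Reasoning

    product-< : ∀ a {b A δ} → 0ℚ ℚ.< A → ℚ.∣ a ∣ ℚ.< A → ℚ.∣ b ∣ ℚ.< δ →
                ℚ.∣ a ℚ.* b ∣ ℚ.< A ℚ.* δ
    product-< a {b} {A} {δ} A>0 a<A b<δ = begin-strict
        ℚ.∣ a ℚ.* b ∣         ≡⟨ ℚₚ.∣p*q∣≡∣p∣*∣q∣ a b ⟩
        ℚ.∣ a ∣ ℚ.* ℚ.∣ b ∣   ≤⟨ ℚₚ.*-monoʳ-≤-nonNeg ℚ.∣ b ∣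
                                   {{ℚₚ.∣-∣-nonNeg b}} (ℚₚ.<⇒≤ a<A) ⟩
        A ℚ.* ℚ.∣ b ∣         <⟨ ℚₚ.*-monoʳ-<-pos A {{ℚ.positive A>0}} b<δ ⟩
        A ℚ.* δ               ∎
      where open ℚₚ.≤-Reasoning

    divide : ∀ C {ε} → 0ℚ ℚ.< C → 0ℚ ℚ.< ε → ∃ λ δ → 0ℚ ℚ.< δ × C ℚ.* δ ≡ ε
    divide C {ε} C>0 ε>0 = ℚ.1/ C ℚ.* ε
      , ℚₚ.positive⁻¹ (ℚ.1/ C ℚ.* ε)
          {{ℚₚ.pos*pos⇒pos (ℚ.1/ C) {{ℚₚ.1/pos⇒pos C}} ε {{ℚ.positive ε>0}}}}
      , trans (sym (ℚₚ.*-assoc C (ℚ.1/ C) ε))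
          (trans (cong (ℚ._* ε) (ℚₚ.*-inverseʳ C)) (ℚₚ.*-identityˡ ε))
      where
      instance
        C-pos : ℚ.Positive C
        C-pos = ℚ.positive C>0
        C-nonZero : ℚ.NonZero C
        C-nonZero = ℚₚ.pos⇒nonZero C

    *-difference-< : ∀ a b c d {A B δ} → 0ℚ ℚ.< A → 0ℚ ℚ.< B →
      ℚ.∣ a ∣ ℚ.< A → ℚ.∣ d ∣ ℚ.< B →
      ℚ.∣ a ℚ.- c ∣ ℚ.< δ → ℚ.∣ b ℚ.- d ∣ ℚ.< δ →
      ℚ.∣ a ℚ.* b ℚ.- c ℚ.* d ∣ ℚ.< (A ℚ.+ B) ℚ.* δ
    *-difference-< a b c d {A} {B} {δ} A>0 B>0 a<A d<B a-c<δ b-d<δ = begin-strict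
        ℚ.∣ a ℚ.* b ℚ.- c ℚ.* d ∣
          ≡⟨ cong ℚ.∣_∣ (identity a b c d) ⟩
        ℚ.∣ a ℚ.* (b ℚ.- d) ℚ.+ d ℚ.* (a ℚ.- c) ∣
          ≤⟨ ℚₚ.∣p+q∣≤∣p∣+∣q∣ (a ℚ.* (b ℚ.- d)) (d ℚ.* (a ℚ.- c)) ⟩
        ℚ.∣ a ℚ.* (b ℚ.- d) ∣ ℚ.+ ℚ.∣ d ℚ.* (a ℚ.- c) ∣
          <⟨ ℚₚ.+-mono-< {ℚ.∣ a ℚ.* (b ℚ.- d) ∣} {A ℚ.* δ}
               {ℚ.∣ d ℚ.* (a ℚ.- c) ∣} {B ℚ.* δ}
               (product-< a {b ℚ.- d} A>0 a<A b-d<δ)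
               (product-< d {a ℚ.- c} B>0 d<B a-c<δ) ⟩
        A ℚ.* δ ℚ.+ B ℚ.* δ
          ≡⟨ sym (ℚₚ.*-distribʳ-+ δ A B) ⟩
        (A ℚ.+ B) ℚ.* δ ∎
      where
      open ℚₚ.≤-Reasoning
      identity : ∀ a b c d →
        a ℚ.* b ℚ.- c ℚ.* d ≡ a ℚ.* (b ℚ.- d) ℚ.+ d ℚ.* (a ℚ.- c)
      identity = solve 4 (λ a b c d →
        a :* b :- c :* d := a :* (b :- d) :+ d :* (a :- c)) refl

    *-cauchy : ∀ {s t} → IsCauchy s → IsCauchy t → IsCauchy (λ n → s n ℚ.* t n)
    *-cauchy {s} {t} cs ct ε ε>0 =
      let A , A>0 , K , s<A = eventually-bounded {s} cs
          B , B>0 , L , t<B = eventually-bounded {t} ct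
          δ , δ>0 , [A+B]δ≡ε = divide (A ℚ.+ B) {ε}
            (ℚₚ.+-mono-< {0ℚ} {A} {0ℚ} {B} A>0 B>0) ε>0
          M , hs = cs δ δ>0
          N , ht = ct δ δ>0
      in K ℕ.⊔ L ℕ.⊔ (M ℕ.⊔ N) , λ m n p q →
        let p₁ = ℕₚ.m⊔n≤o⇒m≤o (K ℕ.⊔ L) (M ℕ.⊔ N) p
            p₂ = ℕₚ.m⊔n≤o⇒n≤o (K ℕ.⊔ L) (M ℕ.⊔ N) p
            q₁ = ℕₚ.m⊔n≤o⇒m≤o (K ℕ.⊔ L) (M ℕ.⊔ N) q
            q₂ = ℕₚ.m⊔n≤o⇒n≤o (K ℕ.⊔ L) (M ℕ.⊔ N) q
        in subst (ℚ.∣ s m ℚ.* t m ℚ.- s n ℚ.* t n ∣ ℚ.<_) [A+B]δ≡ε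
             (*-difference-< (s m) (t m) (s n) (t n) {A} {B} {δ} A>0 B>0
               (s<A m (ℕₚ.m⊔n≤o⇒m≤o K L p₁))
               (t<B n (ℕₚ.m⊔n≤o⇒n≤o K L q₁))
               (hs m n (ℕₚ.m⊔n≤o⇒m≤o M N p₂) (ℕₚ.m⊔n≤o⇒m≤o M N q₂))
               (ht m n (ℕₚ.m⊔n≤o⇒n≤o M N p₂) (ℕₚ.m⊔n≤o⇒n≤o M N q₂)))

infixl 6 _+_ _-_
infixl 7 _*_
infix  8 -_

fromℚ : ℚ → ℝ
fromℚ q = mkℝ (λ _ → q) (const-cauchy q)

fromℕ : ℕ → ℝ
fromℕ n = fromℚ (ℤ.+ n ℚ./ 1)

0ℝ 1ℝ 2ℝ ½ : ℝ
0ℝ = fromℕ 0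
1ℝ = fromℕ 1
2ℝ = fromℕ 2
½  = fromℚ ℚ.½

_+_ : ℝ → ℝ → ℝ
x + y = mkℝ (λ n → seq x n ℚ.+ seq y n) (+-cauchy {seq x} {seq y} (cauchy x) (cauchy y))

-_ : ℝ → ℝ
- x = mkℝ (λ n → ℚ.- seq x n) (neg-cauchy {seq x} (cauchy x))

_-_ : ℝ → ℝ → ℝ
x - y = x + (- y)

_*_ : ℝ → ℝ → ℝ
x * y = mkℝ (λ n → seq x n ℚ.* seq y n) (*-cauchy {seq x} {seq y} (cauchy x) (cauchy y))

∑ : ∀ {A : Set} → List A → (A → ℝ) → ℝ
∑ []       f = 0ℝ
∑ (a ∷ as) f = f a + ∑ as f

ConvergesTo : (ℕ → ℝ) → ℝ → Set
ConvergesTo a L = ∀ ε → 0ℝ < ε →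
  ∃ λ N → ∀ n → N ℕ.≤ n → L - ε < a n × a n < L + ε

------------------------------------------------------------------------
-- Complex numbers

infix 4 _≈ᶜ_
infixl 6 _+ᶜ_
infixl 7 _*ᶜ_ _·ᶜ_

record ℂ : Set where
  constructor _+i_
  field
    re im : ℝ

open ℂ public

_≈ᶜ_ : ℂ → ℂ → Set
z ≈ᶜ w = re z ≈ re w × im z ≈ im w

0ℂ 1ℂ : ℂ
0ℂ = 0ℝ +i 0ℝ
1ℂ = 1ℝ +i 0ℝ

_+ᶜ_ : ℂ → ℂ → ℂ
z +ᶜ w = (re z + re w) +i (im z + im w)

_*ᶜ_ : ℂ → ℂ → ℂ
z *ᶜ w = (re z * re w - im z * im w) +i (re z * im w + im z * re w)

_·ᶜ_ : ℝ → ℂ → ℂ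
r ·ᶜ z = (r * re z) +i (r * im z)

_^ᶜ_ : ℂ → ℕ → ℂ
z ^ᶜ zero  = 1ℂ
z ^ᶜ suc n = z *ᶜ (z ^ᶜ n)

1/_! : ℕ → ℚ
1/ n ! = (ℤ.+ 1 ℚ./ n ℕ.!) {{n ℕₚ.!≢0}}

-- expSum z n = Σ_{k<n} zᵏ / k!
expSum : ℂ → ℕ → ℂ
expSum z zero    = 0ℂ
expSum z (suc n) = expSum z n +ᶜ (fromℚ (1/ n !) ·ᶜ (z ^ᶜ n))

------------------------------------------------------------------------
-- Dirichlet characters, as functions on ℤ

record DirichletCharacter : Set where
  field
    modulus         : ℕ
    modulus-nonZero : ℕ.NonZero modulus
    ⟦_⟧             : ℤ → ℂ
    periodic        : ∀ n → ⟦ n ℤ.+ ℤ.+ modulus ⟧ ≈ᶜ ⟦ n ⟧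
    multiplicative  : ∀ m n → ⟦ m ℤ.* n ⟧ ≈ᶜ ⟦ m ⟧ *ᶜ ⟦ n ⟧
    coprime⇒≉0      : ∀ n → Coprime ℤ.∣ n ∣ modulus → ¬ (⟦ n ⟧ ≈ᶜ 0ℂ)
    ¬coprime⇒≈0     : ∀ n → ¬ Coprime ℤ.∣ n ∣ modulus → ⟦ n ⟧ ≈ᶜ 0ℂ

open DirichletCharacter public

Induces : DirichletCharacter → DirichletCharacter → Set
Induces ψ χ = modulus ψ ∣ modulus χ ×
  (∀ n → Coprime ℤ.∣ n ∣ (modulus χ) → ⟦ χ ⟧ n ≈ᶜ ⟦ ψ ⟧ n)

IsPrimitive : DirichletCharacter → Set
IsPrimitive χ = ∀ ψ → Induces ψ χ → modulus ψ ≡ modulus χ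

infix 4 _∼_

_∼_ : DirichletCharacter → DirichletCharacter → Set
χ₁ ∼ χ₂ = ∃ λ χ* → IsPrimitive χ* × Induces χ* χ₁ × Induces χ* χ₂

-- Representatives in {0, …, d - 1} of the classes in (ℤ/dℤ)ˣ, for d ≥ 1.
units : ℕ → List ℕ
units d = filter (λ u → coprime? u d) (upTo d)

φ : ℕ → ℕ
φ d = length (units d)

------------------------------------------------------------------------
-- Analysis over ℝ. Excluded middle turns unique existence into total
-- functions; each is 0 where no value with the defining property exists.

module Classical (lem : ExcludedMiddle 0ℓ) where

  the : (ℝ → Set) → ℝ
  the P with lem {Σ ℝ P}
  ... | yes (x , _) = x
  ... | no _        = 0ℝ

  infix  9 _⁻¹
  infixl 7 _÷_
  infixr 8 _^_

  _⁻¹ : ℝ → ℝ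
  x ⁻¹ = the (λ y → x * y ≈ 1ℝ)

  _÷_ : ℝ → ℝ → ℝ
  x ÷ y = x * y ⁻¹

  sqrt : ℝ → ℝ
  sqrt x = the (λ y → 0ℝ ≤ y × y * y ≈ x)

  lim : (ℕ → ℝ) → ℝ
  lim a = the (ConvergesTo a)

  ∣_∣ᶜ : ℂ → ℝ
  ∣ z ∣ᶜ = sqrt (re z * re z + im z * im z)

  expᶜ : ℂ → ℂ
  expᶜ z = lim (λ n → re (expSum z n)) +i lim (λ n → im (expSum z n))

  exp : ℝ → ℝ
  exp x = re (expᶜ (x +i 0ℝ))

  log : ℝ → ℝ
  log x = the (λ y → exp y ≈ x)

  -- Real powers of a nonnegative base; the value 0 for x ≤ 0 is the
  -- usual one when x ≈ 0 and y > 0, and conventional otherwise.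
  _^_ : ℝ → ℝ → ℝ
  x ^ y with lem {0ℝ < x}
  ... | yes _ = exp (y * log x)
  ... | no  _ = 0ℝ

  e^-i : ℝ → ℂ
  e^-i θ = expᶜ (0ℝ +i (- θ))

  ξ : ℝ → DirichletCharacter × DirichletCharacter → ℝ × ℝ → ℝ
  ξ σ (χ₁ , χ₂) (θ₁ , θ₂) =
    (fromℕ (φ d)) ⁻¹ *
    ∑ (units d) (λ u →
      ∣ e^-i θ₁ *ᶜ ⟦ χ₁ ⟧ (ℤ.+ u) +ᶜ e^-i θ₂ *ᶜ ⟦ χ₂ ⟧ (ℤ.+ u) ∣ᶜ ^ (σ ⁻¹))
    where d = lcm (modulus χ₁) (modulus χ₂)

  ξ̃ : ℝ → DirichletCharacter × DirichletCharacter → ℝ × ℝ → ℝ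
  ξ̃ σ χ θ = 2ℝ ^ (1ℝ ÷ (1ℝ - σ)) * ξ σ χ θ ^ ((- σ) ÷ (1ℝ - σ))

-- Put s = 1/(2σ) ≤ 1 and X(u) = |e^{-iθ₁}χ₁(u) + e^{-iθ₂}χ₂(u)|². Concavity of x ↦ xˢ bounds X(u)ˢ by
-- the tangent line at x = 2, namely 2ˢ (1 - s + s X(u)/2). The mean of X over the units modulo d is 2,
-- because |χ₁| = |χ₂| = 1 there and χ₁ times the conjugate of χ₂ has mean zero. Hence 0 < ξ ≤ 2ˢ, and
-- raising to the power - σ/(1 - σ) gives the bound, whose exponent 1/(2(1 - σ)) exceeds 1 as σ > 1/2.
--
-- That last mean vanishes as soon as χ₁(u) ≠ χ₂(u) for one unit u. If there is none, take a character χ*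
-- of least modulus m among those agreeing with χ₁ on all integers coprime to some K ≠ 0. For any other
-- such character, of modulus q, χ* descends to modulus gcd m q, so m divides q by minimality. Therefore
-- χ* is primitive and induces both χ₁ and χ₂, that is χ₁ ∼ χ₂.

module Submission where

open import Algebra.Bundles using (CommutativeRing)
import Algebra.Solver.Ring
open import Algebra.Solver.Ring.AlmostCommutativeRing
  using (fromCommutativeRing; _-Raw-AlmostCommutative⟶_)
open import Algebra.Structures using (IsCommutativeRing)
open import Axiom.ExcludedMiddle using (ExcludedMiddle)
open import Data.Empty using (⊥-elim)
open import Data.Integer.Base as ℤ using (ℤ)
open import Data.Integer.Divisibility.Signed as ℤ∣ using (divides) renaming (_∣_ to _∣ᶻ_)
import Data.Integer.DivMod as ℤ%
import Data.Integer.Properties as ℤₚ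
open import Data.Integer.Tactic.RingSolver using (solve-∀)
open import Data.List.Base using (List; []; _∷_; length; map)
open import Data.List.Membership.Propositional using (_∈_)
open import Data.List.Membership.Propositional.Properties
  using (∈-filter⁺; ∈-filter⁻; ∈-upTo⁺; ∈-upTo⁻; ∈-map⁺; ∈-map⁻)
open import Data.List.Membership.Propositional.Properties.WithK using (unique∧set⇒bag)
open import Data.List.Properties using (map-∘; map-id-local)
open import Data.List.Relation.Binary.BagAndSetEquality using (∼bag⇒↭)
open import Data.List.Relation.Binary.Permutation.Propositional as ↭ using (_↭_)
open import Data.List.Relation.Unary.All using (tabulate)
open import Data.List.Relation.Unary.Any using (here; there)
open import Data.List.Relation.Unary.Unique.Propositional using (Unique)
import Data.List.Relation.Unary.Unique.Propositional.Properties as Unique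
open import Data.Maybe.Base using (Maybe; just; nothing)
open import Data.Nat.Base as ℕ using (ℕ; zero; suc; NonZero)
open import Data.Nat.Coprimality as Coprimality
  using (Coprime; 1-coprimeTo; coprime?; coprime-divisor; coprime-Bézout)
open import Data.Nat.Divisibility as ℕ∣
  using (_∣_; ∣-trans; ∣-refl; ∣1⇒≡1; ∣⇒≤; ∣m⇒∣m*n; ∣n∣m%n⇒∣m; %-presˡ-∣; m∣m*n; n∣m*n)
open import Data.Nat.DivMod using (_%_; m%n<n; m%n%n≡m%n; %-distribˡ-*; m<n⇒m%n≡m; [m+kn]%n≡m%n)
open import Data.Nat.GCD using (gcd; gcd[m,n]∣m; gcd[m,n]∣n; gcd-GCD; gcd[m,n]≢0; module Bézout)
open import Data.Nat.Induction using (<-rec)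
open import Data.Nat.LCM using (lcm; m∣lcm[m,n]; n∣lcm[m,n]; gcd*lcm)
import Data.Nat.Properties as ℕₚ
open import Data.Nat.Solver using () renaming (module +-*-Solver to ℕ-Solver)
open import Data.Product.Base using (Σ; ∃; _×_; _,_; proj₁; proj₂)
open import Data.Rational.Base as ℚ using (ℚ; mkℚ; 0ℚ; 1ℚ)
import Data.Rational.Properties as ℚₚ
open import Data.Rational.Solver using () renaming (module +-*-Solver to ℚ-RingSolver)
open import Data.Sum.Base using (_⊎_; inj₁; inj₂)
open import Function.Base using (_∘_)
open import Function.Bundles using (mk⇔)
open import Level using (0ℓ)
open import Relation.Binary.PropositionalEquality as ≡ using (_≡_)
import Relation.Binary.Reasoning.Setoid
open import Relation.Nullary using (¬_; Dec; yes; no)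

-- The functions `lim`, `exp`, `log`, `sqrt` and `_⁻¹` of the statement are chosen by excluded
-- middle, with default 0 where nothing fits, so nothing is known about them until an object with
-- the defining property is exhibited. Most of the analysis serves that end: convergence of the
-- exponential series, its functional equation, and logarithms of all positive reals. No derivatives
-- occur; once exp x exp y = exp (x + y) is known, monotonicity, convexity and the logarithm all
-- come from 1 + x ≤ exp x. The tangent line must also cover the terms with X(u) = 0, where the
-- power is 0 by convention, and ξ > 0 holds because X has positive sum. On the arithmetic side,
-- |χ(u)| = 1 comes from comparing a sum over the units with its translate, without orders of
-- elements. The descent to modulus gcd m q meets an obstacle: the two characters are compared only
-- at integers coprime to K, while the new one must be defined at all integers coprime to gcd m q.
-- Every such class therefore needs a representative coprime to K, and `lift` constructs one.

-- Rational arithmetic, and the numbers n and 1/(n + 1).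

module Rationals where

  open ≡ using (refl; sym; trans; cong; subst; subst₂)

  -- Reduces a strict inequality to a ring identity: the slack `e` is assembled from known positive
  -- quantities, and the solver checks that it is the difference.
  ℚ-<-by : ∀ {a b} e → 0ℚ ℚ.< e → b ≡ e ℚ.+ a → a ℚ.< b
  ℚ-<-by {a} e e>0 eq =
    subst₂ ℚ._<_ (ℚₚ.+-identityˡ a) (sym eq) (ℚₚ.+-monoˡ-< a e>0)

  ℚ-gap : ∀ {a b} → a ℚ.< b → 0ℚ ℚ.< b ℚ.- a
  ℚ-gap {a} {b} a<b = subst (ℚ._< b ℚ.- a) (ℚₚ.+-inverseʳ a) (ℚₚ.+-monoˡ-< (ℚ.- a) a<b)

  ℚ-+-pos : ∀ {a b} → 0ℚ ℚ.< a → 0ℚ ℚ.< b → 0ℚ ℚ.< a ℚ.+ b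
  ℚ-+-pos = ℚₚ.+-mono-<

  ℚ-*-pos : ∀ {a b} → 0ℚ ℚ.< a → 0ℚ ℚ.< b → 0ℚ ℚ.< a ℚ.* b
  ℚ-*-pos {a} {b} a>0 b>0 = ℚₚ.positive⁻¹ (a ℚ.* b)
    {{ℚₚ.pos*pos⇒pos a {{ℚ.positive a>0}} b {{ℚ.positive b>0}}}}

  ℚ-half : ∀ {a} → 0ℚ ℚ.< a → 0ℚ ℚ.< ℚ.½ ℚ.* a
  ℚ-half = ℚ-*-pos (ℚₚ.positive⁻¹ ℚ.½)

  ℚ-divide : ∀ {c e} → 0ℚ ℚ.< c → 0ℚ ℚ.< e → ∃ λ δ → 0ℚ ℚ.< δ × c ℚ.* δ ≡ e
  ℚ-divide {c} {e} c>0 e>0 = ℚ.1/ c ℚ.* e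
    , ℚ-*-pos (ℚₚ.positive⁻¹ (ℚ.1/ c) {{ℚₚ.1/pos⇒pos c}}) e>0
    , trans (sym (ℚₚ.*-assoc c (ℚ.1/ c) e))
        (trans (cong (ℚ._* e) (ℚₚ.*-inverseʳ c)) (ℚₚ.*-identityˡ e))
    where
    instance
      _ = ℚ.positive c>0
      _ = ℚₚ.pos⇒nonZero c

  -- The number 1/(n + 1), given in lowest terms, so that no normalisation by a gcd stands in the
  -- way of computation.
  recip : ℕ → ℚ
  recip n = mkℚ (ℤ.+ 1) n (1-coprimeTo (suc n))

  recip-pos : ∀ n → 0ℚ ℚ.< recip n
  recip-pos n = ℚₚ.positive⁻¹ (recip n)


  natℚ : ℕ → ℚ
  natℚ n = ℤ.+ n ℚ./ 1

  natℚ-mk : ∀ n → natℚ n ≡ mkℚ (ℤ.+ n) 0 (Coprimality.sym (1-coprimeTo n))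
  natℚ-mk n = ℚₚ.↥p/↧p≡p (mkℚ (ℤ.+ n) 0 (Coprimality.sym (1-coprimeTo n)))

  natℚ-suc : ∀ n → natℚ (suc n) ≡ 1ℚ ℚ.+ natℚ n
  natℚ-suc n rewrite natℚ-mk n | ℤₚ.*-identityʳ (ℤ.+ n) = refl

  natℚ*recip : ∀ n → natℚ (suc n) ℚ.* recip n ≡ 1ℚ
  natℚ*recip n rewrite natℚ-mk (suc n) = ℚₚ.*-inverseʳ (mkℚ (ℤ.+ suc n) 0 (Coprimality.sym (1-coprimeTo (suc n))))

  natℚ-mono : ∀ {m n} → m ℕ.≤ n → natℚ m ℚ.≤ natℚ n
  natℚ-mono {m} {n} h = subst₂ ℚ._≤_ (sym (natℚ-mk m)) (sym (natℚ-mk n))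
    (ℚ.*≤* (ℤₚ.*-monoʳ-≤-nonNeg (ℤ.+ 1) (ℤ.+≤+ h)))

  natℚ-above : ∀ q → ∃ λ n → q ℚ.≤ natℚ n
  natℚ-above q@(mkℚ (ℤ.+ a) d _) = a , subst (q ℚ.≤_) (sym (natℚ-mk a))
    (ℚ.*≤* (ℤₚ.*-monoˡ-≤-nonNeg (ℤ.+ a) (ℤ.+≤+ (ℕ.s≤s ℕ.z≤n))))
  natℚ-above (mkℚ ℤ.-[1+ a ] d _) = 0 , ℚ.*≤* ℤ.-≤+

  recip-small : ∀ ε → 0ℚ ℚ.< ε → ∃ λ N → ∀ n → N ℕ.≤ n → recip n ℚ.≤ ε
  recip-small ε@(mkℚ (ℤ.+ suc a) d _) _ = d , λ n d≤n →
    ℚ.*≤* (ℤ.+≤+ (ℕₚ.*-mono-≤ {1} {suc a} (ℕ.s≤s ℕ.z≤n) (ℕ.s≤s d≤n)))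
  recip-small (mkℚ (ℤ.+ 0) _ _) (ℚ.*<* (ℤ.+<+ ()))
  recip-small (mkℚ ℤ.-[1+ _ ] _ _) (ℚ.*<* ())

  -- Yields the recursion for 1/n!. The product of two reciprocals in lowest terms computes to the
  -- left-hand side, so only 1/k has to be brought to the form `recip j`.
  recip-* : ∀ n k .{{_ : ℕ.NonZero k}} .{{_ : ℕ.NonZero (suc n ℕ.* k)}} →
    ℤ.+ 1 ℚ./ (suc n ℕ.* k) ≡ recip n ℚ.* (ℤ.+ 1 ℚ./ k)
  recip-* n (suc j) = cong (recip n ℚ.*_) (sym (ℚₚ.↥p/↧p≡p (recip j)))

open Rationals

-- The analysis is done over an abstract field, since ≈ on Cauchy sequences unfolds to a statement
-- about rationals from which the two reals cannot be inferred.
record CompleteOrderedField : Set₁ where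
  infix  4 _≈_ _≤_ _<_
  infixl 6 _+_
  infixl 7 _*_
  infix  8 -_
  field
    Carrier     : Set
    _≈_ _≤_ _<_ : Carrier → Carrier → Set
    _+_ _*_     : Carrier → Carrier → Carrier
    -_          : Carrier → Carrier
    ι           : ℚ → Carrier
    isCommutativeRing : IsCommutativeRing _≈_ _+_ _*_ -_ (ι 0ℚ) (ι 1ℚ)
    ι-+        : ∀ p q → ι (p ℚ.+ q) ≈ ι p + ι q
    ι-*        : ∀ p q → ι (p ℚ.* q) ≈ ι p * ι q
    ι-neg      : ∀ p → ι (ℚ.- p) ≈ - ι p
    ι-mono-<   : ∀ {p q} → p ℚ.< q → ι p < ι q
    ≤-reflexive : ∀ {x y} → x ≈ y → x ≤ y
    ≤-trans    : ∀ {x y z} → x ≤ y → y ≤ z → x ≤ z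
    ≤-antisym  : ∀ {x y} → x ≤ y → y ≤ x → x ≈ y
    <⇒≤        : ∀ {x y} → x < y → x ≤ y
    <-irrefl   : ∀ {x} → ¬ (x < x)
    <-≤-trans  : ∀ {x y z} → x < y → y ≤ z → x < z
    ≤-<-trans  : ∀ {x y z} → x ≤ y → y < z → x < z
    compare    : ∀ x y → x ≤ y ⊎ y < x
    +-monoʳ-≤  : ∀ x {y z} → y ≤ z → x + y ≤ x + z
    +-monoʳ-<  : ∀ x {y z} → y < z → x + y < x + z
    *-nonneg   : ∀ {x y} → ι 0ℚ ≤ x → ι 0ℚ ≤ y → ι 0ℚ ≤ x * y
    *-pos      : ∀ {x y} → ι 0ℚ < x → ι 0ℚ < y → ι 0ℚ < x * y
    ι-below    : ∀ {x} → ι 0ℚ < x → ∃ λ q → 0ℚ ℚ.< q × ι q ≤ x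
    ι-above    : ∀ x → ∃ λ q → x ≤ ι q
    -- A single inequality expresses the Cauchy condition, since m and n may be exchanged.
    complete   : (a : ℕ → Carrier) →
      (∀ ε → 0ℚ ℚ.< ε → ∃ λ N → ∀ m n → N ℕ.≤ m → N ℕ.≤ n → a m ≤ a n + ι ε) →
      ∃ λ L → ∀ ε → 0ℚ ℚ.< ε → ∃ λ N → ∀ n → N ℕ.≤ n → a n ≤ L + ι ε × L ≤ a n + ι ε

  0# 1# : Carrier
  0# = ι 0ℚ
  1# = ι 1ℚ

-- The coefficients are rationals with decidable equality, which brings identities with constants
-- such as ½ within reach of the solver.
module ℚ-Solver (A : CommutativeRing 0ℓ 0ℓ)
  (φ : CommutativeRing.rawRing ℚₚ.+-*-commutativeRing -Raw-AlmostCommutative⟶ fromCommutativeRing A) where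

  open CommutativeRing A using (_≈_; refl)
  open _-Raw-AlmostCommutative⟶_ φ using (⟦_⟧)

  decide : ∀ p q → Maybe (⟦ p ⟧ ≈ ⟦ q ⟧)
  decide p q with p ℚₚ.≟ q
  ... | yes ≡.refl = just refl
  ... | no _       = nothing

  open Algebra.Solver.Ring (CommutativeRing.rawRing ℚₚ.+-*-commutativeRing) (fromCommutativeRing A) φ decide
    public using (solve; _:=_; _:+_; _:*_; _:-_; :-_; con)

-- Order, two-sided bounds and limits in a complete ordered field.

module OrderedField (K : CompleteOrderedField) where

  open CompleteOrderedField K public

  commutativeRing : CommutativeRing 0ℓ 0ℓ
  commutativeRing = record { isCommutativeRing = isCommutativeRing }

  open CommutativeRing commutativeRing public
    using (_-_; +-cong; +-congˡ; +-congʳ; *-cong; *-congˡ; *-congʳ; -‿cong;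
           +-identityˡ; +-identityʳ; *-identityˡ; *-identityʳ; zeroˡ; zeroʳ; *-comm; +-comm)
    renaming (refl to ≈-refl; sym to ≈-sym; trans to ≈-trans)

  coefficients : CommutativeRing.rawRing ℚₚ.+-*-commutativeRing -Raw-AlmostCommutative⟶ fromCommutativeRing commutativeRing
  coefficients = record
    { ⟦_⟧ = ι ; +-homo = ι-+ ; *-homo = ι-* ; -‿homo = ι-neg ; 0-homo = ≈-refl ; 1-homo = ≈-refl }

  open ℚ-Solver commutativeRing coefficients public

  ≤-refl : ∀ {x} → x ≤ x
  ≤-refl = ≤-reflexive ≈-refl

  ≤-respʳ-≈ : ∀ {x y z} → y ≈ z → x ≤ y → x ≤ z
  ≤-respʳ-≈ e h = ≤-trans h (≤-reflexive e)

  ≤-respˡ-≈ : ∀ {x y z} → x ≈ y → x ≤ z → y ≤ z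
  ≤-respˡ-≈ e h = ≤-trans (≤-reflexive (≈-sym e)) h

  <-respʳ-≈ : ∀ {x y z} → y ≈ z → x < y → x < z
  <-respʳ-≈ e h = <-≤-trans h (≤-reflexive e)

  <-respˡ-≈ : ∀ {x y z} → x ≈ y → x < z → y < z
  <-respˡ-≈ e h = ≤-<-trans (≤-reflexive (≈-sym e)) h

  ≤⇒gap : ∀ {x y} → x ≤ y → 0# ≤ y - x
  ≤⇒gap {x} {y} h = ≤-respˡ-≈ (solve 1 (λ x → (:- x) :+ x := con 0ℚ) ≈-refl x)
    (≤-respʳ-≈ (+-comm (- x) y) (+-monoʳ-≤ (- x) h))

  <⇒gap : ∀ {x y} → x < y → 0# < y - x
  <⇒gap {x} {y} h = <-respˡ-≈ (solve 1 (λ x → (:- x) :+ x := con 0ℚ) ≈-refl x)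
    (<-respʳ-≈ (+-comm (- x) y) (+-monoʳ-< (- x) h))

  -- The usual way to prove an inequality below: name a difference that is visibly nonnegative and
  -- leave the identity to the solver.
  ≤-by : ∀ {x y} e → 0# ≤ e → y ≈ x + e → x ≤ y
  ≤-by {x} e 0≤e eq = ≤-respʳ-≈ (≈-sym eq) (≤-respˡ-≈ (+-identityʳ x) (+-monoʳ-≤ x 0≤e))

  <-by : ∀ {x y} e → 0# < e → y ≈ x + e → x < y
  <-by {x} e 0<e eq = <-respʳ-≈ (≈-sym eq) (<-respˡ-≈ (+-identityʳ x) (+-monoʳ-< x 0<e))

  +-mono-≤ : ∀ {x x′ y y′} → x ≤ x′ → y ≤ y′ → x + y ≤ x′ + y′
  +-mono-≤ {x} {x′} {y} {y′} h k = ≤-trans (+-monoʳ-≤ x k)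
    (≤-respˡ-≈ (+-comm y′ x) (≤-respʳ-≈ (+-comm y′ x′) (+-monoʳ-≤ y′ h)))

  +-nonneg : ∀ {x y} → 0# ≤ x → 0# ≤ y → 0# ≤ x + y
  +-nonneg h k = ≤-respˡ-≈ (+-identityʳ 0#) (+-mono-≤ h k)

  +-pos : ∀ {x y} → 0# < x → 0# ≤ y → 0# < x + y
  +-pos {x} h k = <-≤-trans h (≤-respˡ-≈ (+-identityʳ x) (+-monoʳ-≤ x k))

  neg-anti-≤ : ∀ {x y} → x ≤ y → - y ≤ - x
  neg-anti-≤ {x} {y} h = ≤-by (y - x) (≤⇒gap h)
    (solve 2 (λ x y → :- x := :- y :+ (y :- x)) ≈-refl x y)

  *-monoˡ-≤ : ∀ {x y z} → 0# ≤ z → x ≤ y → z * x ≤ z * y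
  *-monoˡ-≤ {x} {y} {z} 0≤z h = ≤-by (z * (y - x)) (*-nonneg 0≤z (≤⇒gap h))
    (solve 3 (λ x y z → z :* y := z :* x :+ z :* (y :- x)) ≈-refl x y z)

  *-monoˡ-< : ∀ {x y z} → 0# < z → x < y → z * x < z * y
  *-monoˡ-< {x} {y} {z} 0<z h = <-by (z * (y - x)) (*-pos 0<z (<⇒gap h))
    (solve 3 (λ x y z → z :* y := z :* x :+ z :* (y :- x)) ≈-refl x y z)

  *-mono-≤ : ∀ {x x′ y y′} → 0# ≤ x′ → 0# ≤ y → x ≤ x′ → y ≤ y′ → x * y ≤ x′ * y′
  *-mono-≤ {x} {x′} {y} {y′} 0≤x′ 0≤y h k = ≤-trans
    (≤-respˡ-≈ (*-comm y x) (≤-respʳ-≈ (*-comm y x′) (*-monoˡ-≤ 0≤y h))) (*-monoˡ-≤ 0≤x′ k)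

  ≰⇒> : ∀ {x y} → ¬ (x ≤ y) → y < x
  ≰⇒> {x} {y} h with compare x y
  ... | inj₁ x≤y = ⊥-elim (h x≤y)
  ... | inj₂ y<x = y<x

  ≮⇒≥ : ∀ {x y} → ¬ (x < y) → y ≤ x
  ≮⇒≥ {x} {y} h with compare y x
  ... | inj₁ y≤x = y≤x
  ... | inj₂ x<y = ⊥-elim (h x<y)

  *-cancelˡ-≤ : ∀ {x y z} → 0# < z → z * x ≤ z * y → x ≤ y
  *-cancelˡ-≤ 0<z h = ≮⇒≥ λ y<x → <-irrefl (<-≤-trans (*-monoˡ-< 0<z y<x) h)

  *-cancelˡ-≈ : ∀ {x y z} → 0# < z → z * x ≈ z * y → x ≈ y
  *-cancelˡ-≈ 0<z h = ≤-antisym (*-cancelˡ-≤ 0<z (≤-reflexive h)) (*-cancelˡ-≤ 0<z (≤-reflexive (≈-sym h)))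

  square-nonneg : ∀ x → 0# ≤ x * x
  square-nonneg x with compare 0# x
  ... | inj₁ 0≤x = *-nonneg 0≤x 0≤x
  ... | inj₂ x<0 = ≤-respʳ-≈ (solve 1 (λ x → (con 0ℚ :- x) :* (con 0ℚ :- x) := x :* x) ≈-refl x)
    (*-nonneg (≤⇒gap (<⇒≤ x<0)) (≤⇒gap (<⇒≤ x<0)))

  ι-pos : ∀ {q} → 0ℚ ℚ.< q → 0# < ι q
  ι-pos = ι-mono-<

  ι-nonneg : ∀ {q} → 0ℚ ℚ.< q → 0# ≤ ι q
  ι-nonneg h = <⇒≤ (ι-pos h)

  ι-mono-≤ : ∀ {p q} → p ℚ.≤ q → ι p ≤ ι q
  ι-mono-≤ {p} {q} h with p ℚₚ.<? q
  ... | yes p<q = <⇒≤ (ι-mono-< p<q)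
  ... | no p≮q = ≤-reflexive (≡⇒≈ (ℚₚ.≤-antisym h (ℚₚ.≮⇒≥ p≮q)))
    where
    ≡⇒≈ : p ≡ q → ι p ≈ ι q
    ≡⇒≈ ≡.refl = ≈-refl

  0<1 : 0# < 1#
  0<1 = ι-pos (ℚₚ.positive⁻¹ 1ℚ)

  0≤1 : 0# ≤ 1#
  0≤1 = <⇒≤ 0<1

  positive-bound : ∀ x → ∃ λ B → 0ℚ ℚ.< B × x ≤ ι B
  positive-bound x with ι-above x
  ... | q , x≤q with 0ℚ ℚₚ.<? q
  ...   | yes 0<q = q , 0<q , x≤q
  ...   | no 0≮q = 1ℚ , ℚₚ.positive⁻¹ 1ℚ
          , ≤-trans x≤q (ι-mono-≤ (ℚₚ.≤-trans (ℚₚ.≮⇒≥ 0≮q) (ℚₚ.<⇒≤ (ℚₚ.positive⁻¹ 1ℚ))))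

  -- If y < x, there is a rational q with 0 < q ≤ x - y, and the hypothesis at q/2 contradicts it.
  ≤-closed : ∀ {x y} → (∀ ε → 0ℚ ℚ.< ε → x ≤ y + ι ε) → x ≤ y
  ≤-closed {x} {y} h = ≮⇒≥ λ y<x →
    let q , 0<q , q≤ = ι-below (<⇒gap y<x) in
    <-irrefl (<-≤-trans
      (<-by (ι q * 1# - ι ℚ.½ * ι q)
        (<-respʳ-≈ (solve 1 (λ q → con ℚ.½ :* q := q :* con 1ℚ :- con ℚ.½ :* q) ≈-refl (ι q))
          (*-pos (ι-pos (ℚₚ.positive⁻¹ ℚ.½)) (ι-pos 0<q)))
        (solve 3 (λ x y q → x := (x :- (q :- con ℚ.½ :* q)) :+ (q :* con 1ℚ :- con ℚ.½ :* q)) ≈-refl x y (ι q)))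
      (≤-by ((x - y) - ι q + (y + ι (ℚ.½ ℚ.* q) - x))
        (+-nonneg (≤⇒gap q≤) (≤⇒gap (h (ℚ.½ ℚ.* q) (ℚ-half 0<q))))
        (≈-trans (solve 3 (λ x y q → x :- (q :- con ℚ.½ :* q) := x :+ ((x :- y) :- q :+ (y :+ con ℚ.½ :* q :- x))) ≈-refl x y (ι q))
          (+-congˡ (+-congˡ (+-congʳ (+-congˡ (≈-sym (ι-* ℚ.½ q)))))))))

  infix 4 ∣_∣≤_

  -- A relation takes the place of an absolute value function, which keeps case distinctions on
  -- signs out of the estimates.
  ∣_∣≤_ : Carrier → Carrier → Set
  ∣ x ∣≤ r = - r ≤ x × x ≤ r

  ∣∣-cong : ∀ {x y r s} → x ≈ y → r ≈ s → ∣ x ∣≤ r → ∣ y ∣≤ s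
  ∣∣-cong e f (p , q) = ≤-respˡ-≈ (-‿cong f) (≤-respʳ-≈ e p) , ≤-respʳ-≈ f (≤-respˡ-≈ e q)

  ∣∣-mono : ∀ {x r s} → r ≤ s → ∣ x ∣≤ r → ∣ x ∣≤ s
  ∣∣-mono h (p , q) = ≤-trans (neg-anti-≤ h) p , ≤-trans q h

  ∣∣-nonneg : ∀ {x r} → 0# ≤ x → x ≤ r → ∣ x ∣≤ r
  ∣∣-nonneg {x} {r} 0≤x x≤r = ≤-by (r + x) (+-nonneg (≤-trans 0≤x x≤r) 0≤x)
      (solve 2 (λ x r → x := :- r :+ (r :+ x)) ≈-refl x r)
    , x≤r

  ∣∣-neg : ∀ {x r} → ∣ x ∣≤ r → ∣ - x ∣≤ r
  ∣∣-neg {x} {r} (p , q) = neg-anti-≤ q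
    , ≤-respʳ-≈ (solve 1 (λ r → :- (:- r) := r) ≈-refl r) (neg-anti-≤ p)

  ∣∣-+ : ∀ {x y r s} → ∣ x ∣≤ r → ∣ y ∣≤ s → ∣ x + y ∣≤ r + s
  ∣∣-+ {x} {y} {r} {s} (p , q) (p′ , q′) =
    ≤-respˡ-≈ (solve 2 (λ r s → :- r :+ (:- s) := :- (r :+ s)) ≈-refl r s) (+-mono-≤ p p′)
    , +-mono-≤ q q′

  -- r s ± x y is half the sum of (r ± x)(s + y) and (r ∓ x)(s - y).
  ∣∣-* : ∀ {x y r s} → ∣ x ∣≤ r → ∣ y ∣≤ s → ∣ x * y ∣≤ r * s
  ∣∣-* {x} {y} {r} {s} (p , q) (p′ , q′) =
      ≤-by (ι ℚ.½ * ((x - - r) * (y - - s) + (r - x) * (s - y)))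
        (*-nonneg 0≤½ (+-nonneg (*-nonneg (≤⇒gap p) (≤⇒gap p′)) (*-nonneg (≤⇒gap q) (≤⇒gap q′))))
        (solve 4 (λ x y r s → x :* y := :- (r :* s) :+
          con ℚ.½ :* ((x :- (:- r)) :* (y :- (:- s)) :+ (r :- x) :* (s :- y))) ≈-refl x y r s)
    , ≤-by (ι ℚ.½ * ((r - x) * (y - - s) + (x - - r) * (s - y)))
        (*-nonneg 0≤½ (+-nonneg (*-nonneg (≤⇒gap q) (≤⇒gap p′)) (*-nonneg (≤⇒gap p) (≤⇒gap q′))))
        (solve 4 (λ x y r s → r :* s := (x :* y) :+
          con ℚ.½ :* ((r :- x) :* (y :- (:- s)) :+ (x :- (:- r)) :* (s :- y))) ≈-refl x y r s)
    where
    0≤½ : 0# ≤ ι ℚ.½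
    0≤½ = ι-nonneg (ℚₚ.positive⁻¹ ℚ.½)

  infix 4 _⟶_

  _⟶_ : (ℕ → Carrier) → Carrier → Set
  a ⟶ L = ∀ ε → 0ℚ ℚ.< ε → ∃ λ N → ∀ n → N ℕ.≤ n → ∣ a n - L ∣≤ ι ε

  eventually-both : {P Q : ℕ → Set} → (∃ λ N → ∀ n → N ℕ.≤ n → P n) →
    (∃ λ N → ∀ n → N ℕ.≤ n → Q n) → ∃ λ N → ∀ n → N ℕ.≤ n → P n × Q n
  eventually-both (M , p) (N , q) = M ℕ.⊔ N , λ n h →
    p n (ℕₚ.m⊔n≤o⇒m≤o M N h) , q n (ℕₚ.m⊔n≤o⇒n≤o M N h)

  eventually-map : {P Q : ℕ → Set} → (∀ n → P n → Q n) →
    (∃ λ N → ∀ n → N ℕ.≤ n → P n) → ∃ λ N → ∀ n → N ℕ.≤ n → Q n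
  eventually-map f (N , p) = N , λ n h → f n (p n h)

  ι-halves : ∀ ε → ι (ℚ.½ ℚ.* ε) + ι (ℚ.½ ℚ.* ε) ≈ ι ε
  ι-halves ε = ≈-trans (+-cong (ι-* ℚ.½ ε) (ι-* ℚ.½ ε))
    (solve 1 (λ ε → con ℚ.½ :* ε :+ con ℚ.½ :* ε := ε) ≈-refl (ι ε))

  cauchy⇒⟶ : (a : ℕ → Carrier) →
    (∀ ε → 0ℚ ℚ.< ε → ∃ λ N → ∀ m n → N ℕ.≤ m → N ℕ.≤ n → a m ≤ a n + ι ε) → ∃ λ L → a ⟶ L
  cauchy⇒⟶ a h = let L , c = complete a h in L , λ ε ε>0 → eventually-map (λ n (p , q) →
      ≤-by (a n + ι ε - L) (≤⇒gap q) (solve 3 (λ a L ε → a :- L := :- ε :+ (a :+ ε :- L)) ≈-refl (a n) L (ι ε))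
    , ≤-by (L + ι ε - a n) (≤⇒gap p) (solve 3 (λ a L ε → ε := (a :- L) :+ (L :+ ε :- a)) ≈-refl (a n) L (ι ε)))
    (c ε ε>0)

  ⟶-≤ : ∀ {a b L M} → a ⟶ L → b ⟶ M → (∃ λ N → ∀ n → N ℕ.≤ n → a n ≤ b n) → L ≤ M
  ⟶-≤ {a} {b} {L} {M} h k e = ≤-closed λ ε ε>0 →
    let N , c = eventually-both (eventually-both (h _ (ℚ-half ε>0)) (k _ (ℚ-half ε>0))) e
        ((p , _) , (_ , q)) , r = c N ℕₚ.≤-refl
        δ = ι (ℚ.½ ℚ.* ε)
    in ≤-by ((a N - L) - - δ + (δ - (b N - M)) + (b N - a N))
         (+-nonneg (+-nonneg (≤⇒gap p) (≤⇒gap q)) (≤⇒gap r))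
         (≈-trans (+-congˡ (≈-sym (ι-halves ε)))
           (solve 5 (λ L M a b δ → M :+ (δ :+ δ) := L :+ ((a :- L) :- (:- δ) :+ (δ :- (b :- M)) :+ (b :- a))) ≈-refl
             L M (a N) (b N) δ))

  ⟶-unique : ∀ {a b L M} → a ⟶ L → b ⟶ M → (∀ n → a n ≈ b n) → L ≈ M
  ⟶-unique h k e = ≤-antisym (⟶-≤ h k (0 , λ n _ → ≤-reflexive (e n)))
    (⟶-≤ k h (0 , λ n _ → ≤-reflexive (≈-sym (e n))))

  ⟶-const : ∀ c → (λ _ → c) ⟶ c
  ⟶-const c ε ε>0 = 0 , λ _ _ → ∣∣-nonneg (≤-reflexive (solve 1 (λ c → con 0ℚ := c :- c) ≈-refl c))
    (≤-respˡ-≈ (solve 1 (λ c → con 0ℚ := c :- c) ≈-refl c) (ι-nonneg ε>0))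

  ⟶-+ : ∀ {a b L M} → a ⟶ L → b ⟶ M → (λ n → a n + b n) ⟶ (L + M)
  ⟶-+ {a} {b} {L} {M} h k ε ε>0 = eventually-map (λ n (p , q) →
      ∣∣-cong (solve 4 (λ a b L M → (a :- L) :+ (b :- M) := (a :+ b) :- (L :+ M)) ≈-refl (a n) (b n) L M)
        (ι-halves ε) (∣∣-+ p q))
    (eventually-both (h _ (ℚ-half ε>0)) (k _ (ℚ-half ε>0)))

  ⟶-neg : ∀ {a L} → a ⟶ L → (λ n → - a n) ⟶ (- L)
  ⟶-neg {a} {L} h ε ε>0 = eventually-map (λ n p →
      ∣∣-cong (solve 2 (λ a L → :- (a :- L) := :- a :- (:- L)) ≈-refl (a n) L) ≈-refl (∣∣-neg p))
    (h ε ε>0)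

  ∣∣-bound : ∀ x → ∃ λ B → 0ℚ ℚ.< B × ∣ x ∣≤ ι B
  ∣∣-bound x with compare 0# x
  ... | inj₁ 0≤x = let B , B>0 , h = positive-bound x in B , B>0 , ∣∣-nonneg 0≤x h
  ... | inj₂ x<0 = let B , B>0 , h = positive-bound (- x) in B , B>0 ,
    ∣∣-cong (solve 1 (λ x → :- (:- x) := x) ≈-refl x) ≈-refl
      (∣∣-neg (∣∣-nonneg (≤-respʳ-≈ (solve 1 (λ x → con 0ℚ :- x := :- x) ≈-refl x) (≤⇒gap (<⇒≤ x<0))) h))

  -- a b - L M = (a - L)(b - M) + L (b - M) + M (a - L)
  ⟶-* : ∀ {a b L M} → a ⟶ L → b ⟶ M → (λ n → a n * b n) ⟶ (L * M)
  ⟶-* {a} {b} {L} {M} h k ε ε>0 =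
    let A , A>0 , L≤A = ∣∣-bound L
        B , B>0 , M≤B = ∣∣-bound M
        δ , δ>0 , eq = ℚ-divide (ℚ-+-pos (ℚ-+-pos (ℚₚ.positive⁻¹ 1ℚ) A>0) B>0) ε>0
    in eventually-map (λ n ((p , q) , r) →
        ∣∣-cong (solve 4 (λ a b L M → (a :- L) :* (b :- M) :+ L :* (b :- M) :+ M :* (a :- L) := a :* b :- L :* M)
            ≈-refl (a n) (b n) L M)
          (total A B δ eq)
          (∣∣-+ (∣∣-+ (∣∣-* r q) (∣∣-* L≤A q)) (∣∣-* M≤B p)))
      (eventually-both (eventually-both (h δ δ>0) (k δ δ>0)) (h 1ℚ (ℚₚ.positive⁻¹ 1ℚ)))
    where
    total : ∀ A B δ → (1ℚ ℚ.+ A ℚ.+ B) ℚ.* δ ≡ ε → 1# * ι δ + ι A * ι δ + ι B * ι δ ≈ ι ε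
    total A B δ ≡.refl = ≈-sym (≈-trans (ι-* (1ℚ ℚ.+ A ℚ.+ B) δ)
      (≈-trans (*-congʳ (≈-trans (ι-+ (1ℚ ℚ.+ A) B) (+-congʳ (ι-+ 1ℚ A))))
        (solve 3 (λ A B δ → (con 1ℚ :+ A :+ B) :* δ := con 1ℚ :* δ :+ A :* δ :+ B :* δ) ≈-refl (ι A) (ι B) (ι δ))))

  ⟶-suc : ∀ {a L} → a ⟶ L → (λ n → a (suc n)) ⟶ L
  ⟶-suc h ε ε>0 = let N , e = h ε ε>0 in N , λ n N≤n → e (suc n) (ℕₚ.m≤n⇒m≤1+n N≤n)

  ⟶-limit-cong : ∀ {a L M} → L ≈ M → a ⟶ L → a ⟶ M
  ⟶-limit-cong e h ε ε>0 = eventually-map (λ n → ∣∣-cong (+-congˡ (-‿cong e)) ≈-refl) (h ε ε>0)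

  -- Comparing a with b + e and b with a + e reduces this to the preservation of ≤ in the limit.
  ⟶-squeeze : ∀ {a b e L M} → a ⟶ L → b ⟶ M → e ⟶ 0# → (∀ n → ∣ a n - b n ∣≤ e n) → L ≈ M
  ⟶-squeeze {a} {b} {e} {L} {M} h k z d = ≤-antisym
    (⟶-≤ {b = λ n → b n + e n} h (⟶-limit-cong (+-identityʳ M) (⟶-+ k z)) (0 , λ n _ →
      ≤-by (e n - (a n - b n)) (≤⇒gap (proj₂ (d n)))
        (solve 3 (λ a b e → b :+ e := a :+ (e :- (a :- b))) ≈-refl (a n) (b n) (e n))))
    (⟶-≤ {b = λ n → a n + e n} k (⟶-limit-cong (+-identityʳ L) (⟶-+ h z)) (0 , λ n _ →
      ≤-by ((a n - b n) - - e n) (≤⇒gap (proj₁ (d n)))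
        (solve 3 (λ a b e → a :+ e := b :+ ((a :- b) :- (:- e))) ≈-refl (a n) (b n) (e n))))

  -- Passes to the convergence of the statement, where ε is real and the bounds are strict. Half of
  -- a rational q ≤ ε leaves the room needed for strictness.
  ⟶⇒bounds : ∀ {a L} → a ⟶ L → ∀ ε → 0# < ε → ∃ λ N → ∀ n → N ℕ.≤ n → L - ε < a n × a n < L + ε
  ⟶⇒bounds {a} {L} h ε 0<ε =
    let q , q>0 , q≤ε = ι-below 0<ε
        δ = ι (ℚ.½ ℚ.* q)
        δ<ε = <-≤-trans (<-respʳ-≈ (ι-halves q) (<-by δ (ι-pos (ℚ-half q>0)) ≈-refl)) q≤ε
    in eventually-map (λ n (p , r) →
        <-by ((ε - δ) + ((a n - L) - - δ)) (+-pos (<⇒gap δ<ε) (≤⇒gap p))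
          (solve 4 (λ a L ε δ → a := (L :- ε) :+ ((ε :- δ) :+ ((a :- L) :- (:- δ)))) ≈-refl (a n) L ε δ)
      , <-by ((ε - δ) + (δ - (a n - L))) (+-pos (<⇒gap δ<ε) (≤⇒gap r))
          (solve 4 (λ a L ε δ → L :+ ε := a :+ ((ε :- δ) :+ (δ :- (a :- L)))) ≈-refl (a n) L ε δ))
      (h (ℚ.½ ℚ.* q) (ℚ-half q>0))

  bounds⇒⟶ : ∀ {a L} → (∀ ε → 0# < ε → ∃ λ N → ∀ n → N ℕ.≤ n → L - ε < a n × a n < L + ε) → a ⟶ L
  bounds⇒⟶ {a} {L} h ε ε>0 = eventually-map (λ n (p , q) →
      ≤-by (a n - (L - ι ε)) (<⇒≤ (<⇒gap p)) (solve 3 (λ a L ε → a :- L := :- ε :+ (a :- (L :- ε))) ≈-refl (a n) L (ι ε))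
    , ≤-by (L + ι ε - a n) (<⇒≤ (<⇒gap q)) (solve 3 (λ a L ε → ε := (a :- L) :+ (L :+ ε :- a)) ≈-refl (a n) L (ι ε)))
    (h (ι ε) (ι-pos ε>0))

-- Formal series: partial sums, convolution, derivative, and the coefficients zⁿ / n!.

module PowerSeries (A : CommutativeRing 0ℓ 0ℓ)
  (φ : CommutativeRing.rawRing ℚₚ.+-*-commutativeRing -Raw-AlmostCommutative⟶ fromCommutativeRing A) where

  open CommutativeRing A
  open _-Raw-AlmostCommutative⟶_ φ using (+-homo; *-homo; 1-homo) renaming (⟦_⟧ to ι)
  open ℚ-Solver A φ
  open Relation.Binary.Reasoning.Setoid setoid

  ν : ℕ → Carrier
  ν n = ι (natℚ n)

  ι-cong : ∀ {p q} → p ≡ q → ι p ≈ ι q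
  ι-cong ≡.refl = refl

  ν-suc : ∀ n → ν (suc n) ≈ 1# + ν n
  ν-suc n = trans (ι-cong (natℚ-suc n)) (trans (+-homo 1ℚ (natℚ n)) (+-congʳ 1-homo))

  ν*recip : ∀ n → ν (suc n) * ι (recip n) ≈ 1#
  ν*recip n = trans (sym (*-homo (natℚ (suc n)) (recip n))) (trans (ι-cong (natℚ*recip n)) 1-homo)

  -- Sums the n terms f 0, ..., f (n - 1). On generating functions this is multiplication by x/(1 -
  -- x).
  S : (ℕ → Carrier) → ℕ → Carrier
  S f zero    = 0#
  S f (suc n) = S f n + f n

  -- The coefficient f 0 g n + ... + f n g 0 of the product of two series. The recursion removes f
  -- 0, so inductions pass from f to `f ∘ suc`.
  conv : (ℕ → Carrier) → (ℕ → Carrier) → ℕ → Carrier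
  conv f g zero    = f 0 * g 0
  conv f g (suc n) = f 0 * g (suc n) + conv (f ∘ suc) g n

  S-cong : ∀ {f g} → (∀ n → f n ≈ g n) → ∀ n → S f n ≈ S g n
  S-cong h zero    = refl
  S-cong h (suc n) = +-cong (S-cong h n) (h n)

  conv-cong : ∀ {f f′ g g′} → (∀ n → f n ≈ f′ n) → (∀ n → g n ≈ g′ n) → ∀ n → conv f g n ≈ conv f′ g′ n
  conv-cong h k zero    = *-cong (h 0) (k 0)
  conv-cong h k (suc n) = +-cong (*-cong (h 0) (k (suc n))) (conv-cong (h ∘ suc) k n)

  conv-scaleˡ : ∀ z f g n → conv (λ j → z * f j) g n ≈ z * conv f g n
  conv-scaleˡ z f g zero    = *-assoc z (f 0) (g 0)
  conv-scaleˡ z f g (suc n) = trans (+-congˡ (conv-scaleˡ z (f ∘ suc) g n))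
    (solve 4 (λ z a b c → z :* a :* b :+ z :* c := z :* (a :* b :+ c)) refl z (f 0) (g (suc n)) (conv (f ∘ suc) g n))

  conv-scaleʳ : ∀ z f g n → conv f (λ j → z * g j) n ≈ z * conv f g n
  conv-scaleʳ z f g zero    = solve 3 (λ z a b → a :* (z :* b) := z :* (a :* b)) refl z (f 0) (g 0)
  conv-scaleʳ z f g (suc n) = trans (+-congˡ (conv-scaleʳ z (f ∘ suc) g n))
    (solve 4 (λ z a b c → a :* (z :* b) :+ z :* c := z :* (a :* b :+ c)) refl z (f 0) (g (suc n)) (conv (f ∘ suc) g n))

  conv-+ˡ : ∀ f f′ g n → conv (λ j → f j + f′ j) g n ≈ conv f g n + conv f′ g n
  conv-+ˡ f f′ g zero    = distribʳ (g 0) (f 0) (f′ 0)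
  conv-+ˡ f f′ g (suc n) = trans (+-congˡ (conv-+ˡ (f ∘ suc) (f′ ∘ suc) g n))
    (solve 5 (λ a a′ b c c′ → (a :+ a′) :* b :+ (c :+ c′) := (a :* b :+ c) :+ (a′ :* b :+ c′)) refl
      (f 0) (f′ 0) (g (suc n)) (conv (f ∘ suc) g n) (conv (f′ ∘ suc) g n))

  conv-+ʳ : ∀ f g g′ n → conv f (λ j → g j + g′ j) n ≈ conv f g n + conv f g′ n
  conv-+ʳ f g g′ zero    = distribˡ (f 0) (g 0) (g′ 0)
  conv-+ʳ f g g′ (suc n) = trans (+-congˡ (conv-+ʳ (f ∘ suc) g g′ n))
    (solve 5 (λ a b b′ c c′ → a :* (b :+ b′) :+ (c :+ c′) := (a :* b :+ c) :+ (a :* b′ :+ c′)) refl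
      (f 0) (g (suc n)) (g′ (suc n)) (conv (f ∘ suc) g n) (conv (f ∘ suc) g′ n))

  -- Only the last term f (n + 1) h 0 is lost. The case in view is h = `S g`, an empty sum at 0.
  conv-shift : ∀ f h → h 0 ≈ 0# → ∀ n → conv f h (suc n) ≈ conv f (h ∘ suc) n
  conv-shift f h h0 zero    = trans (+-congˡ (trans (*-congˡ h0) (zeroʳ (f 1)))) (+-identityʳ _)
  conv-shift f h h0 (suc n) = +-congˡ (conv-shift (f ∘ suc) h h0 n)

  S-front : ∀ f n → S f (suc n) ≈ f 0 + S (f ∘ suc) n
  S-front f zero    = trans (+-identityˡ (f 0)) (sym (+-identityʳ (f 0)))
  S-front f (suc n) = trans (+-congʳ (S-front f n)) (+-assoc (f 0) (S (f ∘ suc) n) (f (suc n)))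

  conv-const : ∀ f c n → conv f (λ _ → c) n ≈ S f (suc n) * c
  conv-const f c zero    = *-congʳ (sym (+-identityˡ (f 0)))
  conv-const f c (suc n) = trans (+-congˡ (conv-const (f ∘ suc) c n))
    (trans (sym (distribʳ c (f 0) (S (f ∘ suc) (suc n)))) (*-congʳ (sym (S-front f (suc n)))))

  -- In generating functions, the factor x/(1 - x) is moved onto the second series.
  S-conv : ∀ f g n → S (conv f g) n ≈ conv f (S g) n
  S-conv f g zero    = sym (zeroʳ (f 0))
  S-conv f g (suc n) = begin
    S (conv f g) n + conv f g n        ≈⟨ +-congʳ (S-conv f g n) ⟩
    conv f (S g) n + conv f g n        ≈⟨ sym (conv-+ʳ f (S g) g n) ⟩
    conv f (S g ∘ suc) n               ≈⟨ sym (conv-shift f (S g) refl n) ⟩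
    conv f (S g) (suc n)               ∎

  -- The error made by multiplying partial sums becomes a convolution of f with tails of g, a form
  -- that can be majorised term by term. The first factor has n + 1 terms because `conv f _ n`
  -- involves f 0, ..., f n.
  cauchy-product : ∀ f g n → S f (suc n) * S g n - S (conv f g) n ≈ conv f (λ i → S g n - S g i) n
  cauchy-product f g n = begin
    S f (suc n) * S g n - S (conv f g) n
      ≈⟨ +-cong (sym (conv-const f (S g n) n)) (-‿cong (S-conv f g n)) ⟩
    conv f (λ _ → S g n) n - conv f (S g) n
      ≈⟨ +-congʳ (conv-cong {g = λ _ → S g n} (λ _ → refl)
          (λ i → solve 2 (λ a b → a := (a :- b) :+ b) refl (S g n) (S g i)) n) ⟩
    conv f (λ i → (S g n - S g i) + S g i) n - conv f (S g) n
      ≈⟨ +-congʳ (conv-+ʳ f (λ i → S g n - S g i) (S g) n) ⟩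
    conv f (λ i → S g n - S g i) n + conv f (S g) n - conv f (S g) n
      ≈⟨ solve 2 (λ a b → a :+ b :- b := a) refl (conv f (λ i → S g n - S g i) n) (conv f (S g) n) ⟩
    conv f (λ i → S g n - S g i) n ∎

  -- The coefficients of the formal derivative.
  D : (ℕ → Carrier) → ℕ → Carrier
  D f j = ν (suc j) * f (suc j)

  -- The product rule for formal derivatives. After f 0 is removed, each weight j + 2 on f splits as
  -- 1 + (j + 1): the parts j + 1 feed the induction hypothesis, and the ones reassemble
  -- `conv (f ∘ suc) g (suc n)`.
  leibniz : ∀ f g n → conv (D f) g n + conv f (D g) n ≈ ν (suc n) * conv f g (suc n)
  leibniz f g zero = solve 5 (λ v f₀ f₁ g₀ g₁ → v :* f₁ :* g₀ :+ f₀ :* (v :* g₁) := v :* (f₀ :* g₁ :+ f₁ :* g₀)) refl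
    (ν 1) (f 0) (f 1) (g 0) (g 1)
  leibniz f g (suc n) = begin
    (ν 1 * f 1 * g (suc n) + conv (D f ∘ suc) g n) + (f 0 * (ν (suc (suc n)) * g (suc (suc n))) + conv (f ∘ suc) (D g) n)
      ≈⟨ +-cong (+-cong (*-congʳ (*-congʳ 1-homo)) (trans
            (conv-cong {g = g} (λ j → trans (*-congʳ (ν-suc (suc j))) (distribʳ _ _ _)) (λ _ → refl) n)
            (conv-+ˡ (λ j → 1# * f (suc (suc j))) (D (f ∘ suc)) g n)))
          (+-congʳ (*-congˡ (*-congʳ (ν-suc (suc n))))) ⟩
    (1# * f 1 * g (suc n) + (conv (λ j → 1# * f (suc (suc j))) g n + conv (D (f ∘ suc)) g n))
      + (f 0 * ((1# + ν (suc n)) * g (suc (suc n))) + conv (f ∘ suc) (D g) n)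
      ≈⟨ rearrange (1# * f 1 * g (suc n)) _ _ _ _ ⟩
    (1# * f 1 * g (suc n) + conv (λ j → 1# * f (suc (suc j))) g n)
      + (f 0 * ((1# + ν (suc n)) * g (suc (suc n))) + (conv (D (f ∘ suc)) g n + conv (f ∘ suc) (D g) n))
      ≈⟨ +-cong (+-cong (*-congʳ (*-identityˡ (f 1))) (conv-cong {g = g} (λ j → *-identityˡ (f (suc (suc j)))) (λ _ → refl) n))
           (+-congˡ (leibniz (f ∘ suc) g n)) ⟩
    conv (f ∘ suc) g (suc n) + (f 0 * ((1# + ν (suc n)) * g (suc (suc n))) + ν (suc n) * conv (f ∘ suc) g (suc n))
      ≈⟨ +-congʳ (sym (*-identityˡ _)) ⟩
    1# * conv (f ∘ suc) g (suc n) + (f 0 * ((1# + ν (suc n)) * g (suc (suc n))) + ν (suc n) * conv (f ∘ suc) g (suc n))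
      ≈⟨ solve 5 (λ i a b c v → i :* c :+ (a :* ((i :+ v) :* b) :+ v :* c) := (i :+ v) :* (a :* b :+ c)) refl
           1# (f 0) (g (suc (suc n))) (conv (f ∘ suc) g (suc n)) (ν (suc n)) ⟩
    (1# + ν (suc n)) * (f 0 * g (suc (suc n)) + conv (f ∘ suc) g (suc n))
      ≈⟨ *-congʳ (sym (ν-suc (suc n))) ⟩
    ν (suc (suc n)) * (f 0 * g (suc (suc n)) + conv (f ∘ suc) g (suc n)) ∎
    where
    rearrange : ∀ a b c d e → (a + (b + c)) + (d + e) ≈ (a + b) + (d + (c + e))
    rearrange = solve 5 (λ a b c d e → (a :+ (b :+ c)) :+ (d :+ e) := (a :+ b) :+ (d :+ (c :+ e))) refl

  -- t z n = zⁿ / n!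
  t : Carrier → ℕ → Carrier
  t z zero    = 1#
  t z (suc n) = ι (recip n) * (z * t z n)

  D-t : ∀ z n → D (t z) n ≈ z * t z n
  D-t z n = trans (sym (*-assoc (ν (suc n)) (ι (recip n)) (z * t z n)))
    (trans (*-congʳ (ν*recip n)) (*-identityˡ (z * t z n)))

  t-cong : ∀ {z w} → z ≈ w → ∀ n → t z n ≈ t w n
  t-cong h zero    = refl
  t-cong h (suc n) = *-congˡ (*-cong h (t-cong h n))

  -- Both sides satisfy c₀ = 1 and (n + 1) cₙ₊₁ = (z + w) cₙ.
  conv-t : ∀ z w n → conv (t z) (t w) n ≈ t (z + w) n
  conv-t z w zero    = *-identityˡ 1#
  conv-t z w (suc n) = begin
    c (suc n)                                                      ≈⟨ sym (*-identityˡ (c (suc n))) ⟩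
    1# * c (suc n)                                                 ≈⟨ *-congʳ (sym (ν*recip n)) ⟩
    ν (suc n) * ι (recip n) * c (suc n)
      ≈⟨ solve 3 (λ v r c → v :* r :* c := r :* (v :* c)) refl (ν (suc n)) (ι (recip n)) (c (suc n)) ⟩
    ι (recip n) * (ν (suc n) * c (suc n))                          ≈⟨ *-congˡ (sym (leibniz (t z) (t w) n)) ⟩
    ι (recip n) * (conv (D (t z)) (t w) n + conv (t z) (D (t w)) n)
      ≈⟨ *-congˡ (+-cong
          (trans (conv-cong {g = t w} (D-t z) (λ _ → refl) n) (conv-scaleˡ z (t z) (t w) n))
          (trans (conv-cong {f = t z} (λ _ → refl) (D-t w) n) (conv-scaleʳ w (t z) (t w) n))) ⟩
    ι (recip n) * (z * c n + w * c n)                              ≈⟨ *-congˡ (sym (distribʳ (c n) z w)) ⟩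
    ι (recip n) * ((z + w) * c n)                                  ≈⟨ *-congˡ (*-congˡ (conv-t z w n)) ⟩
    ι (recip n) * ((z + w) * t (z + w) n)                          ∎
    where c = conv (t z) (t w)

-- Complex numbers and majorants of complex series.

module Complex (K : CompleteOrderedField) where

  open OrderedField K

  infix  4 _≈ᶜ_
  infixl 6 _+ᶜ_
  infixl 7 _*ᶜ_

  Cx : Set
  Cx = Carrier × Carrier

  re im : Cx → Carrier
  re = proj₁
  im = proj₂

  record _≈ᶜ_ (z w : Cx) : Set where
    constructor mk
    field
      re≈ : re z ≈ re w
      im≈ : im z ≈ im w

  open _≈ᶜ_ public

  _+ᶜ_ _*ᶜ_ : Cx → Cx → Cx
  (a , b) +ᶜ (c , d) = a + c , b + d
  (a , b) *ᶜ (c , d) = a * c - b * d , a * d + b * c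

  -ᶜ_ : Cx → Cx
  -ᶜ (a , b) = - a , - b

  ιᶜ : ℚ → Cx
  ιᶜ q = ι q , 0#

  complexRing : CommutativeRing 0ℓ 0ℓ
  complexRing = record
    { Carrier = Cx ; _≈_ = _≈ᶜ_ ; _+_ = _+ᶜ_ ; _*_ = _*ᶜ_ ; -_ = -ᶜ_ ; 0# = ιᶜ 0ℚ ; 1# = ιᶜ 1ℚ
    ; isCommutativeRing = record
      { isRing = record
        { +-isAbelianGroup = record
          { isGroup = record
            { isMonoid = record
              { isSemigroup = record
                { isMagma = record
                  { isEquivalence = record
                    { refl  = mk ≈-refl ≈-refl
                    ; sym   = λ (mk p q) → mk (≈-sym p) (≈-sym q)
                    ; trans = λ (mk p q) (mk p′ q′) → mk (≈-trans p p′) (≈-trans q q′)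
                    }
                  ; ∙-cong = λ (mk p q) (mk p′ q′) → mk (+-cong p p′) (+-cong q q′)
                  }
                ; assoc = λ (a , b) (c , d) (e , f) → mk (assoc₊ a c e) (assoc₊ b d f)
                }
              ; identity = (λ (a , b) → mk (+-identityˡ a) (+-identityˡ b))
                         , (λ (a , b) → mk (+-identityʳ a) (+-identityʳ b))
              }
            ; inverse = (λ (a , b) → mk (invˡ a) (invˡ b)) , (λ (a , b) → mk (invʳ a) (invʳ b))
            ; ⁻¹-cong = λ (mk p q) → mk (-‿cong p) (-‿cong q)
            }
          ; comm = λ (a , b) (c , d) → mk (+-comm a c) (+-comm b d)
          }
        ; *-cong = λ (mk p q) (mk p′ q′) →
            mk (+-cong (*-cong p p′) (-‿cong (*-cong q q′))) (+-cong (*-cong p q′) (*-cong q p′))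
        ; *-assoc = λ (a , b) (c , d) (e , f) → mk
            (solve 6 (λ a b c d e f → (a :* c :- b :* d) :* e :- (a :* d :+ b :* c) :* f :=
              a :* (c :* e :- d :* f) :- b :* (c :* f :+ d :* e)) ≈-refl a b c d e f)
            (solve 6 (λ a b c d e f → (a :* c :- b :* d) :* f :+ (a :* d :+ b :* c) :* e :=
              a :* (c :* f :+ d :* e) :+ b :* (c :* e :- d :* f)) ≈-refl a b c d e f)
        ; *-identity =
            (λ (a , b) → mk (solve 2 (λ a b → con 1ℚ :* a :- con 0ℚ :* b := a) ≈-refl a b)
              (solve 2 (λ a b → con 1ℚ :* b :+ con 0ℚ :* a := b) ≈-refl a b))
          , (λ (a , b) → mk (solve 2 (λ a b → a :* con 1ℚ :- b :* con 0ℚ := a) ≈-refl a b)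
              (solve 2 (λ a b → a :* con 0ℚ :+ b :* con 1ℚ := b) ≈-refl a b))
        ; distrib =
            (λ (a , b) (c , d) (e , f) → mk
              (solve 6 (λ a b c d e f → a :* (c :+ e) :- b :* (d :+ f) := (a :* c :- b :* d) :+ (a :* e :- b :* f))
                ≈-refl a b c d e f)
              (solve 6 (λ a b c d e f → a :* (d :+ f) :+ b :* (c :+ e) := (a :* d :+ b :* c) :+ (a :* f :+ b :* e))
                ≈-refl a b c d e f))
          , (λ (a , b) (c , d) (e , f) → mk
              (solve 6 (λ a b c d e f → (c :+ e) :* a :- (d :+ f) :* b := (c :* a :- d :* b) :+ (e :* a :- f :* b))
                ≈-refl a b c d e f)
              (solve 6 (λ a b c d e f → (c :+ e) :* b :+ (d :+ f) :* a := (c :* b :+ d :* a) :+ (e :* b :+ f :* a))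
                ≈-refl a b c d e f))
        }
      ; *-comm = λ (a , b) (c , d) → mk
          (solve 4 (λ a b c d → a :* c :- b :* d := c :* a :- d :* b) ≈-refl a b c d)
          (solve 4 (λ a b c d → a :* d :+ b :* c := c :* b :+ d :* a) ≈-refl a b c d)
      }
    }
    where
    assoc₊ : ∀ x y z → (x + y) + z ≈ x + (y + z)
    assoc₊ = solve 3 (λ x y z → (x :+ y) :+ z := x :+ (y :+ z)) ≈-refl
    invˡ : ∀ x → - x + x ≈ 0#
    invˡ = solve 1 (λ x → :- x :+ x := con 0ℚ) ≈-refl
    invʳ : ∀ x → x + - x ≈ 0#
    invʳ = solve 1 (λ x → x :+ :- x := con 0ℚ) ≈-refl

  complexCoefficients : CommutativeRing.rawRing ℚₚ.+-*-commutativeRing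
    -Raw-AlmostCommutative⟶ fromCommutativeRing complexRing
  complexCoefficients = record
    { ⟦_⟧ = ιᶜ
    ; +-homo = λ p q → mk (ι-+ p q) (≈-sym (+-identityʳ 0#))
    ; *-homo = λ p q → mk
        (≈-trans (ι-* p q) (solve 2 (λ p q → p :* q := p :* q :- con 0ℚ :* con 0ℚ) ≈-refl (ι p) (ι q)))
        (solve 2 (λ p q → con 0ℚ := p :* con 0ℚ :+ con 0ℚ :* q) ≈-refl (ι p) (ι q))
    ; -‿homo = λ p → mk (ι-neg p) (solve 0 (con 0ℚ := :- con 0ℚ) ≈-refl)
    ; 0-homo = mk ≈-refl ≈-refl
    ; 1-homo = mk ≈-refl ≈-refl
    }

  module ℂ = CommutativeRing complexRing
  module Sᶜ = PowerSeries complexRing complexCoefficients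
  module Sʳ = PowerSeries commutativeRing coefficients

  infix 4 ∣_∣ᶜ≤_

  -- A bound on the larger coordinate needs no square roots. Its price is a factor 2 in products,
  -- which is why the majorants below are taken at r + r.
  record ∣_∣ᶜ≤_ (z : Cx) (r : Carrier) : Set where
    constructor bounds
    field
      re≤ : ∣ re z ∣≤ r
      im≤ : ∣ im z ∣≤ r

  open ∣_∣ᶜ≤_ public

  ∣∣ᶜ-+ : ∀ {z w r s} → ∣ z ∣ᶜ≤ r → ∣ w ∣ᶜ≤ s → ∣ z +ᶜ w ∣ᶜ≤ r + s
  ∣∣ᶜ-+ (bounds p q) (bounds p′ q′) = bounds (∣∣-+ p p′) (∣∣-+ q q′)

  ∣∣ᶜ-* : ∀ {z w r s} → ∣ z ∣ᶜ≤ r → ∣ w ∣ᶜ≤ s → ∣ z *ᶜ w ∣ᶜ≤ (r + r) * s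
  ∣∣ᶜ-* {z} {w} {r} {s} (bounds p q) (bounds p′ q′) = bounds
    (∣∣-cong ≈-refl double (∣∣-+ (∣∣-* p p′) (∣∣-neg (∣∣-* q q′))))
    (∣∣-cong ≈-refl double (∣∣-+ (∣∣-* p q′) (∣∣-* q p′)))
    where
    double : r * s + r * s ≈ (r + r) * s
    double = solve 2 (λ r s → r :* s :+ r :* s := (r :+ r) :* s) ≈-refl r s

  ∣∣ᶜ-cong : ∀ {z w r s} → z ≈ᶜ w → r ≈ s → ∣ z ∣ᶜ≤ r → ∣ w ∣ᶜ≤ s
  ∣∣ᶜ-cong (mk e f) g (bounds p q) = bounds (∣∣-cong e g p) (∣∣-cong f g q)

  ∣∣ᶜ-bound : ∀ z → ∃ λ B → 0ℚ ℚ.< B × ∣ z ∣ᶜ≤ ι B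
  ∣∣ᶜ-bound (a , b) =
    let A , A>0 , p = ∣∣-bound a
        B , B>0 , q = ∣∣-bound b
    in A ℚ.+ B , ℚ-+-pos A>0 B>0
     , bounds (∣∣-mono (≤-by (ι B) (ι-nonneg B>0) (ι-+ A B)) p)
         (∣∣-mono (≤-by (ι A) (ι-nonneg A>0) (≈-trans (ι-+ A B) (+-comm (ι A) (ι B)))) q)

  conv-dominated : ∀ {f F h H} n → (∀ j → ∣ f j ∣ᶜ≤ F j) → (∀ i → i ℕ.≤ n → ∣ h i ∣ᶜ≤ H i) →
    ∣ Sᶜ.conv f h n ∣ᶜ≤ Sʳ.conv (λ j → F j + F j) H n
  conv-dominated zero    p q = ∣∣ᶜ-* (p 0) (q 0 ℕ.z≤n)
  conv-dominated {f} {F} {h} {H} (suc n) p q = ∣∣ᶜ-+ (∣∣ᶜ-* (p 0) (q (suc n) ℕₚ.≤-refl))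
    (conv-dominated {f ∘ suc} {F ∘ suc} {h} {H} n (p ∘ suc) (λ i h → q i (ℕₚ.m≤n⇒m≤1+n h)))

  S-tail-dominated : ∀ {g G} → (∀ j → ∣ g j ∣ᶜ≤ G j) → ∀ {i n} → i ℕ.≤′ n →
    ∣ Sᶜ.S g n ℂ.- Sᶜ.S g i ∣ᶜ≤ Sʳ.S G n - Sʳ.S G i
  S-tail-dominated {g} {G} p {i} ℕ.≤′-refl = bounds (zero-bound (re (Sᶜ.S g i))) (zero-bound (im (Sᶜ.S g i)))
    where
    zero-bound : ∀ x → ∣ x - x ∣≤ Sʳ.S G i - Sʳ.S G i
    zero-bound x = ∣∣-cong {x = 0#} {r = 0#}
      (solve 1 (λ x → con 0ℚ := x :- x) ≈-refl x) (solve 1 (λ x → con 0ℚ := x :- x) ≈-refl (Sʳ.S G i))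
      (∣∣-nonneg ≤-refl ≤-refl)
  S-tail-dominated {g} {G} p {i} {suc n} (ℕ.≤′-step h) =
    ∣∣ᶜ-cong (mk (shift (re (Sᶜ.S g n)) _ _) (shift (im (Sᶜ.S g n)) _ _)) (shift (Sʳ.S G n) _ _)
      (∣∣ᶜ-+ (S-tail-dominated p h) (p n))
    where
    shift : ∀ a b c → a - b + c ≈ a + c - b
    shift = solve 3 (λ a b c → a :- b :+ c := a :+ c :- b) ≈-refl

  conv-nonneg : ∀ {F H} → (∀ j → 0# ≤ F j) → (∀ j → 0# ≤ H j) → ∀ n → 0# ≤ Sʳ.conv F H n
  conv-nonneg p q zero    = *-nonneg (p 0) (q 0)
  conv-nonneg p q (suc n) = +-nonneg (*-nonneg (p 0) (q (suc n))) (conv-nonneg (p ∘ suc) q n)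

  S-nonneg : ∀ {F} → (∀ j → 0# ≤ F j) → ∀ n → 0# ≤ Sʳ.S F n
  S-nonneg p zero    = ≤-refl
  S-nonneg p (suc n) = +-nonneg (S-nonneg p n) (p n)

  S-mono : ∀ {F} → (∀ j → 0# ≤ F j) → ∀ {m n} → m ℕ.≤′ n → Sʳ.S F m ≤ Sʳ.S F n
  S-mono p ℕ.≤′-refl = ≤-refl
  S-mono {F} p (ℕ.≤′-step {n} h) = ≤-trans (S-mono p h) (≤-by (F n) (p n) ≈-refl)

  -- The first n terms of the convolution pair F with H at indices above k, where the monotone H is
  -- at least H k; all other terms are nonnegative.
  conv-lower : ∀ {F H} → (∀ j → 0# ≤ F j) → (∀ j → 0# ≤ H j) → (∀ m n → m ℕ.≤ n → H m ≤ H n) →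
    ∀ n k → Sʳ.S F n * H k ≤ Sʳ.conv F H (n ℕ.+ k)
  conv-lower {F} {H} p q mono zero k = ≤-respˡ-≈ (≈-sym (zeroˡ (H k))) (conv-nonneg p q k)
  conv-lower {F} {H} p q mono (suc n) k =
    ≤-respˡ-≈ (≈-trans (solve 3 (λ a b c → a :* c :+ b :* c := (a :+ b) :* c) ≈-refl (F 0) (Sʳ.S (F ∘ suc) n) (H k))
        (*-congʳ (≈-sym (Sʳ.S-front F n))))
      (+-mono-≤ (*-monoˡ-≤ (p 0) (mono k (suc (n ℕ.+ k)) (ℕₚ.m≤n⇒m≤1+n (ℕₚ.m≤n+m k n))))
        (conv-lower (p ∘ suc) q mono n k))

  t-nonneg : ∀ {a} → 0# ≤ a → ∀ n → 0# ≤ Sʳ.t a n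
  t-nonneg h zero    = 0≤1
  t-nonneg h (suc n) = *-nonneg (ι-nonneg (recip-pos n)) (*-nonneg h (t-nonneg h n))

  t-dominated : ∀ {z r} → ∣ z ∣ᶜ≤ r → ∀ n → ∣ Sᶜ.t z n ∣ᶜ≤ Sʳ.t (r + r) n
  t-dominated h zero = bounds (∣∣-nonneg 0≤1 ≤-refl) (∣∣-nonneg ≤-refl 0≤1)
  t-dominated {z} {r} h (suc n) = ∣∣ᶜ-cong
    (mk (solve 3 (λ q a b → q :* a := q :* a :- con 0ℚ :* b) ≈-refl q (re w) (im w))
        (solve 3 (λ q a b → q :* b := q :* b :+ con 0ℚ :* a) ≈-refl q (re w) (im w)))
    ≈-refl
    (bounds (∣∣-* q-bound (re≤ w-bound)) (∣∣-* q-bound (im≤ w-bound)))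
    where
    q = ι (recip n)
    w = z *ᶜ Sᶜ.t z n
    q-bound : ∣ q ∣≤ q
    q-bound = ∣∣-nonneg (ι-nonneg (recip-pos n)) ≤-refl
    w-bound : ∣ w ∣ᶜ≤ (r + r) * Sʳ.t (r + r) n
    w-bound = ∣∣ᶜ-* h (t-dominated h n)

-- Convergence and functional equation of the exponential series.

module ExpSeries (K : CompleteOrderedField) where

  open OrderedField K public
  open Complex K public
  open Sʳ public using (ν; ν-suc; ν*recip)

  ν-mono : ∀ {m n} → m ℕ.≤ n → ν m ≤ ν n
  ν-mono h = ι-mono-≤ (natℚ-mono h)

  ν-nonneg : ∀ n → 0# ≤ ν n
  ν-nonneg n = ν-mono {0} {n} ℕ.z≤n

  1≤ν : ∀ n → 1# ≤ ν (suc n)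
  1≤ν n = ν-mono {1} {suc n} (ℕ.s≤s ℕ.z≤n)

  ν-above : ∀ x → ∃ λ n → x ≤ ν n
  ν-above x = let q , h = ι-above x ; n , k = natℚ-above q in n , ≤-trans h (ι-mono-≤ k)

  ν-multiple-above : ∀ x ε → 0ℚ ℚ.< ε → ∃ λ n → x ≤ ν n * ι ε
  ν-multiple-above x ε ε>0 =
    let B , B>0 , h = positive-bound x
        δ , δ>0 , eq = ℚ-divide ε>0 B>0
        n , k = natℚ-above δ
    in n , ≤-trans h (≤-respˡ-≈ (≈-trans (≈-sym (ι-* δ ε)) (Sʳ.ι-cong (≡.trans (ℚₚ.*-comm δ ε) eq)))
      (*-mono-≤ (ν-nonneg n) (ι-nonneg ε>0) (ι-mono-≤ k) ≤-refl))

  double : ∀ x → ι (natℚ 2) * x ≈ x + x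
  double = solve 1 (λ x → con (natℚ 2) :* x := x :+ x) ≈-refl

  module _ {a} (0≤a : 0# ≤ a) where

    private
      t = Sʳ.t a
      e = Sʳ.S t
      K₀ = proj₁ (ν-above (a + a))

    -- The ratio of consecutive terms is a/(n + 1), and 2 a ≤ K₀ ≤ n + 1.
    t-halves : ∀ n → K₀ ℕ.≤ n → t (suc n) + t (suc n) ≤ t n
    t-halves n h = ≤-respˡ-≈ (solve 3 (λ r a t → r :* (a :+ a) :* t := r :* (a :* t) :+ r :* (a :* t)) ≈-refl (ι (recip n)) a (t n))
      (≤-respʳ-≈ (≈-trans (*-congʳ (≈-trans (*-comm (ι (recip n)) (ν (suc n))) (ν*recip n))) (*-identityˡ (t n)))
        (≤-respˡ-≈ (*-comm (t n) (ι (recip n) * (a + a))) (≤-respʳ-≈ (*-comm (t n) (ι (recip n) * ν (suc n)))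
          (*-monoˡ-≤ (t-nonneg 0≤a n) (*-monoˡ-≤ (ι-nonneg (recip-pos n))
            (≤-trans (proj₂ (ν-above (a + a))) (ν-mono (ℕₚ.m≤n⇒m≤1+n h))))))))

    -- Halving beats the growth of the weight, as i + 2 ≤ 2 (i + 1). Decay like 1/(i + 1) is all
    -- that the comparison with ε requires.
    t-decay : ∀ i → ν (suc i) * t (i ℕ.+ K₀) ≤ t K₀
    t-decay zero = ≤-reflexive (*-identityˡ (t K₀))
    t-decay (suc i) = ≤-trans
      (≤-respʳ-≈ (solve 2 (λ v t → (v :+ v) :* t := v :* (t :+ t)) ≈-refl (ν (suc i)) (t (suc (i ℕ.+ K₀))))
        (*-mono-≤ (+-nonneg (ν-nonneg (suc i)) (ν-nonneg (suc i))) (t-nonneg 0≤a (suc (i ℕ.+ K₀)))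
          (≤-respˡ-≈ (≈-sym (ν-suc (suc i))) (+-mono-≤ (1≤ν i) ≤-refl)) ≤-refl))
      (≤-trans (*-monoˡ-≤ (ν-nonneg (suc i)) (t-halves (i ℕ.+ K₀) (ℕₚ.m≤n+m K₀ i))) (t-decay i))

    -- The quantity e n + 2 t n does not increase: passing to n + 1 adds t n to the sum and replaces
    -- 2 t n by 2 t (n + 1) ≤ t n. Hence the tail from n on is at most 2 t n.
    S-tail : ∀ {n m} → K₀ ℕ.≤ n → n ℕ.≤′ m → e m + (t m + t m) ≤ e n + (t n + t n)
    S-tail h ℕ.≤′-refl = ≤-refl
    S-tail h (ℕ.≤′-step {m} k) = ≤-trans
      (≤-by (t m - (t (suc m) + t (suc m))) (≤⇒gap (t-halves m (ℕₚ.≤-trans h (ℕₚ.≤′⇒≤ k))))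
        (solve 3 (λ e t u → e :+ (t :+ t) := (e :+ t :+ (u :+ u)) :+ (t :- (u :+ u))) ≈-refl (e m) (t m) (t (suc m))))
      (S-tail h k)

    S-cauchy : ∀ ε → 0ℚ ℚ.< ε → ∃ λ N → ∀ m n → N ℕ.≤ m → N ℕ.≤ n → e m ≤ e n + ι ε
    S-cauchy ε ε>0 = M ℕ.+ K₀ , bound
      where
      -- With 2 t K₀ ≤ M ε, the decay gives 2 t (i + K₀) ≤ ε for all i ≥ M.
      M = proj₁ (ν-multiple-above (t K₀ + t K₀) ε ε>0)
      small : ∀ i → M ℕ.≤ i → t (i ℕ.+ K₀) + t (i ℕ.+ K₀) ≤ ι ε
      small i h = *-cancelˡ-≤ (<-≤-trans 0<1 (1≤ν i))
        (≤-trans (≤-respˡ-≈ (solve 2 (λ v t → v :* t :+ v :* t := v :* (t :+ t)) ≈-refl (ν (suc i)) (t (i ℕ.+ K₀)))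
            (+-mono-≤ (t-decay i) (t-decay i)))
          (≤-trans (proj₂ (ν-multiple-above (t K₀ + t K₀) ε ε>0))
            (*-mono-≤ (ν-nonneg (suc i)) (ι-nonneg ε>0) (ν-mono (ℕₚ.m≤n⇒m≤1+n h)) ≤-refl)))
      small′ : ∀ n → M ℕ.+ K₀ ℕ.≤ n → t n + t n ≤ ι ε
      small′ n h = ≡.subst (λ n → t n + t n ≤ ι ε) (ℕₚ.m∸n+n≡m (ℕₚ.m+n≤o⇒n≤o M h))
        (small (n ℕ.∸ K₀) (≡.subst (ℕ._≤ n ℕ.∸ K₀) (ℕₚ.m+n∸n≡m M K₀) (ℕₚ.∸-monoˡ-≤ K₀ h)))
      bound : ∀ m n → M ℕ.+ K₀ ℕ.≤ m → M ℕ.+ K₀ ℕ.≤ n → e m ≤ e n + ι ε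
      bound m n p q with ℕₚ.≤-total m n
      ... | inj₁ m≤n = ≤-trans (S-mono (t-nonneg 0≤a) (ℕₚ.≤⇒≤′ m≤n)) (≤-by (ι ε) (ι-nonneg ε>0) ≈-refl)
      ... | inj₂ n≤m = ≤-trans (≤-by (t m + t m) (+-nonneg (t-nonneg 0≤a m) (t-nonneg 0≤a m)) ≈-refl)
        (≤-trans (S-tail (ℕₚ.m+n≤o⇒n≤o M q) (ℕₚ.≤⇒≤′ n≤m)) (+-mono-≤ ≤-refl (small′ n q)))

  expSum : Cx → ℕ → Cx
  expSum z = Sᶜ.S (Sᶜ.t z)

  infix 4 _⟶ᶜ_

  record _⟶ᶜ_ (a : ℕ → Cx) (L : Cx) : Set where
    constructor tends
    field
      re⟶ : (λ n → re (a n)) ⟶ re L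
      im⟶ : (λ n → im (a n)) ⟶ im L

  open _⟶ᶜ_ public

  module _ {z r} (0≤r : 0# ≤ r) (z≤r : ∣ z ∣ᶜ≤ r) where

    private
      0≤2r = +-nonneg 0≤r 0≤r
      e = Sʳ.S (Sʳ.t (r + r))

    expSum-close : ∀ ε → 0ℚ ℚ.< ε → ∃ λ N → ∀ m n → N ℕ.≤ m → N ℕ.≤ n →
      ∣ expSum z m ℂ.- expSum z n ∣ᶜ≤ ι ε
    expSum-close ε ε>0 = let N , h = S-cauchy 0≤2r ε ε>0 in N , λ m n p q → go m n (h m n p q) (h n m q p) (ℕₚ.≤-total m n)
      where
      go : ∀ m n → e m ≤ e n + ι ε → e n ≤ e m + ι ε → m ℕ.≤ n ⊎ n ℕ.≤ m → ∣ expSum z m ℂ.- expSum z n ∣ᶜ≤ ι ε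
      go m n p q (inj₂ n≤m) =
        let bounds u v = S-tail-dominated (t-dominated z≤r) (ℕₚ.≤⇒≤′ n≤m)
            h = ≤-by (e n + ι ε - e m) (≤⇒gap p) (solve 3 (λ m n ε → ε := (m :- n) :+ (n :+ ε :- m)) ≈-refl (e m) (e n) (ι ε))
        in bounds (∣∣-mono h u) (∣∣-mono h v)
      go m n p q (inj₁ m≤n) =
        let bounds u v = S-tail-dominated (t-dominated z≤r) (ℕₚ.≤⇒≤′ m≤n)
            h = ≤-by (e m + ι ε - e n) (≤⇒gap q) (solve 3 (λ m n ε → ε := (n :- m) :+ (m :+ ε :- n)) ≈-refl (e m) (e n) (ι ε))
        in bounds (∣∣-cong (flip (re (expSum z n)) _) ≈-refl (∣∣-neg (∣∣-mono h u)))
                  (∣∣-cong (flip (im (expSum z n)) _) ≈-refl (∣∣-neg (∣∣-mono h v)))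
        where
        flip : ∀ a b → - (a - b) ≈ b - a
        flip = solve 2 (λ a b → :- (a :- b) := b :- a) ≈-refl

  expSum-converges : ∀ z → ∃ λ L → expSum z ⟶ᶜ L
  expSum-converges z =
    let B , B>0 , z≤B = ∣∣ᶜ-bound z
        close = expSum-close (ι-nonneg B>0) z≤B
        P , p = cauchy⇒⟶ (re ∘ expSum z) λ ε ε>0 → let N , h = close ε ε>0 in N , λ m n u v → upper (re≤ (h m n u v))
        Q , q = cauchy⇒⟶ (im ∘ expSum z) λ ε ε>0 → let N , h = close ε ε>0 in N , λ m n u v → upper (im≤ (h m n u v))
    in (P , Q) , tends p q
    where
    upper : ∀ {a b ε} → ∣ a - b ∣≤ ε → a ≤ b + ε
    upper {a} {b} {ε} (_ , h) = ≤-by (ε - (a - b)) (≤⇒gap h) (solve 3 (λ a b ε → b :+ ε := a :+ (ε :- (a :- b))) ≈-refl a b ε)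

  ⟶ᶜ-* : ∀ {a b L M} → a ⟶ᶜ L → b ⟶ᶜ M → (λ n → a n *ᶜ b n) ⟶ᶜ (L *ᶜ M)
  ⟶ᶜ-* (tends p q) (tends p′ q′) = tends (⟶-+ (⟶-* p p′) (⟶-neg (⟶-* q q′))) (⟶-+ (⟶-* p q′) (⟶-* q p′))

  ⟶-reindex : ∀ {a L} (f : ℕ → ℕ) → (∀ n → n ℕ.≤ f n) → a ⟶ L → (a ∘ f) ⟶ L
  ⟶-reindex f n≤fn h ε ε>0 = let N , e = h ε ε>0 in N , λ n N≤n → e (f n) (ℕₚ.≤-trans N≤n (n≤fn n))

  ⟶-seq-cong : ∀ {a b L} → (∀ n → a n ≈ b n) → a ⟶ L → b ⟶ L
  ⟶-seq-cong e h ε ε>0 = eventually-map (λ n → ∣∣-cong (+-congʳ (e n)) ≈-refl) (h ε ε>0)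

  ⟶ᶜ-seq-cong : ∀ {a b L} → (∀ n → a n ≈ᶜ b n) → a ⟶ᶜ L → b ⟶ᶜ L
  ⟶ᶜ-seq-cong e (tends p q) = tends (⟶-seq-cong (re≈ ∘ e) p) (⟶-seq-cong (im≈ ∘ e) q)

  -- The Cauchy product of the partial sums for z and w differs from the partial sum for z + w
  -- by at most a tail of the exponential series of a majorant.
  module _ {z w r s} (0≤r : 0# ≤ r) (0≤s : 0# ≤ s) (z≤r : ∣ z ∣ᶜ≤ r) (w≤s : ∣ w ∣ᶜ≤ s) where

    private
      a = r + r
      b = s + s
      0≤a = +-nonneg 0≤r 0≤r
      0≤b = +-nonneg 0≤s 0≤s
      F = Sʳ.t a
      G = Sʳ.t b
      e = Sʳ.S (Sʳ.t (a + b))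
      d : ℕ → Carrier
      d n = e (suc n ℕ.+ n) - e n

    -- By `cauchy-product` the left side is a product of partial sums minus S (conv F G) n. By
    -- `conv-lower` and `S-conv` the product is at most S (conv F G) (2 n + 1), and `conv-t`
    -- identifies both sums with partial sums for a + b.
    majorant-tail : ∀ n → Sʳ.conv F (λ i → Sʳ.S G n - Sʳ.S G i) n ≤ d n
    majorant-tail n = ≤-respˡ-≈ (Sʳ.cauchy-product F G n) (≤-trans
      (≤-by (Sʳ.conv F (Sʳ.S G) (suc n ℕ.+ n) - Sʳ.S F (suc n) * Sʳ.S G n)
        (≤⇒gap (conv-lower (t-nonneg 0≤a) (S-nonneg (t-nonneg 0≤b))
          (λ m n h → S-mono (t-nonneg 0≤b) (ℕₚ.≤⇒≤′ h)) (suc n) n))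
        (solve 3 (λ c p q → c :- q := (p :- q) :+ (c :- p)) ≈-refl
          (Sʳ.conv F (Sʳ.S G) (suc n ℕ.+ n)) (Sʳ.S F (suc n) * Sʳ.S G n) (Sʳ.S (Sʳ.conv F G) n)))
      (≤-reflexive (+-cong
        (≈-trans (≈-sym (Sʳ.S-conv F G (suc n ℕ.+ n))) (Sʳ.S-cong (Sʳ.conv-t a b) (suc n ℕ.+ n)))
        (-‿cong (Sʳ.S-cong (Sʳ.conv-t a b) n)))))

    product-error : ∀ n → ∣ (expSum z (suc n) *ᶜ expSum w n) ℂ.- expSum (z +ᶜ w) n ∣ᶜ≤ d n + d n
    product-error n = mono (≤-respˡ-≈ (≈-sym (Sʳ.conv-+ˡ F F _ n)) (+-mono-≤ (majorant-tail n) (majorant-tail n)))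
      (∣∣ᶜ-cong
        (ℂ.trans (ℂ.sym (Sᶜ.cauchy-product (Sᶜ.t z) (Sᶜ.t w) n))
          (ℂ.+-congˡ {expSum z (suc n) *ᶜ expSum w n} (ℂ.-‿cong (Sᶜ.S-cong (Sᶜ.conv-t z w) n))))
        ≈-refl
        (conv-dominated n (t-dominated z≤r) (λ i h → S-tail-dominated (t-dominated w≤s) (ℕₚ.≤⇒≤′ h))))
      where
      mono : ∀ {x p q} → p ≤ q → ∣ x ∣ᶜ≤ p → ∣ x ∣ᶜ≤ q
      mono h (bounds u v) = bounds (∣∣-mono h u) (∣∣-mono h v)

    error-vanishes : (λ n → d n + d n) ⟶ 0#
    error-vanishes =
      let L , h = cauchy⇒⟶ e (S-cauchy (+-nonneg 0≤a 0≤b))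
          d⟶ = ⟶-+ (⟶-reindex (λ n → suc n ℕ.+ n) (λ n → ℕₚ.m≤n⇒m≤1+n (ℕₚ.m≤m+n n n)) h) (⟶-neg h)
      in ⟶-limit-cong (solve 1 (λ L → (L :- L) :+ (L :- L) := con 0ℚ) ≈-refl L) (⟶-+ d⟶ d⟶)

    expSum-* : ∀ {L M P} → expSum z ⟶ᶜ L → expSum w ⟶ᶜ M → expSum (z +ᶜ w) ⟶ᶜ P → L *ᶜ M ≈ᶜ P
    expSum-* (tends p q) (tends p′ q′) (tends u v) =
      -- The shift by `⟶-suc` matches the extra term that `product-error` takes for z.
      let tends x y = ⟶ᶜ-* (tends (⟶-suc p) (⟶-suc q)) (tends p′ q′)
      in mk (⟶-squeeze x u error-vanishes (λ n → re≤ (product-error n)))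
            (⟶-squeeze y v error-vanishes (λ n → im≤ (product-error n)))

  exp-+ : ∀ {z w ζ L M P} → z +ᶜ w ≈ᶜ ζ → expSum z ⟶ᶜ L → expSum w ⟶ᶜ M → expSum ζ ⟶ᶜ P → L *ᶜ M ≈ᶜ P
  exp-+ {z} {w} e p q r =
    let A , A>0 , z≤A = ∣∣ᶜ-bound z
        B , B>0 , w≤B = ∣∣ᶜ-bound w
    in expSum-* (ι-nonneg A>0) (ι-nonneg B>0) z≤A w≤B p q (⟶ᶜ-seq-cong (Sᶜ.S-cong (Sᶜ.t-cong (ℂ.sym e))) r)

  t-real : ∀ x n → Sᶜ.t (x , 0#) n ≈ᶜ (Sʳ.t x n , 0#)
  t-real x zero = mk ≈-refl ≈-refl
  t-real x (suc n) = ℂ.trans (ℂ.*-congˡ {ιᶜ (recip n)} (ℂ.*-congˡ {x , 0#} (t-real x n))) (mk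
    (solve 3 (λ r x t → r :* (x :* t :- con 0ℚ :* con 0ℚ) :- con 0ℚ :* (x :* con 0ℚ :+ con 0ℚ :* t) := r :* (x :* t)) ≈-refl
      (ι (recip n)) x (Sʳ.t x n))
    (solve 3 (λ r x t → r :* (x :* con 0ℚ :+ con 0ℚ :* t) :+ con 0ℚ :* (x :* t :- con 0ℚ :* con 0ℚ) := con 0ℚ) ≈-refl
      (ι (recip n)) x (Sʳ.t x n)))

  expSum-real : ∀ x n → expSum (x , 0#) n ≈ᶜ (Sʳ.S (Sʳ.t x) n , 0#)
  expSum-real x zero    = mk ≈-refl ≈-refl
  expSum-real x (suc n) = ℂ.trans (ℂ.+-cong (expSum-real x n) (t-real x n)) (mk ≈-refl (+-identityʳ 0#))

  scaleᶜ : ℚ → Cx → Cx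
  scaleᶜ q z = ι q * re z , ι q * im z

  -- Only the recursions of 1/n! and zⁿ enter, so the lemma applies to the factorials and powers of
  -- the statement, which are defined outside the abstract field.
  scaled-powers : ∀ {z} (c : ℕ → ℚ) (P : ℕ → Cx) → c 0 ≡ 1ℚ → (∀ n → c (suc n) ≡ recip n ℚ.* c n) →
    P 0 ≈ᶜ ιᶜ 1ℚ → (∀ n → P (suc n) ≈ᶜ z *ᶜ P n) → ∀ n → scaleᶜ (c n) (P n) ≈ᶜ Sᶜ.t z n
  scaled-powers c P c₀ cₛ P₀ Pₛ zero = mk
    (≈-trans (*-cong (Sʳ.ι-cong c₀) (re≈ P₀)) (*-identityˡ 1#))
    (≈-trans (*-cong (Sʳ.ι-cong c₀) (im≈ P₀)) (*-identityˡ 0#))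
  scaled-powers {z} c P c₀ cₛ P₀ Pₛ (suc n) = ℂ.trans
    (mk
      (≈-trans (*-cong cₛ′ (re≈ (Pₛ n)))
        (solve 6 (λ r k a b u v → r :* k :* (a :* u :- b :* v) :=
          r :* (a :* (k :* u) :- b :* (k :* v)) :- con 0ℚ :* (a :* (k :* v) :+ b :* (k :* u))) ≈-refl
          (ι (recip n)) (ι (c n)) (re z) (im z) (re (P n)) (im (P n))))
      (≈-trans (*-cong cₛ′ (im≈ (Pₛ n)))
        (solve 6 (λ r k a b u v → r :* k :* (a :* v :+ b :* u) :=
          r :* (a :* (k :* v) :+ b :* (k :* u)) :+ con 0ℚ :* (a :* (k :* u) :- b :* (k :* v))) ≈-refl
          (ι (recip n)) (ι (c n)) (re z) (im z) (re (P n)) (im (P n)))))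
    (ℂ.*-congˡ {ιᶜ (recip n)} (ℂ.*-congˡ {z} (scaled-powers c P c₀ cₛ P₀ Pₛ n)))
    where
    cₛ′ : ι (c (suc n)) ≈ ι (recip n) * ι (c n)
    cₛ′ = ≈-trans (Sʳ.ι-cong (cₛ n)) (ι-* (recip n) (c n))

open import Defs using (units)

-- Translations of the units modulo d.

module Units where

  open ≡ using (refl; sym; trans; cong; subst; module ≡-Reasoning)

  coprime-* : ∀ {m n q} → Coprime m q → Coprime n q → Coprime (m ℕ.* n) q
  coprime-* {m} {n} m⊥q n⊥q (d∣mn , d∣q) =
    n⊥q (coprime-divisor (λ (e∣d , e∣m) → m⊥q (e∣m , ∣-trans e∣d d∣q)) d∣mn , d∣q)

  ∈-units⁺ : ∀ {d u} → u ℕ.< d → Coprime u d → u ∈ units d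
  ∈-units⁺ {d} u<d u⊥d = ∈-filter⁺ (λ u → coprime? u d) (∈-upTo⁺ u<d) u⊥d

  ∈-units⁻ : ∀ {d u} → u ∈ units d → u ℕ.< d × Coprime u d
  ∈-units⁻ {d} h = let p , q = ∈-filter⁻ (λ u → coprime? u d) h in ∈-upTo⁻ p , q

  module _ {d : ℕ} {{_ : NonZero d}} where

    %-coprime : ∀ {n} → Coprime n d → Coprime (n % d) d
    %-coprime n⊥d (e∣ , e∣d) = n⊥d (∣n∣m%n⇒∣m e∣d e∣ , e∣d)

    -- If a ≡ - 1 then a² ≡ 1, which covers the second form of Bézout's identity.
    inverse : ∀ {u} → Coprime u d → ∃ λ v → (v ℕ.* u) % d ≡ 1 % d
    inverse {u} u⊥d with coprime-Bézout u⊥d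
    ... | Bézout.+- x y eq = x , trans (cong (_% d) (sym eq)) ([m+kn]%n≡m%n 1 y d)
    ... | Bézout.-+ x y eq = x ℕ.* (x ℕ.* u) , (begin
        (x ℕ.* (x ℕ.* u) ℕ.* u) % d              ≡⟨ sym ([m+kn]%n≡m%n _ y d) ⟩
        (x ℕ.* (x ℕ.* u) ℕ.* u ℕ.+ y ℕ.* d) % d  ≡⟨ cong (_% d) square ⟩
        (1 ℕ.+ (x ℕ.* u ℕ.* y) ℕ.* d) % d        ≡⟨ [m+kn]%n≡m%n 1 (x ℕ.* u ℕ.* y) d ⟩
        1 % d                                    ∎)
      where
      open ≡-Reasoning
      open ℕ-Solver
      square : x ℕ.* (x ℕ.* u) ℕ.* u ℕ.+ y ℕ.* d ≡ 1 ℕ.+ (x ℕ.* u ℕ.* y) ℕ.* d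
      square = begin
        x ℕ.* (x ℕ.* u) ℕ.* u ℕ.+ y ℕ.* d              ≡⟨ cong (x ℕ.* (x ℕ.* u) ℕ.* u ℕ.+_) (sym eq) ⟩
        x ℕ.* (x ℕ.* u) ℕ.* u ℕ.+ (1 ℕ.+ x ℕ.* u)
          ≡⟨ solve 2 (λ x u → x :* (x :* u) :* u :+ (con 1 :+ x :* u) := con 1 :+ x :* u :* (con 1 :+ x :* u)) refl x u ⟩
        1 ℕ.+ x ℕ.* u ℕ.* (1 ℕ.+ x ℕ.* u)              ≡⟨ cong (λ t → 1 ℕ.+ x ℕ.* u ℕ.* t) eq ⟩
        1 ℕ.+ x ℕ.* u ℕ.* (y ℕ.* d)                    ≡⟨ cong (1 ℕ.+_) (sym (ℕₚ.*-assoc (x ℕ.* u) y d)) ⟩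
        1 ℕ.+ (x ℕ.* u ℕ.* y) ℕ.* d                    ∎

    inverse-coprime : ∀ {u v} → (v ℕ.* u) % d ≡ 1 % d → Coprime v d
    inverse-coprime {u} {v} eq {e} (e∣v , e∣d) = ∣1⇒≡1 (∣n∣m%n⇒∣m e∣d (subst (e ∣_) eq (%-presˡ-∣ (∣m⇒∣m*n u e∣v) e∣d)))

    *-%-cancel : ∀ {u v} → (v ℕ.* u) % d ≡ 1 % d → ∀ {w} → w ℕ.< d → (v ℕ.* ((u ℕ.* w) % d)) % d ≡ w
    *-%-cancel {u} {v} eq {w} w<d = begin
      (v ℕ.* ((u ℕ.* w) % d)) % d              ≡⟨ %-distribˡ-* v ((u ℕ.* w) % d) d ⟩
      (v % d ℕ.* ((u ℕ.* w) % d % d)) % d      ≡⟨ cong (λ t → (v % d ℕ.* t) % d) (m%n%n≡m%n (u ℕ.* w) d) ⟩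
      (v % d ℕ.* ((u ℕ.* w) % d)) % d          ≡⟨ sym (%-distribˡ-* v (u ℕ.* w) d) ⟩
      (v ℕ.* (u ℕ.* w)) % d                    ≡⟨ cong (_% d) (sym (ℕₚ.*-assoc v u w)) ⟩
      (v ℕ.* u ℕ.* w) % d                      ≡⟨ %-distribˡ-* (v ℕ.* u) w d ⟩
      ((v ℕ.* u) % d ℕ.* (w % d)) % d          ≡⟨ cong (λ t → (t ℕ.* (w % d)) % d) eq ⟩
      (1 % d ℕ.* (w % d)) % d                  ≡⟨ sym (%-distribˡ-* 1 w d) ⟩
      (1 ℕ.* w) % d                            ≡⟨ cong (_% d) (ℕₚ.*-identityˡ w) ⟩
      w % d                                    ≡⟨ m<n⇒m%n≡m w<d ⟩
      w                                        ∎
      where open ≡-Reasoning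

    units-unique : Unique (units d)
    units-unique = Unique.filter⁺ (λ u → coprime? u d) (Unique.upTo⁺ d)

    translate : ℕ → ℕ → ℕ
    translate u w = (u ℕ.* w) % d

    translate-∈ : ∀ {u w} → Coprime u d → w ∈ units d → translate u w ∈ units d
    translate-∈ {u} {w} u⊥d h = ∈-units⁺ (m%n<n (u ℕ.* w) d) (%-coprime (coprime-* u⊥d (proj₂ (∈-units⁻ h))))

    -- Two lists without repetitions and with the same members are permutations of each other.
    -- Translation by an inverse v of u undoes translation by u, which gives both the absence of
    -- repetitions and the surjectivity.
    translate-↭ : ∀ {u} → Coprime u d → map (translate u) (units d) ↭ units d
    translate-↭ {u} u⊥d = ∼bag⇒↭ (unique∧set⇒bag unique units-unique (mk⇔ to from))
      where
      v = proj₁ (inverse u⊥d)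
      vu≡1 = proj₂ (inverse u⊥d)
      uv≡1 : (u ℕ.* v) % d ≡ 1 % d
      uv≡1 = trans (cong (_% d) (ℕₚ.*-comm u v)) vu≡1
      unique : Unique (map (translate u) (units d))
      unique = Unique.map⁻ {f = translate v} (subst Unique
        (sym (trans (sym (map-∘ {g = translate v} {f = translate u} (units d)))
          (map-id-local (tabulate λ h → *-%-cancel {u} {v} vu≡1 (proj₁ (∈-units⁻ h)))))) units-unique)
      to : ∀ {w} → w ∈ map (translate u) (units d) → w ∈ units d
      to h with ∈-map⁻ (translate u) h
      ... | w , w∈ , refl = translate-∈ u⊥d w∈
      from : ∀ {w} → w ∈ units d → w ∈ map (translate u) (units d)
      from h = subst (_∈ map (translate u) (units d)) (*-%-cancel {v} {u} uv≡1 (proj₁ (∈-units⁻ h)))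
        (∈-map⁺ (translate u) (translate-∈ (inverse-coprime {u} {v} vu≡1) h))

open Units

module Analysis (K : CompleteOrderedField) where

  open ExpSeries K

  -- The real exponential, logarithms, inverses and square roots.

  module ExpFunction
    (exp : Carrier → Carrier) (exp-limit : ∀ x → Sʳ.S (Sʳ.t x) ⟶ exp x) where

    exp-cong : ∀ {x y} → x ≈ y → exp x ≈ exp y
    exp-cong {x} {y} h = ⟶-unique (exp-limit x) (exp-limit y) (Sʳ.S-cong (Sʳ.t-cong h))

    expSum-real⟶ : ∀ x → expSum (x , 0#) ⟶ᶜ (exp x , 0#)
    expSum-real⟶ x = ⟶ᶜ-seq-cong (λ n → ℂ.sym (expSum-real x n)) (tends (exp-limit x) (⟶-const 0#))

    exp-* : ∀ x y → exp x * exp y ≈ exp (x + y)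
    exp-* x y = ≈-trans (solve 2 (λ a b → a :* b := a :* b :- con 0ℚ :* con 0ℚ) ≈-refl (exp x) (exp y))
      (re≈ (exp-+ {x , 0#} {y , 0#} {x + y , 0#} (mk ≈-refl (+-identityʳ 0#))
        (expSum-real⟶ x) (expSum-real⟶ y) (expSum-real⟶ (x + y))))

    1+x≤exp-nonneg : ∀ {x} → 0# ≤ x → 1# + x ≤ exp x
    1+x≤exp-nonneg {x} 0≤x = ⟶-≤ (⟶-const (1# + x)) (exp-limit x) (2 , λ n 2≤n →
      ≤-respˡ-≈ (solve 1 (λ x → (con 0ℚ :+ con 1ℚ) :+ con 1ℚ :* (x :* con 1ℚ) := con 1ℚ :+ x) ≈-refl x)
        (S-mono (t-nonneg 0≤x) (ℕₚ.≤⇒≤′ 2≤n)))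

    -- The increment of the left-hand side is (1 - y) tₙ₊₁ + y tₙ₊₁ - y tₙ = - n tₙ₊₁.
    S-geometric : ∀ {y} → 0# ≤ y → ∀ n → (1# - y) * Sʳ.S (Sʳ.t y) (suc n) + y * Sʳ.t y n ≤ 1#
    S-geometric {y} 0≤y zero = ≤-reflexive
      (solve 1 (λ y → (con 1ℚ :- y) :* (con 0ℚ :+ con 1ℚ) :+ y :* con 1ℚ := con 1ℚ) ≈-refl y)
    S-geometric {y} 0≤y (suc n) = ≤-trans
      (≤-by (ν n * u) (*-nonneg (ν-nonneg n) (t-nonneg 0≤y (suc n)))
        (≈-trans (+-congˡ (≈-trans (≈-sym (Sʳ.D-t y n)) (*-congʳ (ν-suc n))))
          (solve 4 (λ y e u v → (con 1ℚ :- y) :* e :+ (con 1ℚ :+ v) :* u :=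
            ((con 1ℚ :- y) :* (e :+ u) :+ y :* u) :+ v :* u) ≈-refl y (Sʳ.S (Sʳ.t y) (suc n)) u (ν n))))
      (S-geometric 0≤y n)
      where u = Sʳ.t y (suc n)

    -- The estimate exp y ≤ 1/(1 - y) with the denominator cleared, so that it makes sense for every
    -- y ≥ 0. At y = - x it controls exp at negative x.
    [1-y]exp≤1 : ∀ {y} → 0# ≤ y → (1# - y) * exp y ≤ 1#
    [1-y]exp≤1 {y} 0≤y = ⟶-≤ (⟶-* (⟶-const (1# - y)) (⟶-suc (exp-limit y))) (⟶-const 1#) (0 , λ n _ →
      ≤-trans (≤-by (y * Sʳ.t y n) (*-nonneg 0≤y (t-nonneg 0≤y n)) ≈-refl) (S-geometric 0≤y n))

    exp-0 : exp 0# ≈ 1#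
    exp-0 = ≤-antisym
      (≤-respˡ-≈ (solve 1 (λ e → (con 1ℚ :- con 0ℚ) :* e := e) ≈-refl (exp 0#)) ([1-y]exp≤1 ≤-refl))
      (≤-respˡ-≈ (+-identityʳ 1#) (1+x≤exp-nonneg ≤-refl))

    exp-neg : ∀ x → exp x * exp (- x) ≈ 1#
    exp-neg x = ≈-trans (exp-* x (- x)) (≈-trans (exp-cong (solve 1 (λ x → x :- x := con 0ℚ) ≈-refl x)) exp-0)

    exp-nonneg : ∀ x → 0# ≤ exp x
    exp-nonneg x = ≤-respʳ-≈ (≈-trans (exp-* (ι ℚ.½ * x) (ι ℚ.½ * x))
      (exp-cong (solve 1 (λ x → con ℚ.½ :* x :+ con ℚ.½ :* x := x) ≈-refl x))) (square-nonneg (exp (ι ℚ.½ * x)))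

    exp-pos : ∀ x → 0# < exp x
    exp-pos x = ≰⇒> λ h → <-irrefl (≤-<-trans
      (≤-trans (≤-reflexive (≈-sym (exp-neg x)))
        (≤-respʳ-≈ (zeroʳ (exp (- x))) (≤-respˡ-≈ (*-comm (exp (- x)) (exp x)) (*-monoˡ-≤ (exp-nonneg (- x)) h)))) 0<1)

    -- For x < 0 the inequality is multiplied by exp (- x) and becomes `[1-y]exp≤1` at y = - x.
    -- Together with the functional equation this is the source of monotonicity, convexity and the
    -- logarithm.
    1+x≤exp : ∀ x → 1# + x ≤ exp x
    1+x≤exp x with compare 0# x
    ... | inj₁ 0≤x = 1+x≤exp-nonneg 0≤x
    ... | inj₂ x<0 = *-cancelˡ-≤ (exp-pos (- x)) (≤-respʳ-≈ (≈-sym (≈-trans (*-comm (exp (- x)) (exp x)) (exp-neg x)))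
      (≤-respˡ-≈ (solve 2 (λ x e → (con 1ℚ :- (:- x)) :* e := e :* (con 1ℚ :+ x)) ≈-refl x (exp (- x)))
        ([1-y]exp≤1 (≤-respʳ-≈ (+-identityˡ (- x)) (≤⇒gap (<⇒≤ x<0))))))

    -- exp y = exp x · exp (y - x) ≥ exp x · (1 + (y - x))
    exp-gap : ∀ x y → exp x * (y - x) ≤ exp y - exp x
    exp-gap x y = ≤-respʳ-≈ (+-congʳ (≈-trans (exp-* x (y - x)) (exp-cong (solve 2 (λ x y → x :+ (y :- x) := y) ≈-refl x y))))
      (≤-by (exp x * exp (y - x) - exp x * (1# + (y - x))) (≤⇒gap (*-monoˡ-≤ (exp-nonneg x) (1+x≤exp (y - x))))
        (solve 3 (λ a b d → a :* b :- a := a :* d :+ (a :* b :- a :* (con 1ℚ :+ d))) ≈-refl (exp x) (exp (y - x)) (y - x)))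

    exp-mono-< : ∀ {x y} → x < y → exp x < exp y
    exp-mono-< {x} {y} h = <-by (exp y - exp x) (<-≤-trans (*-pos (exp-pos x) (<⇒gap h)) (exp-gap x y))
      (solve 2 (λ a b → b := a :+ (b :- a)) ≈-refl (exp x) (exp y))

    exp-mono-≤ : ∀ {x y} → x ≤ y → exp x ≤ exp y
    exp-mono-≤ {x} {y} h = ≤-by (exp y - exp x) (≤-trans (*-nonneg (exp-nonneg x) (≤⇒gap h)) (exp-gap x y))
      (solve 2 (λ a b → b := a :+ (b :- a)) ≈-refl (exp x) (exp y))

    exp-cancel-≤ : ∀ {x y} → exp x ≤ exp y → x ≤ y
    exp-cancel-≤ h = ≮⇒≥ λ y<x → <-irrefl (<-≤-trans (exp-mono-< y<x) h)

    exp-cancel-< : ∀ {x y} → exp x < exp y → x < y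
    exp-cancel-< h = ≰⇒> λ y≤x → <-irrefl (<-≤-trans h (exp-mono-≤ y≤x))

    -- The tangent line of exp at s t bounds both exp t and exp 0 from below.
    exp-convex : ∀ {s} → 0# ≤ s → s ≤ 1# → ∀ t → exp (s * t) ≤ s * exp t + (1# - s)
    exp-convex {s} 0≤s s≤1 t = ≤-by
      (s * (exp t - e - e * (t - s * t)) + (1# - s) * (1# - e - e * (0# - s * t)))
      (+-nonneg (*-nonneg 0≤s (≤⇒gap (exp-gap (s * t) t)))
        (*-nonneg (≤⇒gap s≤1) (≤⇒gap (≤-respʳ-≈ (+-congʳ exp-0) (exp-gap (s * t) 0#)))))
      (solve 4 (λ s t e f → s :* f :+ (con 1ℚ :- s) :=
        e :+ (s :* (f :- e :- e :* (t :- s :* t)) :+ (con 1ℚ :- s) :* (con 1ℚ :- e :- e :* (con 0ℚ :- s :* t))))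
        ≈-refl s t e (exp t))
      where e = exp (s * t)

    recip⟶0 : (λ n → ι (recip n)) ⟶ 0#
    recip⟶0 ε ε>0 = let N , h = recip-small ε ε>0 in N , λ n N≤n →
      ∣∣-nonneg (≤-respʳ-≈ (minus-0 n) (ι-nonneg (recip-pos n))) (≤-respˡ-≈ (minus-0 n) (ι-mono-≤ (h n N≤n)))
      where
      minus-0 : ∀ n → ι (recip n) ≈ ι (recip n) - 0#
      minus-0 n = solve 1 (λ r → r := r :- con 0ℚ) ≈-refl (ι (recip n))

    ≤-recip : ∀ {u v} c → (∀ n → u ≤ v + ι (recip n) * c) → u ≤ v
    ≤-recip {u} {v} c h = ⟶-≤ (⟶-const u)
      (⟶-limit-cong (solve 2 (λ v c → v :+ con 0ℚ :* c := v) ≈-refl v c)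
        (⟶-+ (⟶-const v) (⟶-* recip⟶0 (⟶-const c))))
      (0 , λ n _ → h n)

    module _ {x} (0<x : 0# < x) where

      -- A discrete intermediate value argument: walk from a in steps of h until exp first exceeds
      -- x. The second hypothesis bounds the length of the walk by N.
      grid : ∀ h N a → exp a ≤ x → x < exp (a + ν N * h) → ∃ λ y → exp y ≤ x × x < exp (y + h)
      grid h zero a p q = ⊥-elim (<-irrefl (<-≤-trans q
        (≤-respˡ-≈ (exp-cong (solve 2 (λ a h → a := a :+ con 0ℚ :* h) ≈-refl a h)) p)))
      grid h (suc N) a p q with compare (exp (a + h)) x
      ... | inj₂ r = a , p , r
      ... | inj₁ r = grid h N (a + h) r (<-respʳ-≈ (exp-cong (≈-trans (+-congˡ (*-congʳ (ν-suc N)))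
        (solve 3 (λ a h v → a :+ (con 1ℚ :+ v) :* h := (a :+ h) :+ v :* h) ≈-refl a h (ν N)))) q)

      -- For a rational δ with 0 < δ ≤ x and A = 1/δ, the bound A ≤ exp A gives exp (- A) ≤ 1/A = δ.
      exp-below : ∃ λ a → exp a ≤ x
      exp-below =
        let δ , δ>0 , δ≤x = ι-below 0<x
            γ , _ , eq = ℚ-divide δ>0 (ℚₚ.positive⁻¹ 1ℚ)
            A = ι γ
        in - A , ≤-trans (*-cancelˡ-≤ (exp-pos A) (≤-respˡ-≈ (≈-sym (exp-neg A))
          (≤-respˡ-≈ (≈-trans (≈-sym (ι-* δ γ)) (Sʳ.ι-cong eq)) (≤-respˡ-≈ (*-comm A (ι δ)) (≤-respˡ-≈ (*-comm (ι δ) A)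
            (≤-respʳ-≈ (*-comm (ι δ) (exp A)) (*-monoˡ-≤ (ι-nonneg δ>0)
              (≤-trans (≤-by 1# 0≤1 (+-comm 1# A)) (1+x≤exp A)))))))))
          δ≤x

      approx : ∀ n → ∃ λ y → exp y ≤ x × x < exp (y + ι (recip n))
      approx n =
        let a , p = exp-below
            -- Since N h ≥ x - a, the number 1 + (a + N h) exceeds x, and exp (a + N h) is at least
            -- as large.
            N , q = ν-multiple-above (x - a) (recip n) (recip-pos n)
            h = ι (recip n)
        in grid h N a p (<-≤-trans
          (<-by (1# + (ν N * h - (x - a))) (+-pos 0<1 (≤⇒gap q))
            (solve 4 (λ x a v i → i :+ (a :+ v) := x :+ (i :+ (v :- (x :- a)))) ≈-refl x a (ν N * h) 1#))
          (1+x≤exp (a + ν N * h)))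

      module _ (y : ℕ → Carrier) (below : ∀ n → exp (y n) ≤ x)
               (above : ∀ n → x < exp (y n + ι (recip n))) where

        y-close : ∀ m n → y m ≤ y n + ι (recip n)
        y-close m n = <⇒≤ (exp-cancel-< (≤-<-trans (below m) (above n)))

        y-limit : ∃ λ L → y ⟶ L
        y-limit = cauchy⇒⟶ y λ ε ε>0 → let N , small = recip-small ε ε>0 in N , λ m n _ N≤n →
          ≤-trans (y-close m n) (+-mono-≤ ≤-refl (ι-mono-≤ (small n N≤n)))

        -- The bound exp (- h) ≥ 1 - h at h = 1/(n + 1) replaces continuity. It gives exp L - h exp
        -- L ≤ exp (L - h) ≤ x and x - h x ≤ exp (- h) x ≤ exp L, and then h tends to 0.
        exp-at-limit : ∀ {L} → y ⟶ L → exp L ≈ x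
        exp-at-limit {L} limit = ≤-antisym
          (≤-recip (exp L) λ n → let h = ι (recip n) in
            ≤-by ((exp (L - h) - exp L - exp L * (L - h - L)) + (x - exp (L - h)))
              (+-nonneg (≤⇒gap (exp-gap L (L - h))) (≤⇒gap (≤-trans (exp-mono-≤ (lower n)) (below n))))
              (solve 5 (λ e f L h x → x :+ h :* e := e :+ ((f :- e :- e :* (L :- h :- L)) :+ (x :- f))) ≈-refl
                (exp L) (exp (L - h)) L h x))
          (≤-recip x λ n → let h = ι (recip n) in
            ≤-trans (≤-by (x * (exp (- h) - (1# + - h))) (*-nonneg (<⇒≤ 0<x) (≤⇒gap (1+x≤exp (- h))))
                (solve 3 (λ x h e → x :* e :+ h :* x := x :+ x :* (e :- (con 1ℚ :+ (:- h)))) ≈-refl x h (exp (- h))))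
              (+-mono-≤ (≤-respˡ-≈ (*-comm (exp (- h)) x) (≤-respʳ-≈ (≈-trans (exp-* (- h) (L + h))
                  (exp-cong (solve 2 (λ L h → :- h :+ (L :+ h) := L) ≈-refl L h)))
                  (*-monoˡ-≤ (exp-nonneg (- h)) (≤-trans (<⇒≤ (above n))
                    (exp-mono-≤ (+-mono-≤ (upper n) ≤-refl))))))
                ≤-refl))
          where
          upper : ∀ n → y n ≤ L
          upper n = ⟶-≤ (⟶-const (y n)) (⟶-limit-cong (+-identityʳ L) (⟶-+ limit recip⟶0))
            (0 , λ m _ → y-close n m)
          lower : ∀ n → L - ι (recip n) ≤ y n
          lower n = ≤-by (y n + ι (recip n) - L)
            (≤⇒gap (⟶-≤ limit (⟶-const (y n + ι (recip n))) (0 , λ m _ → y-close m n)))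
            (solve 3 (λ L h y → y := (L :- h) :+ (y :+ h :- L)) ≈-refl L (ι (recip n)) (y n))

      log-exists : ∃ λ L → exp L ≈ x
      log-exists =
        let y     = λ n → proj₁ (approx n)
            below = λ n → proj₁ (proj₂ (approx n))
            above = λ n → proj₂ (proj₂ (approx n))
            L , h = y-limit y below above
        in L , exp-at-limit y below above h

      inverse-exists : ∃ λ z → x * z ≈ 1#
      inverse-exists = let L , e = log-exists in exp (- L) , ≈-trans (*-congʳ (≈-sym e)) (exp-neg L)

    sqrt-exists : ∀ {x} → 0# ≤ x → ∃ λ r → 0# ≤ r × r * r ≈ x
    sqrt-exists {x} 0≤x with compare x 0#
    ... | inj₁ x≤0 = 0# , ≤-refl , ≈-trans (zeroˡ 0#) (≤-antisym 0≤x x≤0)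
    ... | inj₂ 0<x = let L , e = log-exists 0<x in exp (ι ℚ.½ * L) , exp-nonneg _
      , ≈-trans (exp-* _ _) (≈-trans (exp-cong (solve 1 (λ x → con ℚ.½ :* x :+ con ℚ.½ :* x := x) ≈-refl L)) e)

    -- The partial sums at the conjugate of z are the conjugates, and the conjugate of i y is - i y.
    unit-circle : ∀ {y w} → expSum (0# , y) ⟶ᶜ w → re w * re w + im w * im w ≈ 1#
    unit-circle {y} {w} h = ≈-trans
      (solve 2 (λ a b → a :* a :+ b :* b := a :* a :- b :* (:- b)) ≈-refl (re w) (im w))
      (re≈ (exp-+ {0# , y} {conj (0# , y)} {0# , 0#}
        (mk (+-identityʳ 0#) (solve 1 (λ y → y :- y := con 0ℚ) ≈-refl y))
        h (⟶ᶜ-seq-cong (λ n → ℂ.sym (S-conj n)) (tends (re⟶ h) (⟶-neg (im⟶ h))))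
        (expSum-real⟶ 0#)))
      ≈∙ exp-0
      where
      infixl 4 _≈∙_
      _≈∙_ = ≈-trans
      conj : Cx → Cx
      conj (a , b) = a , - b
      conj-* : ∀ z w → conj z *ᶜ conj w ≈ᶜ conj (z *ᶜ w)
      conj-* (a , b) (c , d) = mk
        (solve 4 (λ a b c d → a :* c :- (:- b) :* (:- d) := a :* c :- b :* d) ≈-refl a b c d)
        (solve 4 (λ a b c d → a :* (:- d) :+ (:- b) :* c := :- (a :* d :+ b :* c)) ≈-refl a b c d)
      0≈-0 : 0# ≈ - 0#
      0≈-0 = solve 0 (con 0ℚ := :- con 0ℚ) ≈-refl
      t-conj : ∀ n → Sᶜ.t (conj (0# , y)) n ≈ᶜ conj (Sᶜ.t (0# , y) n)
      t-conj zero    = mk ≈-refl 0≈-0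
      t-conj (suc n) = ℂ.trans
        (ℂ.*-cong (mk ≈-refl 0≈-0) (ℂ.trans (ℂ.*-congˡ {conj (0# , y)} (t-conj n)) (conj-* (0# , y) (Sᶜ.t (0# , y) n))))
        (conj-* (ιᶜ (recip n)) ((0# , y) *ᶜ Sᶜ.t (0# , y) n))
      S-conj : ∀ n → expSum (conj (0# , y)) n ≈ᶜ conj (expSum (0# , y) n)
      S-conj zero    = mk ≈-refl 0≈-0
      S-conj (suc n) = ℂ.trans (ℂ.+-cong (S-conj n) (t-conj n))
        (mk ≈-refl (solve 2 (λ a b → :- a :+ (:- b) := :- (a :+ b)) ≈-refl (im (expSum (0# , y) n)) (im (Sᶜ.t (0# , y) n))))

  -- Finite sums over lists.

  module Sums
    (∑ : {A : Set} → List A → (A → Carrier) → Carrier)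
    (∑-[] : ∀ {A} (f : A → Carrier) → ∑ [] f ≈ 0#)
    (∑-∷ : ∀ {A} a as (f : A → Carrier) → ∑ (a ∷ as) f ≈ f a + ∑ as f) where

    private variable A : Set

    ∑-cong-∈ : ∀ (as : List A) {f g} → (∀ {a} → a ∈ as → f a ≈ g a) → ∑ as f ≈ ∑ as g
    ∑-cong-∈ [] h = ≈-trans (∑-[] _) (≈-sym (∑-[] _))
    ∑-cong-∈ (a ∷ as) h = ≈-trans (∑-∷ a as _)
      (≈-trans (+-cong (h (here ≡.refl)) (∑-cong-∈ as (h ∘ there))) (≈-sym (∑-∷ a as _)))

    ∑-cong : ∀ (as : List A) {f g} → (∀ a → f a ≈ g a) → ∑ as f ≈ ∑ as g
    ∑-cong as h = ∑-cong-∈ as (λ {a} _ → h a)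

    ∑-map : ∀ {B : Set} (as : List B) (g : B → A) f → ∑ (map g as) f ≈ ∑ as (f ∘ g)
    ∑-map [] g f = ≈-trans (∑-[] f) (≈-sym (∑-[] _))
    ∑-map (a ∷ as) g f = ≈-trans (∑-∷ (g a) _ f) (≈-trans (+-congˡ (∑-map as g f)) (≈-sym (∑-∷ a as _)))

    ∑-↭ : ∀ {as bs : List A} f → as ↭ bs → ∑ as f ≈ ∑ bs f
    ∑-↭ f ↭.refl = ≈-refl
    ∑-↭ f (↭.prep a h) = ≈-trans (∑-∷ a _ f) (≈-trans (+-congˡ (∑-↭ f h)) (≈-sym (∑-∷ a _ f)))
    ∑-↭ f (↭.swap {as} {bs} a b h) = ≈-trans (∑-∷ a _ f) (≈-trans (+-congˡ (≈-trans (∑-∷ b _ f) (+-congˡ (∑-↭ f h))))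
      (≈-trans (solve 3 (λ x y s → x :+ (y :+ s) := y :+ (x :+ s)) ≈-refl (f a) (f b) (∑ bs f))
        (≈-sym (≈-trans (∑-∷ b _ f) (+-congˡ (∑-∷ a bs f))))))
    ∑-↭ f (↭.trans h k) = ≈-trans (∑-↭ f h) (∑-↭ f k)

    ∑-mono : ∀ (as : List A) {f g} → (∀ a → f a ≤ g a) → ∑ as f ≤ ∑ as g
    ∑-mono [] h = ≤-reflexive (≈-trans (∑-[] _) (≈-sym (∑-[] _)))
    ∑-mono (a ∷ as) h = ≤-respˡ-≈ (≈-sym (∑-∷ a as _)) (≤-respʳ-≈ (≈-sym (∑-∷ a as _)) (+-mono-≤ (h a) (∑-mono as h)))

    ∑-nonneg : ∀ (as : List A) {f} → (∀ a → 0# ≤ f a) → 0# ≤ ∑ as f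
    ∑-nonneg [] h = ≤-reflexive (≈-sym (∑-[] _))
    ∑-nonneg (a ∷ as) h = ≤-respʳ-≈ (≈-sym (∑-∷ a as _)) (+-nonneg (h a) (∑-nonneg as h))

    ∑-member : ∀ (as : List A) {f a} → (∀ a → 0# ≤ f a) → a ∈ as → f a ≤ ∑ as f
    ∑-member (a ∷ as) {f} p (here ≡.refl) = ≤-by (∑ as f) (∑-nonneg as p) (∑-∷ a as f)
    ∑-member (a ∷ as) {f} p (there h) = ≤-trans (∑-member as p h)
      (≤-by (f a) (p a) (≈-trans (∑-∷ a as f) (+-comm (f a) (∑ as f))))

    ∑-affine : ∀ (as : List A) f c d → ∑ as (λ a → c * f a + d) ≈ c * ∑ as f + ν (length as) * d
    ∑-affine [] f c d = ≈-trans (∑-[] _) (≈-trans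
      (solve 2 (λ c d → con 0ℚ := c :* con 0ℚ :+ con 0ℚ :* d) ≈-refl c d) (+-congʳ (*-congˡ (≈-sym (∑-[] f)))))
    ∑-affine (a ∷ as) f c d = ≈-trans (∑-∷ a as _) (≈-trans (+-congˡ (∑-affine as f c d))
      (≈-trans (solve 5 (λ c d x s n → (c :* x :+ d) :+ (c :* s :+ n :* d) := c :* (x :+ s) :+ (con 1ℚ :+ n) :* d) ≈-refl
          c d (f a) (∑ as f) (ν (length as)))
        (+-cong (*-congˡ (≈-sym (∑-∷ a as f))) (*-congʳ (≈-sym (ν-suc (length as)))))))

    ∑-+ : ∀ (as : List A) f g → ∑ as (λ a → f a + g a) ≈ ∑ as f + ∑ as g
    ∑-+ [] f g = ≈-trans (∑-[] _) (≈-trans (≈-sym (+-identityʳ 0#)) (+-cong (≈-sym (∑-[] f)) (≈-sym (∑-[] g))))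
    ∑-+ (a ∷ as) f g = ≈-trans (∑-∷ a as _) (≈-trans (+-congˡ (∑-+ as f g))
      (≈-trans (solve 4 (λ x y s t → (x :+ y) :+ (s :+ t) := (x :+ s) :+ (y :+ t)) ≈-refl (f a) (g a) (∑ as f) (∑ as g))
        (+-cong (≈-sym (∑-∷ a as f)) (≈-sym (∑-∷ a as g)))))

    -- Meant for f = X and g a power of the root of X. A sum of nonnegative terms that is ≤ 0 has
    -- all its terms ≤ 0; read contrapositively, positivity passes from the sum of f to the sum of
    -- g.
    ∑-nonpos : ∀ (as : List A) {f g} → (∀ a → 0# ≤ g a) → (∀ a → g a ≤ 0# → f a ≤ 0#) → ∑ as g ≤ 0# → ∑ as f ≤ 0#
    ∑-nonpos [] p q h = ≤-reflexive (∑-[] _)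
    ∑-nonpos (a ∷ as) {f} {g} p q h = ≤-respˡ-≈ (≈-sym (∑-∷ a as f)) (≤-respʳ-≈ (+-identityʳ 0#)
      (+-mono-≤ (q a (≤-trans (≤-by (∑ as g) (∑-nonneg as p) ≈-refl) h′))
        (∑-nonpos as p q (≤-trans (≤-by (g a) (p a) (+-comm (g a) (∑ as g))) h′))))
      where h′ = ≤-respˡ-≈ (∑-∷ a as g) h

  -- The mean of powers and the bound for ξ̃.

  module PowerMean
    (exp : Carrier → Carrier) (exp-limit : ∀ x → Sʳ.S (Sʳ.t x) ⟶ exp x)
    (log inv sqrt : Carrier → Carrier) (pow : Carrier → Carrier → Carrier)
    (exp-log  : ∀ {x} → 0# < x → exp (log x) ≈ x)
    (inv-spec : ∀ {x} → 0# < x → x * inv x ≈ 1#)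
    (sqrt-spec : ∀ {x} → 0# ≤ x → 0# ≤ sqrt x × sqrt x * sqrt x ≈ x)
    (pow-pos  : ∀ {x} y → 0# < x → pow x y ≈ exp (y * log x))
    (pow-nonpos : ∀ {x} y → ¬ (0# < x) → pow x y ≈ 0#)
    (∑ : {A : Set} → List A → (A → Carrier) → Carrier)
    (∑-[] : ∀ {A} (f : A → Carrier) → ∑ [] f ≈ 0#)
    (∑-∷ : ∀ {A} a as (f : A → Carrier) → ∑ (a ∷ as) f ≈ f a + ∑ as f) where

    open ExpFunction exp exp-limit
    open Sums ∑ ∑-[] ∑-∷

    2# : Carrier
    2# = ι (natℚ 2)

    0<2 : 0# < 2#
    0<2 = ι-pos (ℚₚ.positive⁻¹ (natℚ 2))

    0<½ : 0# < ι ℚ.½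
    0<½ = ι-pos (ℚₚ.positive⁻¹ ℚ.½)

    pow-nonneg : ∀ x y → 0# ≤ pow x y
    pow-nonneg x y with compare x 0#
    ... | inj₂ 0<x = ≤-respʳ-≈ (≈-sym (pow-pos y 0<x)) (exp-nonneg _)
    ... | inj₁ x≤0 = ≤-reflexive (≈-sym (pow-nonpos y λ 0<x → <-irrefl (<-≤-trans 0<x x≤0)))

    inv-pos : ∀ {x} → 0# < x → 0# < inv x
    inv-pos {x} 0<x = ≰⇒> λ h → <-irrefl (<-≤-trans 0<1
      (≤-respˡ-≈ (inv-spec 0<x) (≤-respʳ-≈ (zeroʳ x) (*-monoˡ-≤ (<⇒≤ 0<x) h))))

    inv-unique : ∀ {x y} → 0# < x → x * y ≈ 1# → inv x ≈ y
    inv-unique 0<x h = *-cancelˡ-≈ 0<x (≈-trans (inv-spec 0<x) (≈-sym h))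

    sqrt-pos : ∀ {x} → 0# < x → 0# < sqrt x
    sqrt-pos {x} 0<x = ≰⇒> λ h →
      let 0≤r , r²≈x = sqrt-spec (<⇒≤ 0<x) in
      <-irrefl (<-≤-trans 0<x (≤-respˡ-≈ r²≈x (≤-respʳ-≈ (zeroʳ (sqrt x)) (*-monoˡ-≤ 0≤r h))))

    ℓ : Carrier
    ℓ = log 2#

    ℓ-pos : 0# < ℓ
    ℓ-pos = exp-cancel-< (<-respˡ-≈ (≈-sym exp-0) (<-respʳ-≈ (≈-sym (exp-log 0<2))
      (<-by 1# 0<1 (solve 0 (con (natℚ 2) := con 1ℚ :+ con 1ℚ) ≈-refl))))

    module _ {s} (0≤s : 0# ≤ s) (s≤1 : s ≤ 1#) where

      -- With √x = exp t, the exponent p = 2 s satisfies p t = s ℓ + s (2 t - ℓ), and exp (2 t - ℓ) = x / 2.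
      exp-tangent : ∀ x t → exp t * exp t ≈ x → exp ((2# * s) * t) ≤ exp (s * ℓ) * (s * (ι ℚ.½ * x) + (1# - s))
      exp-tangent x t e² = ≤-respˡ-≈
        (≈-trans (exp-* (s * ℓ) (s * y)) (exp-cong
          (solve 3 (λ s t ℓ → s :* ℓ :+ s :* (t :+ t :- ℓ) := (con (natℚ 2) :* s) :* t) ≈-refl s t ℓ)))
        (*-monoˡ-≤ (exp-nonneg (s * ℓ)) (≤-respʳ-≈ (+-congʳ (*-congˡ exp-y)) (exp-convex 0≤s s≤1 y)))
        where
        y = t + t - ℓ
        exp-y : exp y ≈ ι ℚ.½ * x
        exp-y = *-cancelˡ-≈ 0<2 (≈-trans (*-congʳ (≈-sym (exp-log 0<2))) (≈-trans (exp-* ℓ y)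
          (≈-trans (exp-cong (solve 2 (λ t ℓ → ℓ :+ (t :+ t :- ℓ) := t :+ t) ≈-refl t ℓ))
            (≈-trans (≈-sym (exp-* t t)) (≈-trans e²
              (solve 1 (λ x → x := con (natℚ 2) :* (con ℚ.½ :* x)) ≈-refl x))))))

      pow-sqrt-tangent : ∀ {p x} → p ≈ 2# * s → 0# ≤ x →
        pow (sqrt x) p ≤ exp (s * ℓ) * (s * (ι ℚ.½ * x) + (1# - s))
      pow-sqrt-tangent {p} {x} p≈2s 0≤x with compare (sqrt x) 0#
      -- Where X vanishes the power is 0 by convention, and the tangent line is nonnegative there
      -- because s ≤ 1.
      ... | inj₁ r≤0 = ≤-respˡ-≈ (≈-sym (pow-nonpos p λ 0<r → <-irrefl (<-≤-trans 0<r r≤0)))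
        (*-nonneg (exp-nonneg _) (+-nonneg (*-nonneg 0≤s (*-nonneg (<⇒≤ 0<½) 0≤x)) (≤⇒gap s≤1)))
      ... | inj₂ 0<r = ≤-respˡ-≈ (≈-sym (≈-trans (pow-pos p 0<r) (exp-cong (*-congʳ p≈2s))))
        (exp-tangent x (log (sqrt x)) (≈-trans (*-cong (exp-log 0<r) (exp-log 0<r)) (proj₂ (sqrt-spec 0≤x))))

      -- Averaging an affine function gives its value at the mean. At the mean 2 the tangent line
      -- has the value exp (s ℓ) (s + (1 - s)) = exp (s ℓ).
      power-mean : ∀ {A : Set} (us : List A) (X : A → Carrier) {p} → p ≈ 2# * s → (∀ u → 0# ≤ X u) →
        ∑ us X ≈ 2# * ν (length us) → ∑ us (λ u → pow (sqrt (X u)) p) ≤ ν (length us) * exp (s * ℓ)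
      power-mean us X {p} p≈2s 0≤X ∑X = ≤-trans (∑-mono us λ u → pow-sqrt-tangent p≈2s (0≤X u))
        (≤-reflexive (≈-trans
          (∑-cong us λ u → solve 3 (λ c s x → c :* (s :* (con ℚ.½ :* x) :+ (con 1ℚ :- s)) :=
            (c :* s :* con ℚ.½) :* x :+ c :* (con 1ℚ :- s)) ≈-refl c s (X u))
          (≈-trans (∑-affine us X (c * s * ι ℚ.½) (c * (1# - s)))
            (≈-trans (+-congʳ (*-congˡ ∑X))
              (solve 3 (λ c s n → (c :* s :* con ℚ.½) :* (con (natℚ 2) :* n) :+ n :* (c :* (con 1ℚ :- s)) := n :* c) ≈-refl
                c s (ν (length us)))))))
        where c = exp (s * ℓ)

    power-sum-pos : ∀ {A : Set} (us : List A) (X : A → Carrier) p → (∀ u → 0# ≤ X u) →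
      0# < ∑ us X → 0# < ∑ us (λ u → pow (sqrt (X u)) p)
    power-sum-pos us X p 0≤X 0<∑X = ≰⇒> λ h → <-irrefl (<-≤-trans 0<∑X
      (∑-nonpos us (λ u → pow-nonneg (sqrt (X u)) p) (λ u q → ≮⇒≥ λ 0<x →
        <-irrefl (<-≤-trans (exp-pos _) (≤-respˡ-≈ (pow-pos p (sqrt-pos 0<x)) q))) h))

    module _ (σ : Carrier) (½<σ : ι ℚ.½ < σ) (σ<1 : σ < 1#) where

      private
        p = inv σ
        s = ι ℚ.½ * p
        τ = 1# + - σ
        0<σ = <-≤-trans 0<½ (<⇒≤ ½<σ)
        0<τ = <⇒gap σ<1

      σs : σ * s ≈ ι ℚ.½
      σs = ≈-trans (solve 2 (λ σ p → σ :* (con ℚ.½ :* p) := con ℚ.½ :* (σ :* p)) ≈-refl σ p)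
        (≈-trans (*-congˡ (inv-spec 0<σ)) (*-identityʳ (ι ℚ.½)))

      s≤1 : s ≤ 1#
      s≤1 = *-cancelˡ-≤ 0<σ (≤-respˡ-≈ (≈-sym σs) (≤-respʳ-≈ (≈-sym (*-identityʳ σ)) (<⇒≤ ½<σ)))

      inv-2τ : inv (2# * τ) ≈ ι ℚ.½ * inv τ
      inv-2τ = inv-unique (*-pos 0<2 0<τ) (≈-trans
        (solve 2 (λ τ i → (con (natℚ 2) :* τ) :* (con ℚ.½ :* i) := τ :* i) ≈-refl τ (inv τ)) (inv-spec 0<τ))

      -- On the level of logarithms, σ s = ½ turns the difference of the two sides, ℓ/τ - (σ/τ) log
      -- ξ - ℓ/(2 τ), into (σ/τ) (s ℓ - log ξ) ≥ 0.
      lower-bound : ∀ {ξ} → 0# < ξ → ξ ≤ exp (s * ℓ) →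
        pow 2# (1# * inv (2# * τ)) ≤ pow 2# (1# * inv τ) * pow ξ (- σ * inv τ)
      lower-bound {ξ} 0<ξ ξ≤c = ≤-respˡ-≈ (≈-sym (pow-pos _ 0<2))
        (≤-respʳ-≈ (≈-sym (≈-trans (*-cong (pow-pos _ 0<2) (pow-pos _ 0<ξ)) (exp-* _ _)))
          (exp-mono-≤ (≤-by ((σ * inv τ) * (s * ℓ - log ξ))
            (*-nonneg (*-nonneg (<⇒≤ 0<σ) (<⇒≤ (inv-pos 0<τ)))
              (≤⇒gap (exp-cancel-≤ (≤-respˡ-≈ (≈-sym (exp-log 0<ξ)) ξ≤c))))
            (≈-trans (≈-trans
                (solve 4 (λ i ℓ σ g → (con 1ℚ :* i) :* ℓ :+ (:- σ :* i) :* g :=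
                  i :* ℓ :- con ℚ.½ :* i :* ℓ :+ (con ℚ.½ :* i :* ℓ :- σ :* i :* g)) ≈-refl (inv τ) ℓ σ (log ξ))
                (+-congˡ (+-congʳ (*-congʳ (*-congʳ (≈-sym σs))))))
              (≈-trans (solve 5 (λ i ℓ σ s g →
                  i :* ℓ :- con ℚ.½ :* i :* ℓ :+ (σ :* s :* i :* ℓ :- σ :* i :* g) :=
                  (con 1ℚ :* (con ℚ.½ :* i)) :* ℓ :+ (σ :* i) :* (s :* ℓ :- g)) ≈-refl (inv τ) ℓ σ s (log ξ))
                (+-congʳ (*-congʳ (*-congˡ (≈-sym inv-2τ)))))))))

      -- The exponent exceeds 1 by (2 σ - 1)/(2 τ), because 1 - 2 τ = 2 (σ - ½).
      bound>2 : 2# < pow 2# (1# * inv (2# * τ))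
      bound>2 = <-respˡ-≈ (exp-log 0<2) (<-respʳ-≈ (≈-sym (pow-pos _ 0<2)) (exp-mono-<
        (<-by ((i * (2# * (σ - ι ℚ.½))) * ℓ)
          (*-pos (*-pos (inv-pos (*-pos 0<2 0<τ)) (*-pos 0<2 (<⇒gap ½<σ))) ℓ-pos)
          (≈-trans
            (solve 3 (λ i σ ℓ → (con 1ℚ :* i) :* ℓ :=
              ((con (natℚ 2) :* (con 1ℚ :- σ)) :* i) :* ℓ :+ (i :* (con (natℚ 2) :* (σ :- con ℚ.½))) :* ℓ) ≈-refl i σ ℓ)
            (+-congʳ (≈-trans (*-congʳ (inv-spec (*-pos 0<2 0<τ))) (*-identityˡ ℓ)))))))
        where i = inv (2# * τ)

      mean-bounds : ∀ {A : Set} (us : List A) (X : A → Carrier) → 0# < ν (length us) → (∀ u → 0# ≤ X u) →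
        ∑ us X ≈ 2# * ν (length us) →
        let ξ = inv (ν (length us)) * ∑ us (λ u → pow (sqrt (X u)) p) in 0# < ξ × ξ ≤ exp (s * ℓ)
      mean-bounds us X 0<n 0≤X ∑X =
          *-pos (inv-pos 0<n) (power-sum-pos us X p 0≤X (<-respʳ-≈ (≈-sym ∑X) (*-pos 0<2 0<n)))
        , ≤-respʳ-≈ (≈-trans (solve 3 (λ i n c → i :* (n :* c) := (n :* i) :* c) ≈-refl i n (exp (s * ℓ)))
              (≈-trans (*-congʳ (inv-spec 0<n)) (*-identityˡ _)))
            (*-monoˡ-≤ (<⇒≤ (inv-pos 0<n)) (power-mean (<⇒≤ (*-pos 0<½ (inv-pos 0<σ))) s≤1 us X
              (solve 1 (λ p → p := con (natℚ 2) :* (con ℚ.½ :* p)) ≈-refl p) 0≤X ∑X))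
        where
        n = ν (length us)
        i = inv n

      ξ̃-bounds : ∀ {A : Set} (us : List A) (X : A → Carrier) → 0# < ν (length us) → (∀ u → 0# ≤ X u) →
        ∑ us X ≈ 2# * ν (length us) →
        let ξ = inv (ν (length us)) * ∑ us (λ u → pow (sqrt (X u)) p)
            ξ̃ = pow 2# (1# * inv τ) * pow ξ (- σ * inv τ)
        in pow 2# (1# * inv (2# * τ)) ≤ ξ̃ × 2# < ξ̃
      ξ̃-bounds us X 0<n 0≤X ∑X =
        let 0<ξ , ξ≤c = mean-bounds us X 0<n 0≤X ∑X
            h = lower-bound 0<ξ ξ≤c
        in h , <-≤-trans bound>2 h

  -- Orthogonality of two characters and the mean of X.

  module Orthogonality
    (∑ : {A : Set} → List A → (A → Carrier) → Carrier)
    (∑-[] : ∀ {A} (f : A → Carrier) → ∑ [] f ≈ 0#)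
    (∑-∷ : ∀ {A} a as (f : A → Carrier) → ∑ (a ∷ as) f ≈ f a + ∑ as f)
    (d : ℕ) {{_ : ℕ.NonZero d}} where

    open Sums ∑ ∑-[] ∑-∷

    private
      2# : Carrier
      2# = ι (natℚ 2)

    Periodic : (ℕ → Cx) → Set
    Periodic χ = ∀ m n → m % d ≡ n % d → χ m ≈ᶜ χ n

    Multiplicative : (ℕ → Cx) → Set
    Multiplicative χ = ∀ m n → χ (m ℕ.* n) ≈ᶜ χ m *ᶜ χ n

    -- Multiplication by u permutes the units modulo d, and periodicity lets u w stand unreduced.
    ∑-translate : ∀ {u} → u ∈ units d → ∀ {F} → (∀ m n → m % d ≡ n % d → F m ≈ F n) →
      ∑ (units d) (λ w → F (u ℕ.* w)) ≈ ∑ (units d) F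
    ∑-translate {u} u∈ {F} per = ≈-trans
      (∑-cong (units d) λ w → per (u ℕ.* w) (translate u w) (≡.sym (m%n%n≡m%n (u ℕ.* w) d)))
      (≈-trans (≈-sym (∑-map (units d) (translate u) F)) (∑-↭ F (translate-↭ (proj₂ (∈-units⁻ u∈)))))

    norm² : Cx → Carrier
    norm² (a , b) = a * a + b * b

    norm²-cong : ∀ {z w} → z ≈ᶜ w → norm² z ≈ norm² w
    norm²-cong (mk p q) = +-cong (*-cong p p) (*-cong q q)

    norm²-* : ∀ z w → norm² (z *ᶜ w) ≈ norm² z * norm² w
    norm²-* (a , b) (c , e) = solve 4 (λ a b c e →
      (a :* c :- b :* e) :* (a :* c :- b :* e) :+ (a :* e :+ b :* c) :* (a :* e :+ b :* c) :=
      (a :* a :+ b :* b) :* (c :* c :+ e :* e)) ≈-refl a b c e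

    norm²-nonneg : ∀ z → 0# ≤ norm² z
    norm²-nonneg (a , b) = +-nonneg (square-nonneg a) (square-nonneg b)

    square-zero : ∀ {a} → a * a ≤ 0# → a ≈ 0#
    square-zero {a} h = ≤-antisym
      (≮⇒≥ λ 0<a → <-irrefl (<-≤-trans (*-pos 0<a 0<a) h))
      (≮⇒≥ λ a<0 → <-irrefl (<-≤-trans (*-pos (<⇒gap a<0) (<⇒gap a<0))
        (≤-respˡ-≈ (solve 1 (λ a → a :* a := (con 0ℚ :- a) :* (con 0ℚ :- a)) ≈-refl a) h)))

    norm²-zero : ∀ {z} → norm² z ≤ 0# → z ≈ᶜ ιᶜ 0ℚ
    norm²-zero {a , b} h = mk
      (square-zero (≤-trans (≤-by (b * b) (square-nonneg b) ≈-refl) h))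
      (square-zero (≤-trans (≤-by (a * a) (square-nonneg a) (+-comm (a * a) (b * b))) h))

    norm²-pos : ∀ {z} → ¬ (z ≈ᶜ ιᶜ 0ℚ) → 0# < norm² z
    norm²-pos z≉0 = ≰⇒> λ h → z≉0 (norm²-zero h)

    -- Translation by u scales the sum of |χ|² over the units by |χ u|².
    module _ {χ} (mult : Multiplicative χ) (per : Periodic χ) (nonzero : ∀ {u} → u ∈ units d → ¬ (χ u ≈ᶜ ιᶜ 0ℚ)) where

      unitary : ∀ {u} → u ∈ units d → norm² (χ u) ≈ 1#
      unitary {u} u∈ = *-cancelˡ-≈ S-pos (≈-trans (*-comm S (norm² (χ u)))
        (≈-trans (≈-sym scaled) (≈-sym (*-identityʳ S))))
        where
        F : ℕ → Carrier
        F w = norm² (χ w)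
        S = ∑ (units d) F
        S-pos : 0# < S
        S-pos = <-≤-trans (norm²-pos (nonzero u∈)) (∑-member (units d) (λ w → norm²-nonneg (χ w)) u∈)
        scaled : S ≈ norm² (χ u) * S
        scaled = ≈-trans (≈-sym (∑-translate u∈ (λ m n h → norm²-cong (per m n h))))
          (≈-trans (∑-cong (units d) λ w → ≈-trans (≈-trans (norm²-cong (mult u w)) (norm²-* (χ u) (χ w)))
              (≈-sym (+-identityʳ _)))
            (≈-trans (∑-affine (units d) F (norm² (χ u)) 0#)
              (≈-trans (+-congˡ (zeroʳ _)) (+-identityʳ _))))

    module _ {χ₁ χ₂} (mult₁ : Multiplicative χ₁) (mult₂ : Multiplicative χ₂)
      (per₁ : Periodic χ₁) (per₂ : Periodic χ₂)
      (nonzero₁ : ∀ {u} → u ∈ units d → ¬ (χ₁ u ≈ᶜ ιᶜ 0ℚ)) (nonzero₂ : ∀ {u} → u ∈ units d → ¬ (χ₂ u ≈ᶜ ιᶜ 0ℚ)) where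

      private
        -- real and imaginary parts of χ₁ times the conjugate of χ₂
        R I : ℕ → Carrier
        R u = re (χ₁ u) * re (χ₂ u) + im (χ₁ u) * im (χ₂ u)
        I u = im (χ₁ u) * re (χ₂ u) - re (χ₁ u) * im (χ₂ u)

      -- The real part of the multiplicativity of χ₁ times the conjugate of χ₂, with `- I u` grouped
      -- as a coefficient to fit `∑-linear`.
      R-* : ∀ u w → R (u ℕ.* w) ≈ R u * R w + - I u * I w
      R-* u w =
        let mk p q = mult₁ u w ; mk p′ q′ = mult₂ u w in
        ≈-trans (+-cong (*-cong p p′) (*-cong q q′))
          (quad (re (χ₁ u)) (im (χ₁ u)) (re (χ₁ w)) (im (χ₁ w)) (re (χ₂ u)) (im (χ₂ u)) (re (χ₂ w)) (im (χ₂ w)))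
        where
        quad : ∀ a b c d e f g h →
          (a * c - b * d) * (e * g - f * h) + (a * d + b * c) * (e * h + f * g) ≈
          (a * e + b * f) * (c * g + d * h) + - (b * e - a * f) * (d * g - c * h)
        quad = solve 8 (λ a b c d e f g h →
          (a :* c :- b :* d) :* (e :* g :- f :* h) :+ (a :* d :+ b :* c) :* (e :* h :+ f :* g) :=
          (a :* e :+ b :* f) :* (c :* g :+ d :* h) :+ :- (b :* e :- a :* f) :* (d :* g :- c :* h)) ≈-refl

      I-* : ∀ u w → I (u ℕ.* w) ≈ R u * I w + I u * R w
      I-* u w =
        let mk p q = mult₁ u w ; mk p′ q′ = mult₂ u w in
        ≈-trans (+-cong (*-cong q p′) (-‿cong (*-cong p q′)))
          (quad (re (χ₁ u)) (im (χ₁ u)) (re (χ₁ w)) (im (χ₁ w)) (re (χ₂ u)) (im (χ₂ u)) (re (χ₂ w)) (im (χ₂ w)))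
        where
        quad : ∀ a b c d e f g h →
          (a * d + b * c) * (e * g - f * h) - (a * c - b * d) * (e * h + f * g) ≈
          (a * e + b * f) * (d * g - c * h) + (b * e - a * f) * (c * g + d * h)
        quad = solve 8 (λ a b c d e f g h →
          (a :* d :+ b :* c) :* (e :* g :- f :* h) :- (a :* c :- b :* d) :* (e :* h :+ f :* g) :=
          (a :* e :+ b :* f) :* (d :* g :- c :* h) :+ (b :* e :- a :* f) :* (c :* g :+ d :* h)) ≈-refl

      ∑-linear : ∀ a b (f g : ℕ → Carrier) → ∑ (units d) (λ u → a * f u + b * g u) ≈ a * ∑ (units d) f + b * ∑ (units d) g
      ∑-linear a b f g = ≈-trans (∑-+ (units d) (λ u → a * f u) (λ u → b * g u)) (+-cong (scale a f) (scale b g))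
        where
        scale : ∀ a (f : ℕ → Carrier) → ∑ (units d) (λ u → a * f u) ≈ a * ∑ (units d) f
        scale a f = ≈-trans (∑-cong (units d) λ u → ≈-sym (+-identityʳ _))
          (≈-trans (∑-affine (units d) f a 0#) (≈-trans (+-congˡ (zeroʳ _)) (+-identityʳ _)))

      private
        SR = ∑ (units d) R
        SI = ∑ (units d) I

      -- Translation by u multiplies the complex number SR + i SI by R u + i I u and leaves the sum
      -- over the units unchanged. This is the real coordinate of that equation, and `I-sum` is the
      -- imaginary one.
      R-sum : ∀ {u} → u ∈ units d → R u * SR + - I u * SI ≈ SR
      R-sum {u} u∈ = ≈-trans (≈-sym (∑-linear (R u) (- I u) R I))
        (≈-trans (∑-cong (units d) λ w → ≈-sym (R-* u w)) (∑-translate u∈ λ m n h →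
          let mk p q = per₁ m n h ; mk p′ q′ = per₂ m n h in +-cong (*-cong p p′) (*-cong q q′)))

      I-sum : ∀ {u} → u ∈ units d → R u * SI + I u * SR ≈ SI
      I-sum {u} u∈ = ≈-trans (≈-sym (∑-linear (R u) (I u) I R))
        (≈-trans (∑-cong (units d) λ w → ≈-sym (I-* u w)) (∑-translate u∈ λ m n h →
          let mk p q = per₁ m n h ; mk p′ q′ = per₂ m n h in +-cong (*-cong q p′) (-‿cong (*-cong p q′))))

      -- Since |χ₁ u| = |χ₂ u| = 1, the number (1 - R u)² + (I u)² is |χ₁ u - χ₂ u|².
      separation : ∀ {u} → u ∈ units d → ¬ (χ₁ u ≈ᶜ χ₂ u) → 0# < (1# - R u) * (1# - R u) + I u * I u
      separation {u} u∈ χ₁≉χ₂ = <-respʳ-≈ (≈-trans (expand a b c e)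
          (≈-trans (+-congˡ (≈-trans (+-cong n₁ n₂) (≈-sym (+-congˡ (≈-trans (*-cong n₁ n₂) (*-identityˡ 1#))))))
            (collect a b c e)))
        (norm²-pos λ (mk p q) → χ₁≉χ₂ (mk (zero-diff a c p) (zero-diff b e q)))
        where
        a = re (χ₁ u)
        b = im (χ₁ u)
        c = re (χ₂ u)
        e = im (χ₂ u)
        n₁ = unitary mult₁ per₁ nonzero₁ u∈
        n₂ = unitary mult₂ per₂ nonzero₂ u∈
        zero-diff : ∀ x y → x - y ≈ 0# → x ≈ y
        zero-diff x y h = ≈-trans (solve 2 (λ x y → x := (x :- y) :+ y) ≈-refl x y) (≈-trans (+-congʳ h) (+-identityˡ y))
        expand : ∀ a b c e → (a - c) * (a - c) + (b - e) * (b - e) ≈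
          - (2# * (a * c + b * e)) + ((a * a + b * b) + (c * c + e * e))
        expand = solve 4 (λ a b c e → (a :- c) :* (a :- c) :+ (b :- e) :* (b :- e) :=
          :- (con (natℚ 2) :* (a :* c :+ b :* e)) :+ ((a :* a :+ b :* b) :+ (c :* c :+ e :* e))) ≈-refl
        collect : ∀ a b c e → - (2# * (a * c + b * e)) + (1# + (a * a + b * b) * (c * c + e * e)) ≈
          (1# - (a * c + b * e)) * (1# - (a * c + b * e)) + (b * c - a * e) * (b * c - a * e)
        collect = solve 4 (λ a b c e → :- (con (natℚ 2) :* (a :* c :+ b :* e)) :+ (con 1ℚ :+ (a :* a :+ b :* b) :* (c :* c :+ e :* e)) :=
          (con 1ℚ :- (a :* c :+ b :* e)) :* (con 1ℚ :- (a :* c :+ b :* e)) :+ (b :* c :- a :* e) :* (b :* c :- a :* e)) ≈-refl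

      module _ {u} (u∈ : u ∈ units d) (χ₁≉χ₂ : ¬ (χ₁ u ≈ᶜ χ₂ u)) where

        private
          vanish : ∀ x → x - x ≈ 0#
          vanish = solve 1 (λ x → x :- x := con 0ℚ) ≈-refl

        -- `R-sum` and `I-sum` form a homogeneous linear system for SR and SI with determinant (1 -
        -- R u)² + (I u)², which `separation` shows to be positive; Cramer's rule finishes.
        R-orthogonal : SR ≈ 0#
        R-orthogonal = *-cancelˡ-≈ (separation u∈ χ₁≉χ₂) (≈-trans
          (solve 4 (λ r i s t → ((con 1ℚ :- r) :* (con 1ℚ :- r) :+ i :* i) :* s :=
            (con 1ℚ :- r) :* (s :- (r :* s :+ :- i :* t)) :- i :* (t :- (r :* t :+ i :* s))) ≈-refl (R u) (I u) SR SI)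
          (≈-trans (+-cong (*-congˡ (≈-trans (+-congˡ (-‿cong (R-sum u∈))) (vanish SR)))
              (-‿cong (*-congˡ (≈-trans (+-congˡ (-‿cong (I-sum u∈))) (vanish SI)))))
            (solve 2 (λ r i → (con 1ℚ :- r) :* con 0ℚ :- i :* con 0ℚ := ((con 1ℚ :- r) :* (con 1ℚ :- r) :+ i :* i) :* con 0ℚ)
              ≈-refl (R u) (I u))))

        I-orthogonal : SI ≈ 0#
        I-orthogonal = *-cancelˡ-≈ (separation u∈ χ₁≉χ₂) (≈-trans
          (solve 4 (λ r i s t → ((con 1ℚ :- r) :* (con 1ℚ :- r) :+ i :* i) :* t :=
            (con 1ℚ :- r) :* (t :- (r :* t :+ i :* s)) :+ i :* (s :- (r :* s :+ :- i :* t))) ≈-refl (R u) (I u) SR SI)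
          (≈-trans (+-cong (*-congˡ (≈-trans (+-congˡ (-‿cong (I-sum u∈))) (vanish SI)))
              (*-congˡ (≈-trans (+-congˡ (-‿cong (R-sum u∈))) (vanish SR))))
            (solve 2 (λ r i → (con 1ℚ :- r) :* con 0ℚ :+ i :* con 0ℚ := ((con 1ℚ :- r) :* (con 1ℚ :- r) :+ i :* i) :* con 0ℚ)
              ≈-refl (R u) (I u))))

        second-moment : ∀ {e₁ e₂} → norm² e₁ ≈ 1# → norm² e₂ ≈ 1# →
          ∑ (units d) (λ w → norm² (e₁ *ᶜ χ₁ w +ᶜ e₂ *ᶜ χ₂ w)) ≈ 2# * ν (length (units d))
        second-moment {e₁} {e₂} n₁ n₂ = ≈-trans (∑-cong-∈ (units d) expand)
          (≈-trans (∑-affine (units d) (λ w → A * R w + B * I w) 1# 2#)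
            (≈-trans (+-congʳ (*-congˡ (≈-trans (∑-linear A B R I) (+-cong (*-congˡ R-orthogonal) (*-congˡ I-orthogonal)))))
              (solve 3 (λ a b n → con 1ℚ :* (a :* con 0ℚ :+ b :* con 0ℚ) :+ n :* con (natℚ 2) := con (natℚ 2) :* n) ≈-refl
                A B (ν (length (units d))))))
          where
          p = re e₁
          q = im e₁
          r = re e₂
          t = im e₂
          -- The cross term of |e₁ χ₁ + e₂ χ₂|² is twice the real part of e₁ times the conjugate of
          -- e₂ times R + i I. `A` and `B` are its coefficients at R and I.
          A = 2# * (p * r + q * t)
          B = - (2# * (q * r - p * t))
          quad : ∀ p q r t a b c e →
            (p * a - q * b + (r * c - t * e)) * (p * a - q * b + (r * c - t * e)) +
            (p * b + q * a + (r * e + t * c)) * (p * b + q * a + (r * e + t * c)) ≈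
            ((2# * (p * r + q * t)) * (a * c + b * e) + - (2# * (q * r - p * t)) * (b * c - a * e)) +
            ((p * p + q * q) * (a * a + b * b) + (r * r + t * t) * (c * c + e * e))
          quad = solve 8 (λ p q r t a b c e →
            (p :* a :- q :* b :+ (r :* c :- t :* e)) :* (p :* a :- q :* b :+ (r :* c :- t :* e)) :+
            (p :* b :+ q :* a :+ (r :* e :+ t :* c)) :* (p :* b :+ q :* a :+ (r :* e :+ t :* c)) :=
            ((con (natℚ 2) :* (p :* r :+ q :* t)) :* (a :* c :+ b :* e) :+ :- (con (natℚ 2) :* (q :* r :- p :* t)) :* (b :* c :- a :* e)) :+
            ((p :* p :+ q :* q) :* (a :* a :+ b :* b) :+ (r :* r :+ t :* t) :* (c :* c :+ e :* e))) ≈-refl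
          expand : ∀ {w} → w ∈ units d → norm² (e₁ *ᶜ χ₁ w +ᶜ e₂ *ᶜ χ₂ w) ≈ 1# * (A * R w + B * I w) + 2#
          expand {w} w∈ = ≈-trans (quad p q r t (re (χ₁ w)) (im (χ₁ w)) (re (χ₂ w)) (im (χ₂ w)))
            (+-cong (≈-sym (*-identityˡ _)) (≈-trans
              (+-cong (*-cong n₁ (unitary mult₁ per₁ nonzero₁ w∈)) (*-cong n₂ (unitary mult₂ per₂ nonzero₂ w∈)))
              (solve 0 (con 1ℚ :* con 1ℚ :+ con 1ℚ :* con 1ℚ := con (natℚ 2)) ≈-refl)))

open import Defs

-- The Cauchy reals as a complete ordered field.

module RealField where

  open ≡ using (refl; sym; trans; cong; subst)

  open ℚ-RingSolver using (solve; _:=_; _:+_; _:*_; _:-_; :-_; con)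

  ∣-∣-bounds : ∀ {a e} → ℚ.∣ a ∣ ℚ.< e → a ℚ.< e × ℚ.- a ℚ.< e
  ∣-∣-bounds {a} h = ℚₚ.≤-<-trans (p≤∣p∣ a) h
    , ℚₚ.≤-<-trans (subst (ℚ.- a ℚ.≤_) (ℚₚ.∣-p∣≡∣p∣ a) (p≤∣p∣ (ℚ.- a))) h
    where
    p≤∣p∣ : ∀ p → p ℚ.≤ ℚ.∣ p ∣
    p≤∣p∣ p with ℚₚ.∣p∣≡p∨∣p∣≡-p p | ℚₚ.≤-total 0ℚ p
    ... | inj₁ e | _ = ℚₚ.≤-reflexive (sym e)
    ... | inj₂ e | inj₁ 0≤p = ℚₚ.≤-reflexive (sym (ℚₚ.0≤p⇒∣p∣≡p 0≤p))
    ... | inj₂ e | inj₂ p≤0 = ℚₚ.≤-trans p≤0 (ℚₚ.0≤∣p∣ p)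

  bounds-∣-∣ : ∀ {a e} → a ℚ.< e → ℚ.- a ℚ.< e → ℚ.∣ a ∣ ℚ.< e
  bounds-∣-∣ {a} h h′ with ℚₚ.∣p∣≡p∨∣p∣≡-p a
  ... | inj₁ e = subst (ℚ._< _) (sym e) h
  ... | inj₂ e = subst (ℚ._< _) (sym e) h′

  private variable x y z : ℝ

  both : {P Q : ℕ → Set} → (∃ λ N → ∀ n → N ℕ.≤ n → P n) →
    (∃ λ N → ∀ n → N ℕ.≤ n → Q n) → ∃ λ N → ∀ n → N ℕ.≤ n → P n × Q n
  both (M , p) (N , q) = M ℕ.⊔ N , λ n h →
    p n (ℕₚ.m⊔n≤o⇒m≤o M N h) , q n (ℕₚ.m⊔n≤o⇒n≤o M N h)

  each : {P Q : ℕ → Set} → (∀ n → P n → Q n) →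
    (∃ λ N → ∀ n → N ℕ.≤ n → P n) → ∃ λ N → ∀ n → N ℕ.≤ n → Q n
  each f (N , p) = N , λ n h → f n (p n h)

  ≈⇒≤ : ∀ x y → x ≈ y → x ≤ y
  ≈⇒≤ x y h ε ε>0 = each (λ n e → ℚ-<-by (ε ℚ.- (seq x n ℚ.- seq y n))
      (ℚ-gap (proj₁ (∣-∣-bounds e)))
      (solve 3 (λ a b ε → b :+ ε := (ε :- (a :- b)) :+ a) refl (seq x n) (seq y n) ε))
    (h ε ε>0)

  ≈-sym : ∀ x y → x ≈ y → y ≈ x
  ≈-sym x y h ε ε>0 = each (λ n → subst (ℚ._< ε)
      (trans (sym (ℚₚ.∣-p∣≡∣p∣ (seq x n ℚ.- seq y n)))
        (cong ℚ.∣_∣ (solve 2 (λ a b → :- (a :- b) := b :- a) refl (seq x n) (seq y n)))))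
    (h ε ε>0)

  ≤-antisym : ∀ x y → x ≤ y → y ≤ x → x ≈ y
  ≤-antisym x y h k ε ε>0 = each (λ n (p , q) → bounds-∣-∣
      (ℚ-<-by _ (ℚ-gap p) (solve 3 (λ a b ε → ε := ((b :+ ε) :- a) :+ (a :- b)) refl (seq x n) (seq y n) ε))
      (ℚ-<-by _ (ℚ-gap q) (solve 3 (λ a b ε → ε := ((a :+ ε) :- b) :+ (:- (a :- b))) refl (seq x n) (seq y n) ε)))
    (both (h ε ε>0) (k ε ε>0))

  ≤-trans : ∀ x y z → x ≤ y → y ≤ z → x ≤ z
  ≤-trans x y z h k ε ε>0 = each (λ n (p , q) → ℚ-<-by _ (ℚ-+-pos (ℚ-gap p) (ℚ-gap q))
      (solve 4 (λ a b c ε → c :+ ε :=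
        ((b :+ con ℚ.½ :* ε) :- a :+ ((c :+ con ℚ.½ :* ε) :- b)) :+ a) refl
        (seq x n) (seq y n) (seq z n) ε))
    (both (h _ (ℚ-half ε>0)) (k _ (ℚ-half ε>0)))

  pointwise : ∀ x y → (∀ n → seq x n ≡ seq y n) → x ≈ y
  pointwise x y h ε ε>0 = 0 , λ n _ → subst (ℚ._< ε)
    (sym (cong ℚ.∣_∣ (trans (cong (ℚ._- seq y n) (h n)) (ℚₚ.+-inverseʳ (seq y n))))) ε>0

  ≈-trans : ∀ x y z → x ≈ y → y ≈ z → x ≈ z
  ≈-trans x y z h k = ≤-antisym x z
    (≤-trans x y z (≈⇒≤ x y h) (≈⇒≤ y z k))
    (≤-trans z y x (≈⇒≤ z y (≈-sym y z k)) (≈⇒≤ y x (≈-sym x y h)))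

  +-mono-≤ : ∀ x x′ y y′ → x ≤ x′ → y ≤ y′ → x + y ≤ x′ + y′
  +-mono-≤ x x′ y y′ h k ε ε>0 = each (λ n (p , q) → ℚ-<-by _ (ℚ-+-pos (ℚ-gap p) (ℚ-gap q))
      (solve 5 (λ a a′ b b′ ε → (a′ :+ b′) :+ ε :=
        ((a′ :+ con ℚ.½ :* ε) :- a :+ ((b′ :+ con ℚ.½ :* ε) :- b)) :+ (a :+ b)) refl
        (seq x n) (seq x′ n) (seq y n) (seq y′ n) ε))
    (both (h _ (ℚ-half ε>0)) (k _ (ℚ-half ε>0)))

  neg-anti-≤ : ∀ x y → x ≤ y → - y ≤ - x
  neg-anti-≤ x y h ε ε>0 = each (λ n p → ℚ-<-by _ (ℚ-gap p)
      (solve 3 (λ a b ε → (:- a) :+ ε := ((b :+ ε) :- a) :+ (:- b)) refl (seq x n) (seq y n) ε))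
    (h ε ε>0)

  +-cong : ∀ x x′ y y′ → x ≈ x′ → y ≈ y′ → x + y ≈ x′ + y′
  +-cong x x′ y y′ h k = ≤-antisym (x + y) (x′ + y′)
    (+-mono-≤ x x′ y y′ (≈⇒≤ x x′ h) (≈⇒≤ y y′ k))
    (+-mono-≤ x′ x y′ y (≈⇒≤ x′ x (≈-sym x x′ h)) (≈⇒≤ y′ y (≈-sym y y′ k)))

  neg-cong : ∀ x y → x ≈ y → - x ≈ - y
  neg-cong x y h = ≤-antisym (- x) (- y) (neg-anti-≤ y x (≈⇒≤ y x (≈-sym x y h)))
    (neg-anti-≤ x y (≈⇒≤ x y h))

  bounded : ∀ x → ∃ λ B → 0ℚ ℚ.< B × ∃ λ N → ∀ n → N ℕ.≤ n → seq x n ℚ.< B × ℚ.- seq x n ℚ.< B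
  bounded x with cauchy x 1ℚ (ℚₚ.positive⁻¹ 1ℚ)
  ... | N , h = B , ℚₚ.+-mono-<-≤ (ℚₚ.positive⁻¹ 1ℚ) (ℚₚ.0≤∣p∣ (seq x N)) , N
      , λ n p → ∣-∣-bounds (ℚₚ.≤-<-trans (split n) (ℚₚ.+-monoˡ-< ℚ.∣ seq x N ∣ (h n N p ℕₚ.≤-refl)))
    where
    B = 1ℚ ℚ.+ ℚ.∣ seq x N ∣
    split : ∀ n → ℚ.∣ seq x n ∣ ℚ.≤ ℚ.∣ seq x n ℚ.- seq x N ∣ ℚ.+ ℚ.∣ seq x N ∣
    split n = subst (λ t → ℚ.∣ t ∣ ℚ.≤ ℚ.∣ seq x n ℚ.- seq x N ∣ ℚ.+ ℚ.∣ seq x N ∣)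
      (solve 2 (λ a b → (a :- b) :+ b := a) refl (seq x n) (seq x N))
      (ℚₚ.∣p+q∣≤∣p∣+∣q∣ (seq x n ℚ.- seq x N) (seq x N))

  -- With a, b > - δ one has (a + δ)(b + δ) > 0, that is a b > - δ (a + b + δ),
  -- and a + b + δ ≤ A + B + 1 once δ ≤ 1.
  *-nonneg : ∀ x y → 0ℝ ≤ x → 0ℝ ≤ y → 0ℝ ≤ x * y
  *-nonneg x y 0≤x 0≤y ε ε>0 =
    let A , A>0 , ex = bounded x
        B , B>0 , ey = bounded y
        δ₀ , δ₀>0 , eq = ℚ-divide (ℚ-+-pos (ℚ-+-pos A>0 B>0) (ℚₚ.positive⁻¹ 1ℚ)) ε>0
        δ = δ₀ ℚ.⊓ 1ℚ
        δ>0 = ⊓-pos δ₀ δ₀>0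
    in each (λ n ((p , q) , (p′ , _) , (q′ , _)) →
        let u>0 = ℚ-gap p
            v>0 = ℚ-gap q
            a = seq x n
            b = seq y n
        in ℚₚ.<-≤-trans
          (ℚ-<-by ((b ℚ.+ δ ℚ.- 0ℚ) ℚ.* (a ℚ.+ δ ℚ.- 0ℚ) ℚ.+ δ ℚ.* ((A ℚ.- a) ℚ.+ (B ℚ.- b)))
            (ℚ-+-pos (ℚ-*-pos v>0 u>0) (ℚ-*-pos δ>0 (ℚ-+-pos (ℚ-gap p′) (ℚ-gap q′))))
            (solve 5 (λ a b δ A B → a :* b :+ (A :+ B :+ δ) :* δ :=
              ((b :+ δ :- con 0ℚ) :* (a :+ δ :- con 0ℚ) :+ δ :* ((A :- a) :+ (B :- b))) :+ con 0ℚ)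
              refl a b δ A B))
          (ℚₚ.+-monoʳ-≤ (a ℚ.* b) (ℚₚ.≤-trans
            (ℚₚ.*-monoʳ-≤-nonNeg δ {{ℚ.nonNegative (ℚₚ.<⇒≤ δ>0)}}
              (ℚₚ.+-monoʳ-≤ (A ℚ.+ B) (ℚₚ.p⊓q≤q δ₀ 1ℚ)))
            (ℚₚ.≤-trans (ℚₚ.*-monoˡ-≤-nonNeg (A ℚ.+ B ℚ.+ 1ℚ)
                {{ℚ.nonNegative (ℚₚ.<⇒≤ (ℚ-+-pos (ℚ-+-pos A>0 B>0) (ℚₚ.positive⁻¹ 1ℚ)))}}
                (ℚₚ.p⊓q≤p δ₀ 1ℚ))
              (ℚₚ.≤-reflexive eq)))))
      (both (both (0≤x δ δ>0) (0≤y δ δ>0)) (both ex ey))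
    where
    ⊓-pos : ∀ d → 0ℚ ℚ.< d → 0ℚ ℚ.< d ℚ.⊓ 1ℚ
    ⊓-pos d d>0 with ℚₚ.⊓-sel d 1ℚ
    ... | inj₁ e = subst (0ℚ ℚ.<_) (sym e) d>0
    ... | inj₂ e = subst (0ℚ ℚ.<_) (sym e) (ℚₚ.positive⁻¹ 1ℚ)

  <⇒≤ : ∀ x y → x < y → x ≤ y
  <⇒≤ x y (δ , δ>0 , e) ε ε>0 = each (λ n p → ℚ-<-by _ (ℚ-+-pos (ℚ-+-pos (ℚ-gap p) δ>0) ε>0)
      (solve 4 (λ a b δ ε → b :+ ε := ((b :- (a :+ δ)) :+ δ :+ ε) :+ a) refl
        (seq x n) (seq y n) δ ε)) e

  <-irrefl : ∀ x → ¬ (x < x)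
  <-irrefl x (δ , δ>0 , N , e) = ℚₚ.<-irrefl refl
    (ℚₚ.<-trans (ℚ-<-by δ δ>0 (ℚₚ.+-comm (seq x N) δ)) (e N ℕₚ.≤-refl))

  ≤-<-trans : ∀ x y z → x ≤ y → y < z → x < z
  ≤-<-trans x y z h (δ , δ>0 , e) = ℚ.½ ℚ.* δ , ℚ-half δ>0
    , each (λ n (p , q) → ℚ-<-by _ (ℚ-+-pos (ℚ-gap p) (ℚ-gap q))
        (solve 4 (λ a b c δ → c :=
          (b :+ con ℚ.½ :* δ :- a) :+ (c :- (b :+ δ)) :+ (a :+ con ℚ.½ :* δ)) refl
          (seq x n) (seq y n) (seq z n) δ))
      (both (h _ (ℚ-half δ>0)) e)

  <-≤-trans : ∀ x y z → x < y → y ≤ z → x < z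
  <-≤-trans x y z (δ , δ>0 , e) h = ℚ.½ ℚ.* δ , ℚ-half δ>0
    , each (λ n (p , q) → ℚ-<-by _ (ℚ-+-pos (ℚ-gap p) (ℚ-gap q))
        (solve 4 (λ a b c δ → c :=
          (c :+ con ℚ.½ :* δ :- b) :+ (b :- (a :+ δ)) :+ (a :+ con ℚ.½ :* δ)) refl
          (seq x n) (seq y n) (seq z n) δ))
      (both (h _ (ℚ-half δ>0)) e)

  +-monoʳ-< : ∀ x y z → y < z → x + y < x + z
  +-monoʳ-< x y z (δ , δ>0 , e) = δ , δ>0 , each (λ n p → ℚ-<-by _ (ℚ-gap p)
    (solve 4 (λ a b c δ → a :+ c := (c :- (b :+ δ)) :+ ((a :+ b) :+ δ)) refl
      (seq x n) (seq y n) (seq z n) δ)) e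

  *-pos : ∀ x y → 0ℝ < x → 0ℝ < y → 0ℝ < x * y
  *-pos x y (δ , δ>0 , e) (η , η>0 , f) = δ ℚ.* η , ℚ-*-pos δ>0 η>0
    , each (λ n (p , q) → ℚ-<-by _
        (ℚ-+-pos (ℚ-*-pos (ℚ-gap p) (ℚ-gap q)) (ℚ-+-pos (ℚ-*-pos (ℚ-gap p) η>0) (ℚ-*-pos δ>0 (ℚ-gap q))))
        (solve 4 (λ a b δ η → a :* b :=
          (a :- (con 0ℚ :+ δ)) :* (b :- (con 0ℚ :+ η)) :+ ((a :- (con 0ℚ :+ δ)) :* η :+ δ :* (b :- (con 0ℚ :+ η)))
            :+ (con 0ℚ :+ δ :* η)) refl
          (seq x n) (seq y n) δ η))
      (both e f)

  -- With δ = ε/4, the rationals a and b are compared at one index N beyond which both sequences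
  -- stay within δ/2. If a > b + 2 δ, then x exceeds y by δ from N on, against the hypothesis;
  -- otherwise seq x n < seq y n + 3 δ for all n ≥ N.
  ≮⇒≥ : ∀ x y → ¬ (y < x) → x ≤ y
  ≮⇒≥ x y y≮x ε ε>0 = N , λ n N≤n → decide n N≤n (b ℚ.+ (δ ℚ.+ δ) ℚₚ.<? a)
    where
    δ = ℚ.½ ℚ.* (ℚ.½ ℚ.* ε)
    δ>0 = ℚ-half (ℚ-half ε>0)
    η = ℚ.½ ℚ.* δ
    η>0 = ℚ-half δ>0
    N₁ = proj₁ (cauchy x η η>0)
    N₂ = proj₁ (cauchy y η η>0)
    N = N₁ ℕ.⊔ N₂
    a = seq x N
    b = seq y N
    x-near : ∀ n → N ℕ.≤ n → a ℚ.- seq x n ℚ.< η × ℚ.- (a ℚ.- seq x n) ℚ.< η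
    x-near n h = ∣-∣-bounds (proj₂ (cauchy x η η>0) N n (ℕₚ.m≤m⊔n N₁ N₂) (ℕₚ.m⊔n≤o⇒m≤o N₁ N₂ h))
    y-near : ∀ n → N ℕ.≤ n → b ℚ.- seq y n ℚ.< η × ℚ.- (b ℚ.- seq y n) ℚ.< η
    y-near n h = ∣-∣-bounds (proj₂ (cauchy y η η>0) N n (ℕₚ.m≤n⊔m N₁ N₂) (ℕₚ.m⊔n≤o⇒n≤o N₁ N₂ h))
    above : ∀ a a′ b b′ δ → a′ ≡
      ((a ℚ.- (b ℚ.+ (δ ℚ.+ δ))) ℚ.+ ((ℚ.½ ℚ.* δ ℚ.- (a ℚ.- a′)) ℚ.+ (ℚ.½ ℚ.* δ ℚ.- (ℚ.- (b ℚ.- b′))))) ℚ.+ (b′ ℚ.+ δ)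
    above = solve 5 (λ a a′ b b′ δ → a′ :=
      ((a :- (b :+ (δ :+ δ))) :+ ((con ℚ.½ :* δ :- (a :- a′)) :+ (con ℚ.½ :* δ :- (:- (b :- b′))))) :+ (b′ :+ δ)) refl
    below : ∀ a a′ b b′ δ → b′ ℚ.+ (b ℚ.+ (δ ℚ.+ δ) ℚ.- b) ℚ.+ δ ≡
      (((ℚ.½ ℚ.* δ ℚ.- (ℚ.- (a ℚ.- a′))) ℚ.+ (ℚ.½ ℚ.* δ ℚ.- (b ℚ.- b′))) ℚ.+ ((b ℚ.+ (δ ℚ.+ δ)) ℚ.- a)) ℚ.+ a′
    below = solve 5 (λ a a′ b b′ δ → b′ :+ (b :+ (δ :+ δ) :- b) :+ δ :=
      (((con ℚ.½ :* δ :- (:- (a :- a′))) :+ (con ℚ.½ :* δ :- (b :- b′))) :+ ((b :+ (δ :+ δ)) :- a)) :+ a′) refl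
    four : ∀ b b′ ε → b′ ℚ.+ (b ℚ.+ (ℚ.½ ℚ.* (ℚ.½ ℚ.* ε) ℚ.+ ℚ.½ ℚ.* (ℚ.½ ℚ.* ε)) ℚ.- b) ℚ.+ ℚ.½ ℚ.* (ℚ.½ ℚ.* ε) ℚ.+ ℚ.½ ℚ.* (ℚ.½ ℚ.* ε) ≡ b′ ℚ.+ ε
    four = solve 3 (λ b b′ ε → let δ = con ℚ.½ :* (con ℚ.½ :* ε) in
      b′ :+ (b :+ (δ :+ δ) :- b) :+ δ :+ δ := b′ :+ ε) refl
    decide : ∀ n → N ℕ.≤ n → Dec (b ℚ.+ (δ ℚ.+ δ) ℚ.< a) → seq x n ℚ.< seq y n ℚ.+ ε
    decide n N≤n (yes p) = ⊥-elim (y≮x (δ , δ>0 , N , λ m N≤m →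
      ℚ-<-by _ (ℚ-+-pos (ℚ-gap p) (ℚ-+-pos (ℚ-gap (proj₁ (x-near m N≤m))) (ℚ-gap (proj₂ (y-near m N≤m)))))
        (above a (seq x m) b (seq y m) δ)))
    decide n N≤n (no ¬p) = ℚₚ.<-trans
      (ℚ-<-by _ (ℚₚ.+-mono-<-≤ (ℚ-+-pos (ℚ-gap (proj₂ (x-near n N≤n))) (ℚ-gap (proj₁ (y-near n N≤n))))
          (subst (ℚ._≤ (b ℚ.+ (δ ℚ.+ δ)) ℚ.- a) (ℚₚ.+-inverseʳ a) (ℚₚ.+-monoˡ-≤ (ℚ.- a) (ℚₚ.≮⇒≥ ¬p))))
        (below a (seq x n) b (seq y n) δ))
      (ℚ-<-by δ δ>0 (trans (sym (four b (seq y n) ε)) (ℚₚ.+-comm _ δ)))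

  fromℚ-mono-< : ∀ {p q} → p ℚ.< q → fromℚ p < fromℚ q
  fromℚ-mono-< {p} {q} p<q = ℚ.½ ℚ.* (q ℚ.- p) , ℚ-half (ℚ-gap p<q) , 0 , λ _ _ →
    ℚ-<-by _ (ℚ-half (ℚ-gap p<q))
      (solve 2 (λ p q → q := con ℚ.½ :* (q :- p) :+ (p :+ con ℚ.½ :* (q :- p))) refl p q)

  weaken-< : ∀ a b {ε} → 0ℚ ℚ.< ε → a ℚ.< b → a ℚ.< b ℚ.+ ε
  weaken-< a b {ε} ε>0 a<b = ℚₚ.<-trans a<b
    (subst (ℚ._< b ℚ.+ ε) (ℚₚ.+-identityʳ b) (ℚₚ.+-monoʳ-< b ε>0))

  fromℚ-below : ∀ x → 0ℝ < x → ∃ λ q → 0ℚ ℚ.< q × fromℚ q ≤ x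
  fromℚ-below x (δ , δ>0 , N , e) = δ , δ>0 , λ ε ε>0 → N , λ n h →
    weaken-< δ (seq x n) ε>0 (subst (ℚ._< seq x n) (ℚₚ.+-identityˡ δ) (e n h))

  fromℚ-above : ∀ x → ∃ λ q → x ≤ fromℚ q
  fromℚ-above x = proj₁ (bounded x) , λ ε ε>0 → proj₁ (proj₂ (proj₂ (bounded x))) , λ n h →
    weaken-< (seq x n) _ ε>0 (proj₁ (proj₂ (proj₂ (proj₂ (bounded x))) n h))

  near-upper : ∀ am an qm qn ε → let δ = ℚ.½ ℚ.* (ℚ.½ ℚ.* ε) in
    am ℚ.< an ℚ.+ δ ℚ.+ δ → ℚ.- (am ℚ.- qm) ℚ.< δ → an ℚ.- qn ℚ.< δ → qm ℚ.< qn ℚ.+ ε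
  near-upper am an qm qn ε p u v = ℚ-<-by _ (ℚ-+-pos (ℚ-gap p) (ℚ-+-pos (ℚ-gap u) (ℚ-gap v)))
    (solve 5 (λ am an qm qn ε → let δ = con ℚ.½ :* (con ℚ.½ :* ε) in
      qn :+ ε := ((an :+ δ :+ δ :- am) :+ ((δ :- (:- (am :- qm))) :+ (δ :- (an :- qn)))) :+ qm)
      refl am an qm qn ε)

  chain-upper : ∀ a b c ε η → 0ℚ ℚ.< η → a ℚ.- b ℚ.< ℚ.½ ℚ.* ε → b ℚ.< c ℚ.+ ℚ.½ ℚ.* ε → a ℚ.< c ℚ.+ ε ℚ.+ η
  chain-upper a b c ε η η>0 u v = ℚ-<-by _ (ℚ-+-pos (ℚ-gap u) (ℚ-+-pos (ℚ-gap v) η>0))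
    (solve 5 (λ a b c ε η → c :+ ε :+ η :=
      ((con ℚ.½ :* ε :- (a :- b)) :+ ((c :+ con ℚ.½ :* ε :- b) :+ η)) :+ a) refl a b c ε η)

  chain-lower : ∀ a b c ε η → 0ℚ ℚ.< η → ℚ.- (a ℚ.- b) ℚ.< ℚ.½ ℚ.* ε → c ℚ.< b ℚ.+ ℚ.½ ℚ.* ε → c ℚ.< a ℚ.+ ε ℚ.+ η
  chain-lower a b c ε η η>0 u v = ℚ-<-by _ (ℚ-+-pos (ℚ-gap u) (ℚ-+-pos (ℚ-gap v) η>0))
    (solve 5 (λ a b c ε η → a :+ ε :+ η :=
      ((con ℚ.½ :* ε :- (:- (a :- b))) :+ ((b :+ con ℚ.½ :* ε :- c) :+ η)) :+ c) refl a b c ε η)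

  ∣-∣-intro : ∀ a b ε → a ℚ.< b ℚ.+ ε → b ℚ.< a ℚ.+ ε → ℚ.∣ a ℚ.- b ∣ ℚ.< ε
  ∣-∣-intro a b ε p q = bounds-∣-∣
    (ℚ-<-by _ (ℚ-gap p) (solve 3 (λ a b ε → ε := ((b :+ ε) :- a) :+ (a :- b)) refl a b ε))
    (ℚ-<-by _ (ℚ-gap q) (solve 3 (λ a b ε → ε := ((a :+ ε) :- b) :+ (:- (a :- b))) refl a b ε))

  module Limit (a : ℕ → ℝ)
    (a-cauchy : ∀ ε → 0ℚ ℚ.< ε → ∃ λ N → ∀ m n → N ℕ.≤ m → N ℕ.≤ n → a m ≤ a n + fromℚ ε) where

    index : ∀ n → ∃ λ N → ∀ j l → N ℕ.≤ j → N ℕ.≤ l → ℚ.∣ seq (a n) j ℚ.- seq (a n) l ∣ ℚ.< recip n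
    index n = cauchy (a n) (recip n) (recip-pos n)

    k : ℕ → ℕ
    k n = proj₁ (index n)

    -- A diagonal sequence: `q n` is within 1/(n + 1) of every term of `a n` from index `k n` on.
    q : ℕ → ℚ
    q n = seq (a n) (k n)

    q-near : ∀ n ε j → recip n ℚ.≤ ε → k n ℕ.≤ j →
      seq (a n) j ℚ.- q n ℚ.< ε × ℚ.- (seq (a n) j ℚ.- q n) ℚ.< ε
    q-near n ε j r≤ε h = ∣-∣-bounds (ℚₚ.<-≤-trans (proj₂ (index n) j (k n) h ℕₚ.≤-refl) r≤ε)

    q-upper : ∀ ε → 0ℚ ℚ.< ε → ∃ λ N → ∀ m n → N ℕ.≤ m → N ℕ.≤ n → q m ℚ.< q n ℚ.+ ε
    q-upper ε ε>0 = M ℕ.⊔ N , bound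
      where
      δ = ℚ.½ ℚ.* (ℚ.½ ℚ.* ε)
      δ>0 : 0ℚ ℚ.< δ
      δ>0 = ℚ-half (ℚ-half ε>0)
      M = proj₁ (recip-small δ δ>0)
      small = proj₂ (recip-small δ δ>0)
      N = proj₁ (a-cauchy δ δ>0)
      bound : ∀ m n → M ℕ.⊔ N ℕ.≤ m → M ℕ.⊔ N ℕ.≤ n → q m ℚ.< q n ℚ.+ ε
      bound m n p p′ = near-upper (seq (a m) j) (seq (a n) j) (q m) (q n) ε
        (proj₂ close j (ℕₚ.m≤m⊔n J (k m ℕ.⊔ k n)))
        (proj₂ (q-near m δ j (small m (ℕₚ.m⊔n≤o⇒m≤o M N p))
          (ℕₚ.≤-trans (ℕₚ.m≤m⊔n (k m) (k n)) (ℕₚ.m≤n⊔m J (k m ℕ.⊔ k n)))))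
        (proj₁ (q-near n δ j (small n (ℕₚ.m⊔n≤o⇒m≤o M N p′))
          (ℕₚ.≤-trans (ℕₚ.m≤n⊔m (k m) (k n)) (ℕₚ.m≤n⊔m J (k m ℕ.⊔ k n)))))
        where
        close : ∃ λ J → ∀ j → J ℕ.≤ j → seq (a m) j ℚ.< seq (a n) j ℚ.+ δ ℚ.+ δ
        close = proj₂ (a-cauchy δ δ>0) m n (ℕₚ.m⊔n≤o⇒n≤o M N p) (ℕₚ.m⊔n≤o⇒n≤o M N p′) δ δ>0
        J = proj₁ close
        -- At this common index the passages from q m to a m, from a m to a n at a cost of 2 δ, and
        -- from a n to q n are all available, and together they cost 4 δ = ε.
        j = J ℕ.⊔ (k m ℕ.⊔ k n)

    L : ℝ
    L = mkℝ q λ ε ε>0 → proj₁ (q-upper ε ε>0) , λ m n p p′ →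
      ∣-∣-intro (q m) (q n) ε (proj₂ (q-upper ε ε>0) m n p p′) (proj₂ (q-upper ε ε>0) n m p′ p)

    converges : ∀ ε → 0ℚ ℚ.< ε → ∃ λ N → ∀ n → N ℕ.≤ n → a n ≤ L + fromℚ ε × L ≤ a n + fromℚ ε
    converges ε ε>0 = M ℕ.⊔ N , λ n p →
        (λ η η>0 → k n ℕ.⊔ N , λ j e → chain-upper (seq (a n) j) (q n) (q j) ε η η>0
          (proj₁ (q-near n δ j (small n (ℕₚ.m⊔n≤o⇒m≤o M N p)) (ℕₚ.m⊔n≤o⇒m≤o (k n) N e)))
          (proj₂ (q-upper δ δ>0) n j (ℕₚ.m⊔n≤o⇒n≤o M N p) (ℕₚ.m⊔n≤o⇒n≤o (k n) N e)))
      , (λ η η>0 → k n ℕ.⊔ N , λ j e → chain-lower (seq (a n) j) (q n) (q j) ε η η>0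
          (proj₂ (q-near n δ j (small n (ℕₚ.m⊔n≤o⇒m≤o M N p)) (ℕₚ.m⊔n≤o⇒m≤o (k n) N e)))
          (proj₂ (q-upper δ δ>0) j n (ℕₚ.m⊔n≤o⇒n≤o (k n) N e) (ℕₚ.m⊔n≤o⇒n≤o M N p)))
      where
      δ = ℚ.½ ℚ.* ε
      δ>0 : 0ℚ ℚ.< δ
      δ>0 = ℚ-half ε>0
      M = proj₁ (recip-small δ δ>0)
      small = proj₂ (recip-small δ δ>0)
      N = proj₁ (q-upper δ δ>0)

  -- Multiplication by z respects ≤ when z ≥ 0, and one of z, - z is.
  *-congˡ : (∀ u v → u ≤ v ⊎ v < u) → ∀ z x y → x ≈ y → z * x ≈ z * y
  *-congˡ compare z x y x≈y = ≤-antisym (z * x) (z * y) (scale x y x≈y) (scale y x (≈-sym x y x≈y))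
    where
    from-gap : ∀ u v w → 0ℝ ≤ w → (∀ n → seq v n ≡ seq u n ℚ.+ seq w n) → u ≤ v
    from-gap u v w 0≤w eq = ≤-trans u (u + w) v
      (≤-trans u (u + 0ℝ) (u + w)
        (≈⇒≤ u (u + 0ℝ) (pointwise u (u + 0ℝ) λ n → sym (ℚₚ.+-identityʳ (seq u n))))
        (+-mono-≤ u u 0ℝ w (≈⇒≤ u u (pointwise u u λ _ → refl)) 0≤w))
      (≈⇒≤ (u + w) v (pointwise (u + w) v λ n → sym (eq n)))
    gap : ∀ u v → u ≤ v → 0ℝ ≤ v - u
    gap u v h = ≤-trans 0ℝ (u - u) (v - u)
      (≈⇒≤ 0ℝ (u - u) (pointwise 0ℝ (u - u) λ n → sym (ℚₚ.+-inverseʳ (seq u n))))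
      (+-mono-≤ u v (- u) (- u) h (≈⇒≤ (- u) (- u) (pointwise (- u) (- u) λ _ → refl)))
    scale : ∀ x y → x ≈ y → z * x ≤ z * y
    scale x y h with compare 0ℝ z
    ... | inj₁ 0≤z = from-gap (z * x) (z * y) (z * (y - x)) (*-nonneg z (y - x) 0≤z (gap x y (≈⇒≤ x y h)))
      λ n → solve 3 (λ z x y → z :* y := z :* x :+ z :* (y :- x)) refl (seq z n) (seq x n) (seq y n)
    ... | inj₂ z<0 = from-gap (z * x) (z * y) ((0ℝ - z) * (x - y))
      (*-nonneg (0ℝ - z) (x - y) (gap z 0ℝ (<⇒≤ z 0ℝ z<0)) (gap y x (≈⇒≤ y x (≈-sym x y h))))
      λ n → solve 3 (λ z x y → z :* y := z :* x :+ (con 0ℚ :- z) :* (x :- y)) refl (seq z n) (seq x n) (seq y n)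

  module _ (lem : ExcludedMiddle 0ℓ) where

    -- Excluded middle enters the field structure only through this dichotomy; `*-cong` relies on it
    -- to know a sign.
    compare : ∀ x y → x ≤ y ⊎ y < x
    compare x y with lem {y < x}
    ... | yes y<x = inj₂ y<x
    ... | no y≮x  = inj₁ (≮⇒≥ x y y≮x)

    *-cong : ∀ x x′ y y′ → x ≈ x′ → y ≈ y′ → x * y ≈ x′ * y′
    *-cong x x′ y y′ h h′ = ≈-trans (x * y) (x * y′) (x′ * y′) (*-congˡ compare x y y′ h′)
      (≈-trans (x * y′) (y′ * x) (x′ * y′) (comm x y′)
        (≈-trans (y′ * x) (y′ * x′) (x′ * y′) (*-congˡ compare y′ x x′ h) (comm y′ x′)))
      where
      comm : ∀ u v → u * v ≈ v * u
      comm u v = pointwise (u * v) (v * u) λ n → ℚₚ.*-comm (seq u n) (seq v n)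

    ℝ-isCommutativeRing : IsCommutativeRing _≈_ _+_ _*_ -_ (fromℚ 0ℚ) (fromℚ 1ℚ)
    ℝ-isCommutativeRing = record
      { isRing = record
        { +-isAbelianGroup = record
          { isGroup = record
            { isMonoid = record
              { isSemigroup = record
                { isMagma = record
                  { isEquivalence = record
                    { refl  = λ {x} → pointwise x x λ _ → refl
                    ; sym   = λ {x} {y} → ≈-sym x y
                    ; trans = λ {x} {y} {z} → ≈-trans x y z
                    }
                  ; ∙-cong = λ {x} {x′} {y} {y′} → +-cong x x′ y y′
                  }
                ; assoc = λ x y z → pointwise ((x + y) + z) (x + (y + z)) λ n → ℚₚ.+-assoc (seq x n) (seq y n) (seq z n)
                }
              ; identity = (λ x → pointwise (fromℚ 0ℚ + x) x λ n → ℚₚ.+-identityˡ (seq x n))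
                         , (λ x → pointwise (x + fromℚ 0ℚ) x λ n → ℚₚ.+-identityʳ (seq x n))
              }
            ; inverse = (λ x → pointwise (- x + x) (fromℚ 0ℚ) λ n → ℚₚ.+-inverseˡ (seq x n))
                      , (λ x → pointwise (x + - x) (fromℚ 0ℚ) λ n → ℚₚ.+-inverseʳ (seq x n))
            ; ⁻¹-cong = λ {x} {y} → neg-cong x y
            }
          ; comm = λ x y → pointwise (x + y) (y + x) λ n → ℚₚ.+-comm (seq x n) (seq y n)
          }
        ; *-cong = λ {x} {x′} {y} {y′} → *-cong x x′ y y′
        ; *-assoc = λ x y z → pointwise ((x * y) * z) (x * (y * z)) λ n → ℚₚ.*-assoc (seq x n) (seq y n) (seq z n)
        ; *-identity = (λ x → pointwise (fromℚ 1ℚ * x) x λ n → ℚₚ.*-identityˡ (seq x n))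
                     , (λ x → pointwise (x * fromℚ 1ℚ) x λ n → ℚₚ.*-identityʳ (seq x n))
        ; distrib = (λ x y z → pointwise (x * (y + z)) (x * y + x * z) λ n → ℚₚ.*-distribˡ-+ (seq x n) (seq y n) (seq z n))
                  , (λ x y z → pointwise ((y + z) * x) (y * x + z * x) λ n → ℚₚ.*-distribʳ-+ (seq x n) (seq y n) (seq z n))
        }
      ; *-comm = λ x y → pointwise (x * y) (y * x) λ n → ℚₚ.*-comm (seq x n) (seq y n)
      }

    ℝ-field : CompleteOrderedField
    ℝ-field = record
      { Carrier = ℝ
      ; _≈_ = _≈_
      ; _≤_ = _≤_
      ; _<_ = _<_
      ; _+_ = _+_
      ; _*_ = _*_
      ; -_ = -_
      ; ι = fromℚ
      ; isCommutativeRing = ℝ-isCommutativeRing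
      ; ι-+ = λ p q → pointwise (fromℚ (p ℚ.+ q)) (fromℚ p + fromℚ q) λ _ → refl
      ; ι-* = λ p q → pointwise (fromℚ (p ℚ.* q)) (fromℚ p * fromℚ q) λ _ → refl
      ; ι-neg = λ p → pointwise (fromℚ (ℚ.- p)) (- fromℚ p) λ _ → refl
      ; ι-mono-< = fromℚ-mono-<
      ; ≤-reflexive = λ {x} {y} → ≈⇒≤ x y
      ; ≤-trans = λ {x} {y} {z} → ≤-trans x y z
      ; ≤-antisym = λ {x} {y} → ≤-antisym x y
      ; <⇒≤ = λ {x} {y} → <⇒≤ x y
      ; <-irrefl = λ {x} → <-irrefl x
      ; <-≤-trans = λ {x} {y} {z} → <-≤-trans x y z
      ; ≤-<-trans = λ {x} {y} {z} → ≤-<-trans x y z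
      ; compare = compare
      ; +-monoʳ-≤ = λ x {y} {z} → +-mono-≤ x x y z (≈⇒≤ x x (pointwise x x λ _ → refl))
      ; +-monoʳ-< = λ x {y} {z} → +-monoʳ-< x y z
      ; *-nonneg = λ {x} {y} → *-nonneg x y
      ; *-pos = λ {x} {y} → *-pos x y
      ; ι-below = λ {x} → fromℚ-below x
      ; ι-above = fromℚ-above
      ; complete = λ a h → Limit.L a h , Limit.converges a h
      }

-- Congruences, coprime representatives and the Chinese remainder theorem.

module Congruences where

  open ≡ using (refl; sym; trans; cong; subst; subst₂)

  coprime-*⁻ˡ : ∀ {m n q} → Coprime (m ℕ.* n) q → Coprime m q
  coprime-*⁻ˡ {m} {n} c (e∣m , e∣q) = c (∣-trans e∣m (m∣m*n n) , e∣q)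

  coprime-∣ : ∀ {n q K} → q ∣ K → Coprime n K → Coprime n q
  coprime-∣ q∣K c (e∣n , e∣q) = c (e∣n , ∣-trans e∣q q∣K)

  coprime-^ : ∀ {n q} → Coprime n q → ∀ j → Coprime (n ℕ.^ j) q
  coprime-^ c zero    (e∣1 , _) = ∣1⇒≡1 e∣1
  coprime-^ c (suc j) = coprime-* c (coprime-^ c j)

  coprime-abs-* : ∀ {a b q} → Coprime ℤ.∣ a ∣ q → Coprime ℤ.∣ b ∣ q → Coprime ℤ.∣ a ℤ.* b ∣ q
  coprime-abs-* {a} {b} {q} p r = subst (λ t → Coprime t q) (sym (ℤₚ.abs-* a b)) (coprime-* p r)

  ∣-shift : ∀ {e q a b} → e ∣ q → (ℤ.+ q) ∣ᶻ (a ℤ.- b) → e ∣ ℤ.∣ a ∣ → e ∣ ℤ.∣ b ∣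
  ∣-shift {e} {q} {a} {b} e∣q q∣a-b e∣a = ℤ∣.∣⇒∣ᵤ (subst ((ℤ.+ e) ∣ᶻ_) (cancel a b)
    (ℤ∣.∣m∣n⇒∣m-n (ℤ∣.∣ᵤ⇒∣ {ℤ.+ e} {a} e∣a) (ℤ∣.∣-trans (ℤ∣.∣ᵤ⇒∣ {ℤ.+ e} {ℤ.+ q} e∣q) q∣a-b)))
    where
    cancel : ∀ a b → a ℤ.- (a ℤ.- b) ≡ b
    cancel = solve-∀

  ∣-flip : ∀ {q} a b → (ℤ.+ q) ∣ᶻ (a ℤ.- b) → (ℤ.+ q) ∣ᶻ (b ℤ.- a)
  ∣-flip a b h = subst (_ ∣ᶻ_) (flip a b) (ℤ∣.∣m⇒∣-m h)
    where
    flip : ∀ a b → ℤ.- (a ℤ.- b) ≡ b ℤ.- a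
    flip = solve-∀

  ∣-chain : ∀ {q} a b c → (ℤ.+ q) ∣ᶻ (a ℤ.- b) → (ℤ.+ q) ∣ᶻ (b ℤ.- c) → (ℤ.+ q) ∣ᶻ (a ℤ.- c)
  ∣-chain a b c h k = subst (_ ∣ᶻ_) (chain a b c) (ℤ∣.∣m∣n⇒∣m+n h k)
    where
    chain : ∀ a b c → (a ℤ.- b) ℤ.+ (b ℤ.- c) ≡ a ℤ.- c
    chain = solve-∀

  ∣-product : ∀ {q} a a′ b b′ → (ℤ.+ q) ∣ᶻ (a ℤ.- a′) → (ℤ.+ q) ∣ᶻ (b ℤ.- b′) → (ℤ.+ q) ∣ᶻ (a ℤ.* b ℤ.- a′ ℤ.* b′)
  ∣-product a a′ b b′ h k = subst (_ ∣ᶻ_) (expand a a′ b b′) (ℤ∣.∣m∣n⇒∣m+n (ℤ∣.∣n⇒∣m*n a k) (ℤ∣.∣n⇒∣m*n b′ h))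
    where
    expand : ∀ a a′ b b′ → a ℤ.* (b ℤ.- b′) ℤ.+ b′ ℤ.* (a ℤ.- a′) ≡ a ℤ.* b ℤ.- a′ ℤ.* b′
    expand = solve-∀

  ∣-coarsen : ∀ {q Q} → q ∣ Q → ∀ {a} → (ℤ.+ Q) ∣ᶻ a → (ℤ.+ q) ∣ᶻ a
  ∣-coarsen q∣Q = ℤ∣.∣-trans (ℤ∣.∣ᵤ⇒∣ q∣Q)

  coprime-shift : ∀ {q a b} → (ℤ.+ q) ∣ᶻ (a ℤ.- b) → Coprime ℤ.∣ a ∣ q → Coprime ℤ.∣ b ∣ q
  coprime-shift {q} {a} {b} h c (e∣b , e∣q) = c (∣-shift {a = b} {b = a} e∣q (∣-flip a b h) e∣b , e∣q)

  -- A is what remains of K after removing all factors in common with n.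
  coprime-part : ∀ n K → .{{ℕ.NonZero K}} → ∃ λ A → Coprime A n × ∃ λ j → K ∣ A ℕ.* n ℕ.^ j
  coprime-part n K {{K≢0}} = <-rec P step K (ℕ.>-nonZero⁻¹ K)
    where
    P : ℕ → Set
    P K = 0 ℕ.< K → ∃ λ A → Coprime A n × ∃ λ j → K ∣ A ℕ.* n ℕ.^ j
    step : ∀ K → (∀ {K′} → K′ ℕ.< K → P K′) → P K
    step K rec 0<K with coprime? K n
    ... | yes c = K , c , 0 , subst (K ∣_) (sym (ℕₚ.*-identityʳ K)) ∣-refl
    ... | no ¬c with gcd[m,n]∣m K n
    -- Here K = K′ g with g = gcd K n > 1, so K′ is smaller. Since g divides n, K′ ∣ A n^j gives K ∣
    -- A n^(j + 1).
    ...   | ℕ∣.divides K′ eq =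
      let A , c , j , h = rec K′<K 0<K′ in
      A , c , suc j , subst₂ _∣_ (sym eq) (rearrange A (n ℕ.^ j))
        (ℕ∣.*-pres-∣ h (gcd[m,n]∣n K n))
      where
      g = gcd K n
      rearrange : ∀ A p → A ℕ.* p ℕ.* n ≡ A ℕ.* (n ℕ.* p)
      rearrange A p = trans (ℕₚ.*-assoc A p n) (cong (A ℕ.*_) (ℕₚ.*-comm p n))
      0<K′ : 0 ℕ.< K′
      0<K′ = ℕₚ.n≢0⇒n>0 λ { refl → ℕₚ.<-irrefl (sym eq) 0<K }
      1<g : 1 ℕ.< g
      1<g = ℕₚ.≤∧≢⇒< (ℕₚ.n≢0⇒n>0 λ g≡0 → ℕₚ.<-irrefl
          (sym (trans eq (trans (cong (K′ ℕ.*_) g≡0) (ℕₚ.*-zeroʳ K′)))) 0<K)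
        λ 1≡g → ¬c (Coprimality.gcd≡1⇒coprime (sym 1≡g))
      K′<K : K′ ℕ.< K
      K′<K = subst (K′ ℕ.<_) (sym eq) (ℕₚ.m<m*n K′ g {{ℕ.>-nonZero 0<K′}} 1<g)

  -- Take n′ = n + A q, with A the part of K coprime to n. A common divisor e of n′ and K is coprime
  -- to A, as a shared factor would divide n too; hence K ∣ A n^j yields e ∣ n^j. A common divisor
  -- of e and n divides A q, and therefore A, because n is coprime to q. So e is coprime to n^j as
  -- well, and e = 1.
  lift : ∀ n q K → .{{ℕ.NonZero K}} → Coprime ℤ.∣ n ∣ q →
    ∃ λ n′ → (ℤ.+ q) ∣ᶻ (n′ ℤ.- n) × Coprime ℤ.∣ n′ ∣ K
  lift n q K n⊥q = n′ , divides (ℤ.+ A) (difference n (ℤ.+ A) (ℤ.+ q)) , coprime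
    where
    A = proj₁ (coprime-part ℤ.∣ n ∣ K)
    A⊥n : Coprime A ℤ.∣ n ∣
    A⊥n = proj₁ (proj₂ (coprime-part ℤ.∣ n ∣ K))
    j = proj₁ (proj₂ (proj₂ (coprime-part ℤ.∣ n ∣ K)))
    K∣ : K ∣ A ℕ.* ℤ.∣ n ∣ ℕ.^ j
    K∣ = proj₂ (proj₂ (proj₂ (coprime-part ℤ.∣ n ∣ K)))
    n′ = n ℤ.+ ℤ.+ A ℤ.* ℤ.+ q
    difference : ∀ n a q → n ℤ.+ a ℤ.* q ℤ.- n ≡ a ℤ.* q
    difference = solve-∀
    A∣n′-n : (ℤ.+ A) ∣ᶻ (n′ ℤ.- n)
    A∣n′-n = divides (ℤ.+ q) (trans (difference n (ℤ.+ A) (ℤ.+ q)) (ℤₚ.*-comm (ℤ.+ A) (ℤ.+ q)))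
    coprime : Coprime ℤ.∣ n′ ∣ K
    coprime {e} (e∣n′ , e∣K) = coprime-^ (Coprimality.sym e⊥n) j (e∣n^j , ∣-refl)
      where
      e⊥A : Coprime e A
      e⊥A (f∣e , f∣A) = A⊥n (f∣A , ∣-shift {a = n′} {b = n} f∣A A∣n′-n (∣-trans f∣e e∣n′))
      e∣n^j : e ∣ ℤ.∣ n ∣ ℕ.^ j
      e∣n^j = coprime-divisor e⊥A (∣-trans e∣K K∣)
      e⊥n : Coprime e ℤ.∣ n ∣
      e⊥n {f} (f∣e , f∣n) = e⊥A (f∣e , f∣A)
        where
        f∣Aq : f ∣ A ℕ.* q
        f∣Aq = subst (f ∣_) (ℤₚ.abs-* (ℤ.+ A) (ℤ.+ q)) (ℤ∣.∣⇒∣ᵤ (subst ((ℤ.+ f) ∣ᶻ_) (difference n (ℤ.+ A) (ℤ.+ q))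
          (ℤ∣.∣m∣n⇒∣m-n (ℤ∣.∣ᵤ⇒∣ {ℤ.+ f} {n′} (∣-trans f∣e e∣n′)) (ℤ∣.∣ᵤ⇒∣ {ℤ.+ f} {n} f∣n))))
        f∣A : f ∣ A
        f∣A = coprime-divisor (λ (x∣f , x∣q) → n⊥q (∣-trans x∣f f∣n , x∣q)) (subst (f ∣_) (ℕₚ.*-comm A q) f∣Aq)

  bezout : ∀ m q → ∃ λ a → ∃ λ b → ℤ.+ gcd m q ≡ a ℤ.* ℤ.+ m ℤ.+ b ℤ.* ℤ.+ q
  bezout m q with Bézout.identity (gcd-GCD m q)
  ... | Bézout.+- x y eq = ℤ.+ x , ℤ.- ℤ.+ y , isolate (ℤ.+ gcd m q) (ℤ.+ x ℤ.* ℤ.+ m) (ℤ.+ y) (ℤ.+ q)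
      (trans (cong (ℤ._+_ (ℤ.+ gcd m q)) (sym (ℤₚ.pos-* y q))) (trans (cong ℤ.+_ eq) (ℤₚ.pos-* x m)))
    where
    isolate : ∀ g p y q → g ℤ.+ y ℤ.* q ≡ p → g ≡ p ℤ.+ (ℤ.- y) ℤ.* q
    isolate g p y q refl = cancel g y q
      where
      cancel : ∀ g y q → g ≡ g ℤ.+ y ℤ.* q ℤ.+ (ℤ.- y) ℤ.* q
      cancel = solve-∀
  ... | Bézout.-+ x y eq = ℤ.- ℤ.+ x , ℤ.+ y , isolate (ℤ.+ gcd m q) (ℤ.+ y ℤ.* ℤ.+ q) (ℤ.+ x) (ℤ.+ m)
      (trans (cong (ℤ._+_ (ℤ.+ gcd m q)) (sym (ℤₚ.pos-* x m))) (trans (cong ℤ.+_ eq) (ℤₚ.pos-* y q)))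
    where
    isolate : ∀ g p x m → g ℤ.+ x ℤ.* m ≡ p → g ≡ (ℤ.- x) ℤ.* m ℤ.+ p
    isolate g p x m refl = cancel g x m
      where
      cancel : ∀ g x m → g ≡ (ℤ.- x) ℤ.* m ℤ.+ (g ℤ.+ x ℤ.* m)
      cancel = solve-∀

  -- Writing gcd m q = x m + y q and b - a = t gcd m q, the solution a + t x m equals b - t y q.
  chineseRemainder : ∀ m q a b → (ℤ.+ gcd m q) ∣ᶻ (b ℤ.- a) →
    ∃ λ k → (ℤ.+ m) ∣ᶻ (k ℤ.- a) × (ℤ.+ q) ∣ᶻ (k ℤ.- b)
  chineseRemainder m q a b (divides t eq) =
    let x , y , g≡ = bezout m q in
    a ℤ.+ t ℤ.* x ℤ.* ℤ.+ m
    , divides (t ℤ.* x) (first a (t ℤ.* x) (ℤ.+ m))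
    , divides (ℤ.- (t ℤ.* y)) (second a b t x y (ℤ.+ m) (ℤ.+ q) (trans eq (cong (t ℤ.*_) g≡)))
    where
    first : ∀ a c m → a ℤ.+ c ℤ.* m ℤ.- a ≡ c ℤ.* m
    first = solve-∀
    second : ∀ a b t x y m q → b ℤ.- a ≡ t ℤ.* (x ℤ.* m ℤ.+ y ℤ.* q) →
      a ℤ.+ t ℤ.* x ℤ.* m ℤ.- b ≡ (ℤ.- (t ℤ.* y)) ℤ.* q
    second a b t x y m q h = trans (regroup a b (t ℤ.* x ℤ.* m)) (trans (cong (ℤ._-_ (t ℤ.* x ℤ.* m)) h) (expand t x y m q))
      where
      regroup : ∀ a b c → a ℤ.+ c ℤ.- b ≡ c ℤ.- (b ℤ.- a)
      regroup = solve-∀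
      expand : ∀ t x y m q → t ℤ.* x ℤ.* m ℤ.- t ℤ.* (x ℤ.* m ℤ.+ y ℤ.* q) ≡ (ℤ.- (t ℤ.* y)) ℤ.* q
      expand = solve-∀

open Congruences

-- Agreement off K, descent of characters and the conductor.

module Conductor (lem : ExcludedMiddle 0ℓ) where

  open ≡ using (refl; sym; trans; cong; cong₂; subst)

  open RealField

  infix 4 _≋_

  -- Wrapping ≈ᶜ in a record keeps its arguments inferable.
  record _≋_ (z w : ℂ) : Set where
    constructor wrap
    field unwrap : z ≈ᶜ w

  open _≋_ public

  ≋-refl : ∀ {z} → z ≋ z
  ≋-refl {z} = wrap (pointwise (re z) (re z) (λ _ → refl) , pointwise (im z) (im z) (λ _ → refl))

  ≋-sym : ∀ {z w} → z ≋ w → w ≋ z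
  ≋-sym {z} {w} (wrap (p , q)) = wrap (≈-sym (re z) (re w) p , ≈-sym (im z) (im w) q)

  infixr 4 _∙_
  _∙_ : ∀ {z w v} → z ≋ w → w ≋ v → z ≋ v
  _∙_ {z} {w} {v} (wrap (p , q)) (wrap (p′ , q′)) =
    wrap (≈-trans (re z) (re w) (re v) p p′ , ≈-trans (im z) (im w) (im v) q q′)

  *ᶜ-cong : ∀ {z z′ w w′} → z ≋ z′ → w ≋ w′ → z *ᶜ w ≋ z′ *ᶜ w′
  *ᶜ-cong {a +i b} {a′ +i b′} {c +i d} {c′ +i d′} (wrap (p , q)) (wrap (r , s)) = wrap
    ( +-cong (a * c) (a′ * c′) (- (b * d)) (- (b′ * d′)) (*-cong lem a a′ c c′ p r)
        (neg-cong (b * d) (b′ * d′) (*-cong lem b b′ d d′ q s))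
    , +-cong (a * d) (a′ * d′) (b * c) (b′ * c′) (*-cong lem a a′ d d′ p s) (*-cong lem b b′ c c′ q r))

  0*z : ∀ z → 0ℂ *ᶜ z ≋ 0ℂ
  0*z (a +i b) = wrap
    ( pointwise (0ℝ * a - 0ℝ * b) 0ℝ (λ n → trans (cong₂ (λ x y → x ℚ.+ ℚ.- y) (ℚₚ.*-zeroˡ (seq a n)) (ℚₚ.*-zeroˡ (seq b n))) refl)
    , pointwise (0ℝ * b + 0ℝ * a) 0ℝ (λ n → trans (cong₂ ℚ._+_ (ℚₚ.*-zeroˡ (seq b n)) (ℚₚ.*-zeroˡ (seq a n))) refl))

  z*0 : ∀ z → z *ᶜ 0ℂ ≋ 0ℂ
  z*0 (a +i b) = wrap
    ( pointwise (a * 0ℝ - b * 0ℝ) 0ℝ (λ n → trans (cong₂ (λ x y → x ℚ.+ ℚ.- y) (ℚₚ.*-zeroʳ (seq a n)) (ℚₚ.*-zeroʳ (seq b n))) refl)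
    , pointwise (a * 0ℝ + b * 0ℝ) 0ℝ (λ n → trans (cong₂ ℚ._+_ (ℚₚ.*-zeroʳ (seq a n)) (ℚₚ.*-zeroʳ (seq b n))) refl))

  ≡⇒≋ : ∀ χ {a b} → a ≡ b → ⟦ χ ⟧ a ≋ ⟦ χ ⟧ b
  ≡⇒≋ χ refl = ≋-refl

  periodic-+ : ∀ χ n k → ⟦ χ ⟧ (n ℤ.+ ℤ.+ k ℤ.* ℤ.+ modulus χ) ≋ ⟦ χ ⟧ n
  periodic-+ χ n zero = ≡⇒≋ χ (ℤₚ.+-identityʳ n)
  periodic-+ χ n (suc k) = ≡⇒≋ χ (step n (ℤ.+ k) (ℤ.+ modulus χ))
    ∙ wrap (periodic χ (n ℤ.+ ℤ.+ k ℤ.* ℤ.+ modulus χ)) ∙ periodic-+ χ n k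
    where
    step : ∀ n k q → n ℤ.+ (ℤ.+ 1 ℤ.+ k) ℤ.* q ≡ n ℤ.+ k ℤ.* q ℤ.+ q
    step = solve-∀

  congruent : ∀ χ a b → (ℤ.+ modulus χ) ∣ᶻ (a ℤ.- b) → ⟦ χ ⟧ a ≋ ⟦ χ ⟧ b
  congruent χ a b (divides (ℤ.+ k) eq) = ≡⇒≋ χ (trans (shift a b) (cong (ℤ._+_ b) eq)) ∙ periodic-+ χ b k
    where
    shift : ∀ a b → a ≡ b ℤ.+ (a ℤ.- b)
    shift = solve-∀
  congruent χ a b (divides ℤ.-[1+ k ] eq) = ≋-sym (≡⇒≋ χ (shift a b (ℤ.+ suc k) (ℤ.+ modulus χ) eq) ∙ periodic-+ χ a (suc k))
    where
    shift : ∀ a b k q → a ℤ.- b ≡ (ℤ.- k) ℤ.* q → b ≡ a ℤ.+ k ℤ.* q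
    shift a b k q h = trans (move a b) (trans (cong (ℤ._-_ a) h) (sign a k q))
      where
      move : ∀ a b → b ≡ a ℤ.- (a ℤ.- b)
      move = solve-∀
      sign : ∀ a k q → a ℤ.- (ℤ.- k) ℤ.* q ≡ a ℤ.+ k ℤ.* q
      sign = solve-∀

  Agree : ℕ → DirichletCharacter → DirichletCharacter → Set
  Agree K χ ψ = ∀ n → Coprime ℤ.∣ n ∣ K → ⟦ χ ⟧ n ≋ ⟦ ψ ⟧ n

  -- If χ mod m and ψ mod q agree off K, then the value χ n only depends on n modulo gcd m q
  -- for n coprime to K, so χ descends to a character modulo gcd m q.
  module Descent (χ ψ : DirichletCharacter) (K : ℕ) {{_ : ℕ.NonZero K}}
    (m∣K : modulus χ ∣ K) (q∣K : modulus ψ ∣ K) (agree : Agree K χ ψ) where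

    m q g : ℕ
    m = modulus χ
    q = modulus ψ
    g = gcd m q

    g∣m : g ∣ m
    g∣m = gcd[m,n]∣m m q

    -- Choose k congruent to a modulo m and to b modulo q. It is coprime to m q, so some l congruent
    -- to k modulo m q is coprime to K. Then χ a = χ l = ψ l = ψ b = χ b.
    well-defined : ∀ a b → Coprime ℤ.∣ a ∣ K → Coprime ℤ.∣ b ∣ K → (ℤ.+ g) ∣ᶻ (b ℤ.- a) → ⟦ χ ⟧ a ≋ ⟦ χ ⟧ b
    well-defined a b a⊥K b⊥K h =
        congruent χ a l (∣-chain a k l (∣-flip k a k≡a) (∣-flip l k (∣-coarsen (m∣m*n {m} q) l≡k)))
      ∙ agree l l⊥K
      ∙ congruent ψ l b (∣-chain l k b (∣-coarsen (n∣m*n m {q}) l≡k) k≡b)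
      ∙ ≋-sym (agree b b⊥K)
      where
      crt = chineseRemainder m q a b h
      k = proj₁ crt
      k≡a = proj₁ (proj₂ crt)
      k≡b = proj₂ (proj₂ crt)
      k⊥mq : Coprime ℤ.∣ k ∣ (m ℕ.* q)
      k⊥mq = Coprimality.sym (coprime-*
        (Coprimality.sym (coprime-shift {a = a} {k} (∣-flip k a k≡a) (coprime-∣ m∣K a⊥K)))
        (Coprimality.sym (coprime-shift {a = b} {k} (∣-flip k b k≡b) (coprime-∣ q∣K b⊥K))))
      lifted = lift k (m ℕ.* q) K k⊥mq
      l = proj₁ lifted
      l≡k = proj₁ (proj₂ lifted)
      l⊥K = proj₂ (proj₂ lifted)

    -- An integer coprime to g may share factors with K, so χ is evaluated at a representative
    -- coprime to K. The decision is an argument in order that proofs can split on it.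
    value : ∀ n → Dec (Coprime ℤ.∣ n ∣ g) → ℂ
    value n (yes c) = ⟦ χ ⟧ (proj₁ (lift n g K c))
    value n (no _)  = 0ℂ

    η : ℤ → ℂ
    η n = value n (coprime? ℤ.∣ n ∣ g)

    η-value : ∀ n a → (ℤ.+ g) ∣ᶻ (a ℤ.- n) → Coprime ℤ.∣ a ∣ K → η n ≋ ⟦ χ ⟧ a
    η-value n a a≡n a⊥K = go (coprime? ℤ.∣ n ∣ g)
      where
      go : ∀ c → value n c ≋ ⟦ χ ⟧ a
      go (yes c) = let b , b≡n , b⊥K = lift n g K c in well-defined b a b⊥K a⊥K (∣-chain a n b a≡n (∣-flip b n b≡n))
      go (no ¬c) = ⊥-elim (¬c (coprime-shift {a = a} {n} a≡n (coprime-∣ (∣-trans g∣m m∣K) a⊥K)))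

    η-zero : ∀ n → ¬ Coprime ℤ.∣ n ∣ g → η n ≋ 0ℂ
    η-zero n ¬c = go (coprime? ℤ.∣ n ∣ g)
      where
      go : ∀ c → value n c ≋ 0ℂ
      go (yes c) = ⊥-elim (¬c c)
      go (no _)  = ≋-refl

    [n+g]-n : ∀ n g → n ℤ.+ g ℤ.- n ≡ (ℤ.+ 1) ℤ.* g
    [n+g]-n = solve-∀

    η-periodic : ∀ n → η (n ℤ.+ ℤ.+ g) ≋ η n
    η-periodic n = go (coprime? ℤ.∣ n ∣ g)
      where
      n+g≡n : (ℤ.+ g) ∣ᶻ (n ℤ.+ ℤ.+ g ℤ.- n)
      n+g≡n = divides (ℤ.+ 1) ([n+g]-n n (ℤ.+ g))
      go : Dec (Coprime ℤ.∣ n ∣ g) → η (n ℤ.+ ℤ.+ g) ≋ η n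
      go (yes c) = let a , a≡n , a⊥K = lift n g K c in
        η-value (n ℤ.+ ℤ.+ g) a (∣-chain a n (n ℤ.+ ℤ.+ g) a≡n (∣-flip (n ℤ.+ ℤ.+ g) n n+g≡n)) a⊥K ∙ ≋-sym (η-value n a a≡n a⊥K)
      go (no ¬c) = η-zero (n ℤ.+ ℤ.+ g) (λ c → ¬c (coprime-shift {a = n ℤ.+ ℤ.+ g} {n} n+g≡n c)) ∙ ≋-sym (η-zero n ¬c)

    η-multiplicative : ∀ n n′ → η (n ℤ.* n′) ≋ η n *ᶜ η n′
    η-multiplicative n n′ = go (coprime? ℤ.∣ n ∣ g) (coprime? ℤ.∣ n′ ∣ g)
      where
      split : Coprime ℤ.∣ n ℤ.* n′ ∣ g → Coprime (ℤ.∣ n ∣ ℕ.* ℤ.∣ n′ ∣) g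
      split = subst (λ t → Coprime t g) (ℤₚ.abs-* n n′)
      go : Dec (Coprime ℤ.∣ n ∣ g) → Dec (Coprime ℤ.∣ n′ ∣ g) → η (n ℤ.* n′) ≋ η n *ᶜ η n′
      go (yes c) (yes c′) =
        let a , a≡n , a⊥K = lift n g K c
            b , b≡n′ , b⊥K = lift n′ g K c′
        in η-value (n ℤ.* n′) (a ℤ.* b) (∣-product a n b n′ a≡n b≡n′) (coprime-abs-* {a} {b} a⊥K b⊥K)
           ∙ wrap (multiplicative χ a b)
           ∙ ≋-sym (*ᶜ-cong (η-value n a a≡n a⊥K) (η-value n′ b b≡n′ b⊥K))
      go (no ¬c) _ = η-zero (n ℤ.* n′) (λ c → ¬c (coprime-*⁻ˡ {ℤ.∣ n ∣} {ℤ.∣ n′ ∣} (split c)))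
        ∙ ≋-sym (*ᶜ-cong {η n} {0ℂ} {η n′} {η n′} (η-zero n ¬c) ≋-refl ∙ 0*z (η n′))
      go (yes _) (no ¬c) = η-zero (n ℤ.* n′) (λ c → ¬c (coprime-*⁻ˡ {ℤ.∣ n′ ∣} {ℤ.∣ n ∣}
          (subst (λ t → Coprime t g) (ℕₚ.*-comm ℤ.∣ n ∣ ℤ.∣ n′ ∣) (split c))))
        ∙ ≋-sym (*ᶜ-cong {η n} {η n} {η n′} {0ℂ} ≋-refl (η-zero n′ ¬c) ∙ z*0 (η n))

    character : DirichletCharacter
    character = record
      { modulus         = g
      ; modulus-nonZero = ℕ.≢-nonZero (gcd[m,n]≢0 m q (inj₁ (ℕ.≢-nonZero⁻¹ m {{modulus-nonZero χ}})))
      ; ⟦_⟧             = η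
      ; periodic        = λ n → unwrap (η-periodic n)
      ; multiplicative  = λ n n′ → unwrap (η-multiplicative n n′)
      ; coprime⇒≉0      = λ n c h → let a , a≡n , a⊥K = lift n g K c in
          coprime⇒≉0 χ a (coprime-∣ m∣K a⊥K) (unwrap (≋-sym (η-value n a a≡n a⊥K) ∙ wrap {η n} {0ℂ} h))
      ; ¬coprime⇒≈0     = λ n ¬c → unwrap (η-zero n ¬c)
      }

    -- Moving n within its class modulo m to an integer coprime to K changes neither χ n nor η n.
    descends : Agree m χ character
    descends n n⊥m =
      let a , a≡n , a⊥K = lift n m K n⊥m in
      ≋-sym (η-value n a (∣-coarsen g∣m a≡n) a⊥K ∙ congruent χ a n a≡n)

  -- An equivalence relation that serves as `∼` without mention of primitive characters. The least
  -- modulus in a class is the conductor.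
  EventuallyAgree : DirichletCharacter → DirichletCharacter → Set
  EventuallyAgree χ ψ = ∃ λ K → ℕ.NonZero K × Agree K χ ψ

  agree-trans : ∀ {χ ψ ρ} → EventuallyAgree χ ψ → EventuallyAgree ψ ρ → EventuallyAgree χ ρ
  agree-trans (K , K≢0 , h) (L , L≢0 , k) = K ℕ.* L , ℕₚ.m*n≢0 K L {{K≢0}} {{L≢0}} , λ n c →
    h n (coprime-∣ (m∣m*n L) c) ∙ k n (coprime-∣ (n∣m*n K) c)

  agree-sym : ∀ {χ ψ} → EventuallyAgree χ ψ → EventuallyAgree ψ χ
  agree-sym (K , K≢0 , h) = K , K≢0 , λ n c → ≋-sym (h n c)

  -- Descent on the modulus starting from χ itself; excluded middle decides at each stage whether a
  -- smaller modulus occurs.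
  minimal : ∀ χ → ∃ λ χ* → EventuallyAgree χ χ* × (∀ ψ → EventuallyAgree χ ψ → modulus χ* ℕ.≤ modulus ψ)
  minimal χ = <-rec P step (modulus χ) χ refl (1 , _ , λ _ _ → ≋-refl)
    where
    P : ℕ → Set
    P n = ∀ ψ → modulus ψ ≡ n → EventuallyAgree χ ψ →
      ∃ λ χ* → EventuallyAgree χ χ* × (∀ ψ → EventuallyAgree χ ψ → modulus χ* ℕ.≤ modulus ψ)
    step : ∀ n → (∀ {k} → k ℕ.< n → P k) → P n
    step n rec ψ refl h with lem {∃ λ ψ′ → EventuallyAgree χ ψ′ × modulus ψ′ ℕ.< modulus ψ}
    ... | yes (ψ′ , h′ , lt) = rec lt ψ′ refl h′
    ... | no ∄ = ψ , h , λ ψ′ h′ → ℕₚ.≮⇒≥ λ lt → ∄ (ψ′ , h′ , lt)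

  minimal-∣ : ∀ {χ ψ} → EventuallyAgree χ ψ → (∀ ρ → EventuallyAgree χ ρ → modulus χ ℕ.≤ modulus ρ) →
    modulus χ ∣ modulus ψ
  minimal-∣ {χ} {ψ} (K , K≢0 , h) least = subst (_∣ q) g≡m (gcd[m,n]∣n m q)
    where
    m = modulus χ
    q = modulus ψ
    instance
      _ = K≢0
      m≢0 = modulus-nonZero χ
      q≢0 = modulus-nonZero ψ
      mq≢0 = ℕₚ.m*n≢0 m q
      Kmq≢0 = ℕₚ.m*n≢0 K (m ℕ.* q)
    -- K is enlarged to K m q, because the descent asks both moduli to divide it.
    open Descent χ ψ (K ℕ.* (m ℕ.* q)) (∣-trans (m∣m*n {m} q) (n∣m*n K)) (∣-trans (n∣m*n m {q}) (n∣m*n K))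
      (λ n c → h n (coprime-∣ (m∣m*n (m ℕ.* q)) c)) using (character; descends)
    g≡m : gcd m q ≡ m
    g≡m = ℕₚ.≤-antisym (∣⇒≤ (gcd[m,n]∣m m q)) (least character (m , m≢0 , descends))

  -- Agreement off K extends to every n coprime to the modulus of ψ: `lift` moves n within its class
  -- modulo that number to an integer coprime to K, and χ is constant on the class because its
  -- modulus divides that of ψ.
  agree⇒induces : ∀ {χ ψ} → EventuallyAgree χ ψ → modulus χ ∣ modulus ψ → Induces χ ψ
  agree⇒induces {χ} {ψ} (K , K≢0 , h) m∣q = m∣q , λ n n⊥q →
    let a , a≡n , a⊥K = lift n (modulus ψ) K {{K≢0}} n⊥q in
    unwrap (≋-sym (congruent ψ a n a≡n) ∙ ≋-sym (h a a⊥K) ∙ congruent χ a n (∣-coarsen m∣q a≡n))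

  agree⇒∼ : ∀ {χ₁ χ₂} → EventuallyAgree χ₁ χ₂ → χ₁ ∼ χ₂
  agree⇒∼ {χ₁} {χ₂} h = χ* , χ*-primitive , induces χ₁ h* , induces χ₂ (agree-trans {χ*} {χ₁} {χ₂} h* h)
    where
    χ* = proj₁ (minimal χ₁)
    h* : EventuallyAgree χ* χ₁
    h* = agree-sym {χ₁} {χ*} (proj₁ (proj₂ (minimal χ₁)))
    least : ∀ ρ → EventuallyAgree χ* ρ → modulus χ* ℕ.≤ modulus ρ
    least ρ k = proj₂ (proj₂ (minimal χ₁)) ρ (agree-trans {χ₁} {χ*} {ρ} (agree-sym {χ*} {χ₁} h*) k)
    induces : ∀ ψ → EventuallyAgree χ* ψ → Induces χ* ψ
    induces ψ k = agree⇒induces {χ*} {ψ} k (minimal-∣ {χ*} {ψ} k least)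
    χ*-primitive : IsPrimitive χ*
    χ*-primitive ψ (ψ∣ , k) = ℕₚ.≤-antisym (∣⇒≤ {{modulus-nonZero χ*}} ψ∣)
      (least ψ (modulus χ* , modulus-nonZero χ* , λ n c → wrap (k n c)))

  congruent-remainder : ∀ n d → .{{_ : ℕ.NonZero d}} → (ℤ.+ d) ∣ᶻ (n ℤ.- ℤ.+ (n ℤ%.%ℕ d))
  congruent-remainder n d = divides (n ℤ%./ℕ d) (trans (cong (ℤ._- r) (ℤ%.a≡a%ℕn+[a/ℕn]*n n d)) (cancel r (n ℤ%./ℕ d ℤ.* ℤ.+ d)))
    where
    r = ℤ.+ (n ℤ%.%ℕ d)
    cancel : ∀ r p → r ℤ.+ p ℤ.- r ≡ p
    cancel = solve-∀

  ≁⇒unit : ∀ {χ₁ χ₂} → ¬ (χ₁ ∼ χ₂) →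
    let d = lcm (modulus χ₁) (modulus χ₂) in {{ℕ.NonZero d}} →
    ∃ λ u → u ∈ units d × ¬ (⟦ χ₁ ⟧ (ℤ.+ u) ≈ᶜ ⟦ χ₂ ⟧ (ℤ.+ u))
  ≁⇒unit {χ₁} {χ₂} χ₁≁χ₂ {{d≢0}} with lem {∃ λ u → u ∈ units (lcm (modulus χ₁) (modulus χ₂)) × ¬ (⟦ χ₁ ⟧ (ℤ.+ u) ≈ᶜ ⟦ χ₂ ⟧ (ℤ.+ u))}
  ... | yes h = h
  ... | no ∄ = ⊥-elim (χ₁≁χ₂ (agree⇒∼ {χ₁} {χ₂} (d , d≢0 , agree)))
    where
    d = lcm (modulus χ₁) (modulus χ₂)
    agree : Agree d χ₁ χ₂
    agree n n⊥d with lem {⟦ χ₁ ⟧ (ℤ.+ (n ℤ%.%ℕ d)) ≈ᶜ ⟦ χ₂ ⟧ (ℤ.+ (n ℤ%.%ℕ d))}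
    ... | yes eq = congruent χ₁ n _ (∣-coarsen (m∣lcm[m,n] (modulus χ₁) (modulus χ₂)) (congruent-remainder n d))
      ∙ wrap eq ∙ ≋-sym (congruent χ₂ n _ (∣-coarsen (n∣lcm[m,n] (modulus χ₁) (modulus χ₂)) (congruent-remainder n d)))
    ... | no neq = ⊥-elim (∄ (n ℤ%.%ℕ d , ∈-units⁺ (ℤ%.n%ℕd<d n d)
      (coprime-shift {a = n} {ℤ.+ (n ℤ%.%ℕ d)} (congruent-remainder n d) n⊥d) , neq))

1/-suc : ∀ n → 1/ (suc n) ! ≡ recip n ℚ.* 1/ n !
1/-suc n = recip-* n (n ℕ.!) {{n ℕₚ.!≢0}} {{suc n ℕₚ.!≢0}}

-- Specialisation to the functions and characters of the statement.

module Bridge (lem : ExcludedMiddle 0ℓ) where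

  open ≡ using (refl)

  open Classical lem

  K : CompleteOrderedField
  K = RealField.ℝ-field lem

  module S = ExpSeries K
  module A = Analysis K

  -- A proof of existence rules out the default branch, and whichever witness `lem` supplies comes
  -- with its property.
  the-spec : ∀ P → Σ ℝ P → P (the P)
  the-spec P w with lem {Σ ℝ P}
  ... | yes (_ , p) = p
  ... | no ∄        = ⊥-elim (∄ w)

  lim-spec : ∀ a L → a S.⟶ L → a S.⟶ lim a
  lim-spec a L h = S.bounds⇒⟶ {a} {lim a} (the-spec (ConvergesTo a) (L , S.⟶⇒bounds {a} {L} h))

  pair : ℂ → S.Cx
  pair z = re z , im z

  -- Matches the series of the statement, built from powers and factorials, with the recursively
  -- defined terms of the abstract development.
  expSum-pair : ∀ z n → S.expSum (pair z) n S.≈ᶜ pair (expSum z n)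
  expSum-pair z zero    = S.mk (S.≈-refl {0ℝ}) (S.≈-refl {0ℝ})
  expSum-pair z (suc n) = S.ℂ.+-cong (expSum-pair z n) (S.ℂ.sym
    (S.scaled-powers 1/_! (λ n → pair (z ^ᶜ n)) refl 1/-suc (S.mk (S.≈-refl {1ℝ}) (S.≈-refl {0ℝ}))
      (λ n → S.mk (S.≈-refl {re (z *ᶜ (z ^ᶜ n))}) (S.≈-refl {im (z *ᶜ (z ^ᶜ n))})) n))

  expᶜ-limit : ∀ z → S.expSum (pair z) S.⟶ᶜ pair (expᶜ z)
  expᶜ-limit z =
    let L , S.tends p q = S.expSum-converges (pair z) in
    S.⟶ᶜ-seq-cong (λ n → S.ℂ.sym (expSum-pair z n)) (S.tends
      (lim-spec (λ n → re (expSum z n)) (proj₁ L) (S.⟶-seq-cong {λ n → S.re (S.expSum (pair z) n)} {λ n → re (expSum z n)} {proj₁ L} (λ n → S.re≈ (expSum-pair z n)) p))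
      (lim-spec (λ n → im (expSum z n)) (proj₂ L) (S.⟶-seq-cong {λ n → S.im (S.expSum (pair z) n)} {λ n → im (expSum z n)} {proj₂ L} (λ n → S.im≈ (expSum-pair z n)) q)))

  exp-limit : ∀ x → S.Sʳ.S (S.Sʳ.t x) S.⟶ exp x
  exp-limit x = S.⟶-seq-cong {λ n → S.re (S.expSum (x , S.0#) n)} {S.Sʳ.S (S.Sʳ.t x)} {exp x}
    (λ n → S.re≈ (S.expSum-real x n)) (S.re⟶ (expᶜ-limit (x +i 0ℝ)))

  module E = A.ExpFunction exp exp-limit

  log-spec : ∀ {x} → 0ℝ < x → exp (log x) ≈ x
  log-spec {x} 0<x = the-spec (λ y → exp y ≈ x) (E.log-exists {x} 0<x)

  inverse-spec : ∀ {x} → 0ℝ < x → x * x ⁻¹ ≈ 1ℝ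
  inverse-spec {x} 0<x = the-spec (λ y → x * y ≈ 1ℝ) (E.inverse-exists {x} 0<x)

  sqrt-spec : ∀ {x} → 0ℝ ≤ x → 0ℝ ≤ sqrt x × sqrt x * sqrt x ≈ x
  sqrt-spec {x} 0≤x = the-spec (λ y → 0ℝ ≤ y × y * y ≈ x) (E.sqrt-exists {x} 0≤x)

  ^-pos : ∀ {x} y → 0ℝ < x → x ^ y ≈ exp (y * log x)
  ^-pos {x} y 0<x with lem {0ℝ < x}
  ... | yes _  = S.≈-refl {exp (y * log x)}
  ... | no 0≮x = ⊥-elim (0≮x 0<x)

  ^-nonpos : ∀ {x} y → ¬ (0ℝ < x) → x ^ y ≈ 0ℝ
  ^-nonpos {x} y 0≮x with lem {0ℝ < x}
  ... | yes 0<x = ⊥-elim (0≮x 0<x)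
  ... | no _    = S.≈-refl {0ℝ}

  module P = A.PowerMean exp exp-limit log _⁻¹ sqrt _^_
    (λ {x} → log-spec {x}) (λ {x} → inverse-spec {x}) (λ {x} → sqrt-spec {x})
    (λ {x} → ^-pos {x}) (λ {x} → ^-nonpos {x})
    ∑ (λ f → S.≈-refl {0ℝ}) (λ a as f → S.≈-refl {f a + ∑ as f})

  module _ (χ₁ χ₂ : DirichletCharacter) (χ₁≁χ₂ : ¬ (χ₁ ∼ χ₂)) where

    private
      d : ℕ
      d = lcm (modulus χ₁) (modulus χ₂)

      instance
        d≢0 : ℕ.NonZero d
        d≢0 = ℕ.≢-nonZero λ d≡0 → ℕ.≢-nonZero⁻¹ (modulus χ₁ ℕ.* modulus χ₂)
          {{ℕₚ.m*n≢0 (modulus χ₁) (modulus χ₂) {{modulus-nonZero χ₁}} {{modulus-nonZero χ₂}}}}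
          (≡.trans (≡.sym (gcd*lcm (modulus χ₁) (modulus χ₂)))
            (≡.trans (≡.cong (gcd (modulus χ₁) (modulus χ₂) ℕ.*_) d≡0) (ℕₚ.*-zeroʳ (gcd (modulus χ₁) (modulus χ₂)))))

    module O = A.Orthogonality ∑ (λ f → S.≈-refl {0ℝ}) (λ a as f → S.≈-refl {f a + ∑ as f}) d
    module C = Conductor lem

    values : DirichletCharacter → ℕ → S.Cx
    values χ n = pair (⟦ χ ⟧ (ℤ.+ n))

    ≈ᶜ⇒ : ∀ {z w} → z C.≋ w → pair z S.≈ᶜ pair w
    ≈ᶜ⇒ (C.wrap (p , q)) = S.mk p q

    values-multiplicative : ∀ χ → O.Multiplicative (values χ)
    values-multiplicative χ m n = ≈ᶜ⇒ (C.≡⇒≋ χ (ℤₚ.pos-* m n) C.∙ C.wrap (multiplicative χ (ℤ.+ m) (ℤ.+ n)))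

    values-periodic : ∀ χ → modulus χ ∣ d → O.Periodic (values χ)
    values-periodic χ q∣d m n eq = ≈ᶜ⇒ (C.congruent χ (ℤ.+ m) (ℤ.+ n) (∣-coarsen q∣d
      (∣-chain (ℤ.+ m) (ℤ.+ (n % d)) (ℤ.+ n)
        (≡.subst (λ r → (ℤ.+ d) ∣ᶻ (ℤ.+ m ℤ.- ℤ.+ r)) eq (C.congruent-remainder (ℤ.+ m) d))
        (∣-flip (ℤ.+ n) (ℤ.+ (n % d)) (C.congruent-remainder (ℤ.+ n) d)))))

    values-nonzero : ∀ χ → modulus χ ∣ d → ∀ {u} → u ∈ units d → ¬ (values χ u S.≈ᶜ S.ιᶜ 0ℚ)
    values-nonzero χ q∣d {u} u∈ h = coprime⇒≉0 χ (ℤ.+ u) (coprime-∣ q∣d (proj₂ (∈-units⁻ u∈))) (S.re≈ h , S.im≈ h)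

    separating : ∃ λ u → u ∈ units d × ¬ (⟦ χ₁ ⟧ (ℤ.+ u) ≈ᶜ ⟦ χ₂ ⟧ (ℤ.+ u))
    separating = C.≁⇒unit {χ₁} {χ₂} χ₁≁χ₂

    module _ (θ₁ θ₂ : ℝ) where

      term : ℕ → ℂ
      term u = e^-i θ₁ *ᶜ ⟦ χ₁ ⟧ (ℤ.+ u) +ᶜ e^-i θ₂ *ᶜ ⟦ χ₂ ⟧ (ℤ.+ u)

      ∣term∣² : ℕ → ℝ
      ∣term∣² u = re (term u) * re (term u) + im (term u) * im (term u)

      e^-i-unit : ∀ θ → O.norm² (pair (e^-i θ)) ≈ 1ℝ
      e^-i-unit θ = E.unit-circle { - θ} {pair (e^-i θ)} (expᶜ-limit (0ℝ +i (- θ)))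

      ∑∣term∣² : ∑ (units d) ∣term∣² ≈ 2ℝ * fromℕ (φ d)
      ∑∣term∣² = O.second-moment {values χ₁} {values χ₂}
        (values-multiplicative χ₁) (values-multiplicative χ₂)
        (values-periodic χ₁ q₁∣d) (values-periodic χ₂ q₂∣d)
        (values-nonzero χ₁ q₁∣d) (values-nonzero χ₂ q₂∣d)
        {proj₁ separating} (proj₁ (proj₂ separating))
        (λ h → proj₂ (proj₂ separating) (S.re≈ h , S.im≈ h))
        {pair (e^-i θ₁)} {pair (e^-i θ₂)} (e^-i-unit θ₁) (e^-i-unit θ₂)
        where
        q₁∣d = m∣lcm[m,n] (modulus χ₁) (modulus χ₂)
        q₂∣d = n∣lcm[m,n] (modulus χ₁) (modulus χ₂)

      -- The separating unit shows that the list of units is not empty.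
      φ-pos : 0ℝ < fromℕ (φ d)
      φ-pos = member-pos (units d) (proj₁ (proj₂ separating))
        where
        member-pos : ∀ {u : ℕ} us → u ∈ us → S.0# S.< S.ν (length us)
        member-pos (_ ∷ us) _ = S.<-≤-trans {S.0#} {S.1#} {S.ν (suc (length us))} S.0<1 (S.1≤ν (length us))

      -- No conversion is left: `∣ term u ∣ᶜ` unfolds to the square root of `∣term∣² u`, and `ξ̃` to
      -- the expression that `P.ξ̃-bounds` estimates.
      result : ∀ σ → ½ < σ → σ < 1ℝ →
        (ξ̃ σ (χ₁ , χ₂) (θ₁ , θ₂) ≥ 2ℝ ^ (1ℝ ÷ (2ℝ * (1ℝ - σ)))) × (ξ̃ σ (χ₁ , χ₂) (θ₁ , θ₂) > 2ℝ)
      result σ ½<σ σ<1 = P.ξ̃-bounds σ ½<σ σ<1 (units d) ∣term∣² φ-pos (λ u → O.norm²-nonneg (pair (term u))) ∑∣term∣²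

theorem3 : (lem : ExcludedMiddle 0ℓ) →
    let open Classical lem in
    (σ : ℝ) → ½ < σ → σ < 1ℝ →
    (θ : ℝ × ℝ) →
    (χ₁ χ₂ : DirichletCharacter) → ¬ (χ₁ ∼ χ₂) →
    (ξ̃ σ (χ₁ , χ₂) θ ≥ 2ℝ ^ (1ℝ ÷ (2ℝ * (1ℝ - σ)))) ×
    (ξ̃ σ (χ₁ , χ₂) θ > 2ℝ)
theorem3 lem σ ½<σ σ<1 (θ₁ , θ₂) χ₁ χ₂ χ₁≁χ₂ = Bridge.result lem χ₁ χ₂ χ₁≁χ₂ θ₁ θ₂ σ ½<σ σ<1
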